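{- As $n\to\infty$, $$G_3(n)\leq \pi(n)+\pi(n/2)+n^{2/3}(\log n)^{2^{1/3}-1/3+o(1)},$$ where $G_3(n)$ denotes the maximal size of a set $A\subseteq\{1,2,\dots,n\}$ such that the equation $s_1s_2s_3=t_1t_2t_3$ has no solution with $s_1,s_2,s_3,t_1,t_2,t_3$ six pairwise distinct elements of $A$.
   Context: A set $A\subseteq\mathbb{N}$ (positive integers) is called a multiplicative $3$-Sidon set if the equation $s_1s_2s_3=t_1t_2t_3$ has no solution in $A$ consisting of distinct elements (all six of $s_1,s_2,s_3,t_1,t_2,t_3$ pairwise distinct). $G_3(n)$ is the maximal size of a multiplicative $3$-Sidon set contained in $\{1,2,\dots,n\}$. $\pi(x)$ is the number of primes not exceeding the real number $x$, and $\log$ is the natural logarithm. The symbol $o(1)$ denotes a function of $n$ tending to $0$ as $n\to\infty$; that is, the bound means: for every $\varepsilon>0$ there is $n_0$ such that for all integers $n\geq n_0$, $G_3(n)\leq \pi(n)+\pi(n/2)+n^{2/3}(\log n)^{2^{1/3}-1/3+\varepsilon}$. -}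

module Defs where

open import Data.Nat.Base as ℕ using (ℕ; zero; suc; _!)
import Data.Nat.Properties as ℕ
open import Data.Nat.Primality using (prime?)
open import Data.Integer.Base as ℤ using (+_)
import Data.Integer.Properties as ℤ
open import Data.Rational.Base using (ℚ; mkℚ; 0ℚ; 1ℚ; ½; _+_; _*_; _-_; -_; 1/_; _/_; ∣_∣; _≤_; _<_; *≤*; *<*; ↥_; toℚᵘ; positive; nonNegative; ≢-nonZero)
open import Data.Rational.Properties
open import Data.Rational.Literals using (fromℤ)
import Data.Rational.Unnormalised.Base as ℚᵘ
import Data.Rational.Unnormalised.Properties as ℚᵘ
open import Data.Rational.Solver using (module +-*-Solver)
open import Data.Fin.Base using (Fin; toℕ)
open import Data.Fin.Properties using (all?)
open import Data.Fin.Subset as Subset using (Subset; inside; outside; _∈_)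
open import Data.Fin.Subset.Properties using (_∈?_; ∉⊥; ∣⊥∣≡0)
open import Data.Vec.Base using ([]; _∷_)
open import Data.List.Base using (List; []; _∷_; _++_; map; filter; length; upTo)
open import Data.List.Extrema.Nat using (max; xs≤max; argmax-sel)
import Data.List.Membership.Propositional as List
open import Data.List.Membership.Propositional.Properties using (∈-map⁺; ∈-map⁻; ∈-++⁺ˡ; ∈-++⁺ʳ; ∈-filter⁺; ∈-filter⁻)
import Data.List.Relation.Unary.All as All
open import Data.List.Relation.Unary.Any using (here)
open import Data.List.Relation.Unary.Unique.Propositional using (Unique)
open import Data.List.Relation.Unary.Unique.DecPropositional ℕ._≟_ using (unique?)
open import Data.Product.Base using (∃-syntax; _×_; _,_; proj₁; proj₂)
open import Data.Sum.Base using (inj₁; inj₂)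
open import Level using (0ℓ)
open import Relation.Binary.PropositionalEquality
open import Relation.Nullary using (Dec; yes; no; contradiction)
open import Relation.Nullary.Decidable using (map′; toWitness; ¬?; _×-dec_; _→-dec_)
open import Relation.Unary using (Pred)

infixl 7 _*ℝ_
infixl 6 _+ℝ_ _-ℝ_
infix  4 _<ℝ_ _≤ℝ_
infix  8 -ℝ_
infixr 8 _^_

fromℕ : ℕ → ℚ
fromℕ n = fromℤ (+ n)

_^_ : ℚ → ℕ → ℚ
q ^ zero  = 1ℚ
q ^ suc k = q * q ^ k

∑< : ℕ → (ℕ → ℚ) → ℚ
∑< zero    f = 0ℚ
∑< (suc n) f = ∑< n f + f n

-- The total reciprocal, with inv 0 = 0.
inv : ℚ → ℚ
inv q with q ≟ 0ℚ
... | yes _  = 0ℚ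
... | no q≢0 = (1/ q) {{≢-nonZero q≢0}}

expCoeff : ℕ → ℚ
expCoeff k = (+ 1 / k !) {{k ℕ.!≢0}}

expApprox : ℕ → ℚ → ℚ
expApprox N q = ∑< N (λ k → expCoeff k * q ^ k)

-- log q = 2 artanh z = 2 z ∑ₖ z²ᵏ / (2k + 1) with z = (q - 1) / (q + 1), valid for all q > 0.
cayley : ℚ → ℚ
cayley q = (q - 1ℚ) * inv (q + 1ℚ)

artanhCoeff : ℕ → ℚ
artanhCoeff k = + 1 / suc (2 ℕ.* k)

logApprox : ℕ → ℚ → ℚ
logApprox N q = fromℕ 2 * z * ∑< N (λ k → artanhCoeff k * (z * z) ^ k)
  where z = cayley q

Cauchy : (ℕ → ℚ) → Set
Cauchy s = ∀ {ε} → 0ℚ < ε → ∃[ N ] (∀ m n → N ℕ.≤ m → N ℕ.≤ n → ∣ s m - s n ∣ ≤ ε)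

Eventually : (ℕ → Set) → Set
Eventually P = ∃[ N ] (∀ n → N ℕ.≤ n → P n)

⊔-≤ˡ : ∀ a b {m} → a ℕ.⊔ b ℕ.≤ m → a ℕ.≤ m
⊔-≤ˡ a b = ℕ.≤-trans (ℕ.m≤m⊔n a b)

⊔-≤ʳ : ∀ a b {m} → a ℕ.⊔ b ℕ.≤ m → b ℕ.≤ m
⊔-≤ʳ a b = ℕ.≤-trans (ℕ.m≤n⊔m a b)

_∧ᴱ_ : ∀ {P Q} → Eventually P → Eventually Q → Eventually (λ n → P n × Q n)
(M , p) ∧ᴱ (N , q) = M ℕ.⊔ N , λ n le →
  p n (ℕ.≤-trans (ℕ.m≤m⊔n M N) le) , q n (ℕ.≤-trans (ℕ.m≤n⊔m M N) le)

open +-*-Solver using (solve; _:=_; _:+_; _:*_; _:-_; :-_; con)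

*-mono : ∀ {a b c d} → 0ℚ ≤ a → a ≤ b → 0ℚ ≤ c → c ≤ d → a * c ≤ b * d
*-mono {a} {b} {c} {d} 0≤a a≤b 0≤c c≤d = ≤-trans
  (*-monoʳ-≤-nonNeg c {{nonNegative 0≤c}} a≤b)
  (*-monoˡ-≤-nonNeg b {{nonNegative (≤-trans 0≤a a≤b)}} c≤d)

*-pos : ∀ {a b} → 0ℚ < a → 0ℚ < b → 0ℚ < a * b
*-pos {a} {b} 0<a 0<b =
  positive⁻¹ (a * b) {{pos*pos⇒pos a {{positive 0<a}} b {{positive 0<b}}}}

*-nonNeg : ∀ {a b} → 0ℚ ≤ a → 0ℚ ≤ b → 0ℚ ≤ a * b
*-nonNeg {a} {b} 0≤a 0≤b =
  nonNegative⁻¹ (a * b) {{nonNeg*nonNeg⇒nonNeg a {{nonNegative 0≤a}} b {{nonNegative 0≤b}}}}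

+-nonNeg : ∀ {a b} → 0ℚ ≤ a → 0ℚ ≤ b → 0ℚ ≤ a + b
+-nonNeg 0≤a 0≤b = +-mono-≤ 0≤a 0≤b

≤-from-diff : ∀ {a b} → 0ℚ ≤ b - a → a ≤ b
≤-from-diff {a} {b} h = subst₂ _≤_ (+-identityˡ a)
  (solve 2 (λ a b → (b :- a) :+ a := b) refl a b) (+-monoˡ-≤ a h)

diff-nonNeg : ∀ {a b} → a ≤ b → 0ℚ ≤ b - a
diff-nonNeg {a} {b} h = subst (_≤ b - a) (+-inverseʳ a) (+-monoˡ-≤ (- a) h)

diff-pos : ∀ {a b} → a < b → 0ℚ < b - a
diff-pos {a} {b} h = subst (_< b - a) (+-inverseʳ a) (+-monoˡ-< (- a) h)

square-nonNeg : ∀ q → 0ℚ ≤ q * q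
square-nonNeg q with ≤-total 0ℚ q
... | inj₁ 0≤q = *-nonNeg 0≤q 0≤q
... | inj₂ q≤0 = subst (0ℚ ≤_) (solve 1 (λ q → (:- q) :* (:- q) := q :* q) refl q)
  (*-nonNeg (neg-antimono-≤ q≤0) (neg-antimono-≤ q≤0))

0<1 : 0ℚ < 1ℚ
0<1 = positive⁻¹ 1ℚ

half-pos : ∀ {ε} → 0ℚ < ε → 0ℚ < ½ * ε
half-pos = *-pos (positive⁻¹ ½)

half+half : ∀ ε → ½ * ε + ½ * ε ≡ ε
half+half ε = trans (sym (*-distribʳ-+ ε ½ ½)) (*-identityˡ ε)

inv-right : ∀ {q} → 0ℚ < q → q * inv q ≡ 1ℚ
inv-right {q} 0<q with q ≟ 0ℚ
... | yes q≡0 = contradiction (sym q≡0) (<⇒≢ 0<q)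
... | no q≢0  = *-inverseʳ q {{≢-nonZero q≢0}}

inv-pos : ∀ {q} → 0ℚ < q → 0ℚ < inv q
inv-pos {q} 0<q with q ≟ 0ℚ
... | yes q≡0 = contradiction (sym q≡0) (<⇒≢ 0<q)
... | no q≢0  = positive⁻¹ _ {{1/pos⇒pos q {{positive 0<q}}}}

shrink : ∀ {A ε} → 0ℚ < A → 0ℚ < ε → ∃[ δ ] (0ℚ < δ × A * δ ≤ ε)
shrink {A} {ε} 0<A 0<ε = inv A * ε , *-pos (inv-pos 0<A) 0<ε ,
  ≤-reflexive (trans (sym (*-assoc A (inv A) ε))
    (trans (cong (_* ε) (inv-right 0<A)) (*-identityˡ ε)))

recip-anti : ∀ {a b u v} → 0ℚ ≤ u → 0ℚ ≤ v → a * u ≡ 1ℚ → b * v ≡ 1ℚ → a ≤ b → v ≤ u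
recip-anti {a} {b} {u} {v} 0≤u 0≤v au bv a≤b = subst₂ _≤_
  (trans (solve 3 (λ a u v → a :* (u :* v) := (a :* u) :* v) refl a u v)
    (trans (cong (_* v) au) (*-identityˡ v)))
  (trans (solve 3 (λ b u v → b :* (u :* v) := (b :* v) :* u) refl b u v)
    (trans (cong (_* u) bv) (*-identityˡ u)))
  (*-monoʳ-≤-nonNeg (u * v) {{nonNegative (*-nonNeg 0≤u 0≤v)}} a≤b)

fromℕ-mono : ∀ {m n} → m ℕ.≤ n → fromℕ m ≤ fromℕ n
fromℕ-mono {m} {n} m≤n = *≤* (subst₂ ℤ._≤_ (sym (ℤ.*-identityʳ (+ m)))
  (sym (ℤ.*-identityʳ (+ n))) (ℤ.+≤+ m≤n))

fromℕ-mono-< : ∀ {m n} → m ℕ.< n → fromℕ m < fromℕ n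
fromℕ-mono-< {m} {n} m<n = *<* (subst₂ ℤ._<_ (sym (ℤ.*-identityʳ (+ m)))
  (sym (ℤ.*-identityʳ (+ n))) (ℤ.+<+ m<n))

fromℕ-* : ∀ m n → fromℕ (m ℕ.* n) ≡ fromℕ m * fromℕ n
fromℕ-* m n = toℚᵘ-injective (ℚᵘ.≃-trans
  (ℚᵘ.*≡* (cong (ℤ._* + 1) (ℤ.pos-* m n))) (ℚᵘ.≃-sym (toℚᵘ-homo-* (fromℕ m) (fromℕ n))))

fromℕ-suc : ∀ n → fromℕ (suc n) ≡ 1ℚ + fromℕ n
fromℕ-suc n = toℚᵘ-injective (ℚᵘ.≃-trans
  (ℚᵘ.*≡* (cong (ℤ._* + 1) (sym (cong (ℤ._+_ (+ 1)) (ℤ.*-identityʳ (+ n))))))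
  (ℚᵘ.≃-sym (toℚᵘ-homo-+ 1ℚ (fromℕ n))))

fromℕ-*-1/n : ∀ n .{{_ : ℕ.NonZero n}} → fromℕ n * (+ 1 / n) ≡ 1ℚ
fromℕ-*-1/n (suc k) = toℚᵘ-injective (ℚᵘ.≃-trans (toℚᵘ-homo-* (fromℕ (suc k)) (+ 1 / suc k))
  (ℚᵘ.≃-trans (ℚᵘ.*-congˡ {toℚᵘ (fromℕ (suc k))} (toℚᵘ-fromℚᵘ (ℚᵘ.mkℚᵘ (+ 1) k)))
    (ℚᵘ.*≡* (trans (ℤ.*-identityʳ _) (trans (ℤ.*-identityʳ (+ suc k)) (sym (trans (ℤ.*-identityˡ _) (cong (λ x → + suc x) (ℕ.+-identityʳ k)))))))))

1/n-pos : ∀ n .{{_ : ℕ.NonZero n}} → 0ℚ < + 1 / n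
1/n-pos n = positive⁻¹ _ {{normalize-pos 1 n}}

i≤∣i∣ : ∀ i → i ℤ.≤ + ℤ.∣ i ∣
i≤∣i∣ (+ n)        = ℤ.≤-refl
i≤∣i∣ ℤ.-[1+ n ] = ℤ.-≤+

archimedean : ∀ q → ∃[ n ] q ≤ fromℕ n
archimedean q@(mkℚ n d _) = ℤ.∣ n ∣ , *≤* (ℤ.≤-trans
  (subst (ℤ._≤ + ℤ.∣ n ∣) (sym (ℤ.*-identityʳ n)) (i≤∣i∣ n))
  (subst (+ ℤ.∣ n ∣ ℤ.≤_) (ℤ.pos-* ℤ.∣ n ∣ (suc d)) (ℤ.+≤+ (ℕ.m≤m*n ℤ.∣ n ∣ (suc d)))))

+-diff : ∀ a b c d → (a + b) - (c + d) ≡ (a - c) + (b - d)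
+-diff = solve 4 (λ a b c d → (a :+ b) :- (c :+ d) := (a :- c) :+ (b :- d)) refl

*-diff : ∀ a b c d → a * b - c * d ≡ a * (b - d) + d * (a - c)
*-diff = solve 4 (λ a b c d → a :* b :- c :* d := a :* (b :- d) :+ d :* (a :- c)) refl

inv-diff : ∀ a b i j → (i * j) * (b - a) ≡ i * (b * j) - j * (a * i)
inv-diff = solve 4 (λ a b i j → (i :* j) :* (b :- a) := i :* (b :* j) :- j :* (a :* i)) refl

three-diff : ∀ x y z w → x - w ≡ ((x - y) + (- (w - z))) + (y - z)
three-diff = solve 4 (λ x y z w → x :- w := ((x :- y) :+ (:- (w :- z))) :+ (y :- z)) refl

const-cauchy : ∀ q → Cauchy (λ _ → q)
const-cauchy q 0<ε = 0 , λ _ _ _ _ → subst (λ x → ∣ x ∣ ≤ _) (sym (+-inverseʳ q)) (<⇒≤ 0<ε)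

+-cauchy : ∀ s t → Cauchy s → Cauchy t → Cauchy (λ n → s n + t n)
+-cauchy s t cs ct {ε} 0<ε with cs (half-pos 0<ε) | ct (half-pos 0<ε)
... | M , p | N , q = M ℕ.⊔ N , λ m n le₁ le₂ → begin
  ∣ (s m + t m) - (s n + t n) ∣
    ≡⟨ cong ∣_∣ (+-diff (s m) (t m) (s n) (t n)) ⟩
  ∣ (s m - s n) + (t m - t n) ∣
    ≤⟨ ∣p+q∣≤∣p∣+∣q∣ (s m - s n) (t m - t n) ⟩
  ∣ s m - s n ∣ + ∣ t m - t n ∣
    ≤⟨ +-mono-≤ (p m n (ℕ.≤-trans (ℕ.m≤m⊔n M N) le₁) (ℕ.≤-trans (ℕ.m≤m⊔n M N) le₂))
                (q m n (ℕ.≤-trans (ℕ.m≤n⊔m M N) le₁) (ℕ.≤-trans (ℕ.m≤n⊔m M N) le₂)) ⟩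
  ½ * ε + ½ * ε
    ≡⟨ half+half ε ⟩
  ε ∎
  where open ≤-Reasoning

neg-cauchy : ∀ s → Cauchy s → Cauchy (λ n → - s n)
neg-cauchy s cs 0<ε with cs 0<ε
... | N , p = N , λ m n le₁ le₂ → subst (_≤ _)
  (trans (sym (∣-p∣≡∣p∣ (s m - s n)))
    (cong ∣_∣ (solve 2 (λ a b → :- (a :- b) := (:- a) :- (:- b)) refl (s m) (s n))))
  (p m n le₁ le₂)

cauchy-bounded : ∀ s → Cauchy s → ∃[ B ] (0ℚ < B × Eventually (λ n → ∣ s n ∣ ≤ B))
cauchy-bounded s cs with cs 0<1
... | N , p = 1ℚ + ∣ s N ∣ , +-mono-<-≤ 0<1 (0≤∣p∣ (s N)) ,
  N , λ n le → begin
    ∣ s n ∣                   ≡⟨ cong ∣_∣ (solve 2 (λ a b → a := (a :- b) :+ b) refl (s n) (s N)) ⟩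
    ∣ (s n - s N) + s N ∣     ≤⟨ ∣p+q∣≤∣p∣+∣q∣ (s n - s N) (s N) ⟩
    ∣ s n - s N ∣ + ∣ s N ∣   ≤⟨ +-monoˡ-≤ ∣ s N ∣ (p n N le ℕ.≤-refl) ⟩
    1ℚ + ∣ s N ∣              ∎
  where open ≤-Reasoning

*-close : ∀ {a b c d A B δ η} → ∣ a ∣ ≤ A → ∣ d ∣ ≤ B → ∣ b - d ∣ ≤ δ → ∣ a - c ∣ ≤ η →
          ∣ a * b - c * d ∣ ≤ A * δ + B * η
*-close {a} {b} {c} {d} {A} {B} {δ} {η} ha hd hbd hac = begin
  ∣ a * b - c * d ∣                         ≡⟨ cong ∣_∣ (*-diff a b c d) ⟩
  ∣ a * (b - d) + d * (a - c) ∣             ≤⟨ ∣p+q∣≤∣p∣+∣q∣ (a * (b - d)) (d * (a - c)) ⟩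
  ∣ a * (b - d) ∣ + ∣ d * (a - c) ∣         ≡⟨ cong₂ _+_ (∣p*q∣≡∣p∣*∣q∣ a (b - d)) (∣p*q∣≡∣p∣*∣q∣ d (a - c)) ⟩
  ∣ a ∣ * ∣ b - d ∣ + ∣ d ∣ * ∣ a - c ∣     ≤⟨ +-mono-≤ (*-mono (0≤∣p∣ a) ha (0≤∣p∣ (b - d)) hbd)
                                                        (*-mono (0≤∣p∣ d) hd (0≤∣p∣ (a - c)) hac) ⟩
  A * δ + B * η                             ∎
  where open ≤-Reasoning

*-cauchy : ∀ s t → Cauchy s → Cauchy t → Cauchy (λ n → s n * t n)
*-cauchy s t cs ct {ε} 0<ε =
  let A , 0<A , K , bs = cauchy-bounded s cs
      B , 0<B , L , bt = cauchy-bounded t ct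
      δ , 0<δ , Aδ = shrink 0<A (half-pos 0<ε)
      η , 0<η , Bη = shrink 0<B (half-pos 0<ε)
      M , p = ct 0<δ
      N , q = cs 0<η
      K≤ = λ m (h : K ℕ.⊔ L ℕ.⊔ (M ℕ.⊔ N) ℕ.≤ m) → ⊔-≤ˡ K L (⊔-≤ˡ (K ℕ.⊔ L) (M ℕ.⊔ N) h)
      L≤ = λ m (h : K ℕ.⊔ L ℕ.⊔ (M ℕ.⊔ N) ℕ.≤ m) → ⊔-≤ʳ K L (⊔-≤ˡ (K ℕ.⊔ L) (M ℕ.⊔ N) h)
      M≤ = λ m (h : K ℕ.⊔ L ℕ.⊔ (M ℕ.⊔ N) ℕ.≤ m) → ⊔-≤ˡ M N (⊔-≤ʳ (K ℕ.⊔ L) (M ℕ.⊔ N) h)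
      N≤ = λ m (h : K ℕ.⊔ L ℕ.⊔ (M ℕ.⊔ N) ℕ.≤ m) → ⊔-≤ʳ M N (⊔-≤ʳ (K ℕ.⊔ L) (M ℕ.⊔ N) h)
  in K ℕ.⊔ L ℕ.⊔ (M ℕ.⊔ N) , λ m n le₁ le₂ → ≤-trans
    (*-close {s m} {t m} {s n} {t n} (bs m (K≤ m le₁)) (bt n (L≤ n le₂)) (p m n (M≤ m le₁) (M≤ n le₂)) (q m n (N≤ m le₁) (N≤ n le₂)))
    (subst (A * δ + B * η ≤_) (half+half ε) (+-mono-≤ Aδ Bη))

inv-close : ∀ {a b δ η} → 0ℚ < δ → δ ≤ a → δ ≤ b → ∣ b - a ∣ ≤ η →
            ∣ inv a - inv b ∣ ≤ (inv δ * inv δ) * η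
inv-close {a} {b} {δ} {η} 0<δ δ≤a δ≤b h = begin
  ∣ inv a - inv b ∣
    ≡⟨ cong ∣_∣ (sym (trans (inv-diff a b (inv a) (inv b))
         (cong₂ _-_ (trans (cong (inv a *_) (inv-right 0<b)) (*-identityʳ (inv a)))
                    (trans (cong (inv b *_) (inv-right 0<a)) (*-identityʳ (inv b)))))) ⟩
  ∣ (inv a * inv b) * (b - a) ∣
    ≡⟨ ∣p*q∣≡∣p∣*∣q∣ (inv a * inv b) (b - a) ⟩
  ∣ inv a * inv b ∣ * ∣ b - a ∣
    ≡⟨ cong (_* ∣ b - a ∣) (0≤p⇒∣p∣≡p (*-nonNeg 0≤ia 0≤ib)) ⟩
  (inv a * inv b) * ∣ b - a ∣
    ≤⟨ *-mono (*-nonNeg 0≤ia 0≤ib) (*-mono 0≤ia ia≤j 0≤ib ib≤j) (0≤∣p∣ (b - a)) h ⟩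
  (inv δ * inv δ) * η ∎
  where
  open ≤-Reasoning
  0<a : 0ℚ < a
  0<a = <-≤-trans 0<δ δ≤a
  0<b : 0ℚ < b
  0<b = <-≤-trans 0<δ δ≤b
  0≤ia : 0ℚ ≤ inv a
  0≤ia = <⇒≤ (inv-pos 0<a)
  0≤ib : 0ℚ ≤ inv b
  0≤ib = <⇒≤ (inv-pos 0<b)
  ia≤j : inv a ≤ inv δ
  ia≤j = recip-anti (<⇒≤ (inv-pos 0<δ)) 0≤ia (inv-right 0<δ) (inv-right 0<a) δ≤a
  ib≤j : inv b ≤ inv δ
  ib≤j = recip-anti (<⇒≤ (inv-pos 0<δ)) 0≤ib (inv-right 0<δ) (inv-right 0<b) δ≤b

inv-cauchy : ∀ s {δ} → Cauchy s → 0ℚ < δ → Eventually (λ n → δ ≤ s n) → Cauchy (λ n → inv (s n))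
inv-cauchy s cs 0<δ (K , lb) 0<ε =
  let η , 0<η , jjη = shrink (*-pos (inv-pos 0<δ) (inv-pos 0<δ)) 0<ε
      N , p = cs 0<η
      K≤ = λ m (h : K ℕ.⊔ N ℕ.≤ m) → ⊔-≤ˡ K N h
      N≤ = λ m (h : K ℕ.⊔ N ℕ.≤ m) → ⊔-≤ʳ K N h
  in K ℕ.⊔ N , λ m n le₁ le₂ →
    ≤-trans (inv-close {s m} {s n} 0<δ (lb m (K≤ m le₁)) (lb n (K≤ n le₂)) (p n m (N≤ n le₂) (N≤ m le₁))) jjη

^-cauchy : ∀ s → Cauchy s → ∀ k → Cauchy (λ n → s n ^ k)
^-cauchy s cs zero    = const-cauchy 1ℚ
^-cauchy s cs (suc k) = *-cauchy s (λ n → s n ^ k) cs (^-cauchy s cs k)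

∑<-cauchy : ∀ (f : ℕ → ℕ → ℚ) → (∀ k → Cauchy (λ n → f n k)) → ∀ N → Cauchy (λ n → ∑< N (f n))
∑<-cauchy f cf zero    = const-cauchy 0ℚ
∑<-cauchy f cf (suc N) = +-cauchy (λ n → ∑< N (f n)) (λ n → f n N) (∑<-cauchy f cf N) (cf N)

^-nonNeg : ∀ {q} → 0ℚ ≤ q → ∀ k → 0ℚ ≤ q ^ k
^-nonNeg 0≤q zero    = <⇒≤ 0<1
^-nonNeg 0≤q (suc k) = *-nonNeg 0≤q (^-nonNeg 0≤q k)

∣q^k∣≤B^k : ∀ {q B} → ∣ q ∣ ≤ B → ∀ k → ∣ q ^ k ∣ ≤ B ^ k
∣q^k∣≤B^k h zero = ≤-refl
∣q^k∣≤B^k {q} {B} h (suc k) = subst (_≤ B * B ^ k) (sym (∣p*q∣≡∣p∣*∣q∣ q (q ^ k)))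
  (*-mono (0≤∣p∣ q) h (0≤∣p∣ (q ^ k)) (∣q^k∣≤B^k h k))

∑<-tail : ∀ {f t : ℕ → ℚ} → (∀ k → ∣ f k ∣ ≤ t k) → ∀ {N M} → N ℕ.≤′ M →
          ∣ ∑< M f - ∑< N f ∣ ≤ ∑< M t - ∑< N t
∑<-tail {f} {t} h {N} (ℕ.≤′-reflexive refl) = ≤-reflexive
  (trans (cong ∣_∣ (+-inverseʳ (∑< N f))) (sym (+-inverseʳ (∑< N t))))
∑<-tail {f} {t} h {N} (ℕ.≤′-step {M} le) = begin
  ∣ (∑< M f + f M) - ∑< N f ∣
    ≡⟨ cong ∣_∣ (solve 3 (λ a b c → (a :+ b) :- c := (a :- c) :+ b) refl (∑< M f) (f M) (∑< N f)) ⟩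
  ∣ (∑< M f - ∑< N f) + f M ∣
    ≤⟨ ∣p+q∣≤∣p∣+∣q∣ (∑< M f - ∑< N f) (f M) ⟩
  ∣ ∑< M f - ∑< N f ∣ + ∣ f M ∣
    ≤⟨ +-mono-≤ (∑<-tail h le) (h M) ⟩
  (∑< M t - ∑< N t) + t M
    ≡⟨ solve 3 (λ a b c → (a :- c) :+ b := (a :+ b) :- c) refl (∑< M t) (t M) (∑< N t) ⟩
  (∑< M t + t M) - ∑< N t ∎
  where open ≤-Reasoning

q≤∣q∣ : ∀ q → q ≤ ∣ q ∣
q≤∣q∣ q with ≤-total 0ℚ q
... | inj₁ 0≤q = ≤-reflexive (sym (0≤p⇒∣p∣≡p 0≤q))
... | inj₂ q≤0 = ≤-trans q≤0 (0≤∣p∣ q)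

powerSeries-tail : ∀ (a : ℕ → ℚ) {q B} → ∣ q ∣ ≤ B → ∀ {N M} → N ℕ.≤ M →
                   let f = λ k → a k * q ^ k; t = λ k → ∣ a k ∣ * B ^ k in
                   ∣ ∑< M f - ∑< N f ∣ ≤ ∣ ∑< M t - ∑< N t ∣
powerSeries-tail a {q} {B} h N≤M = ≤-trans (∑<-tail term (ℕ.≤⇒≤′ N≤M)) (q≤∣q∣ _)
  where
  term : ∀ k → ∣ a k * q ^ k ∣ ≤ ∣ a k ∣ * B ^ k
  term k = subst (_≤ ∣ a k ∣ * B ^ k) (sym (∣p*q∣≡∣p∣*∣q∣ (a k) (q ^ k)))
    (*-mono (0≤∣p∣ (a k)) ≤-refl (0≤∣p∣ (q ^ k)) (∣q^k∣≤B^k h k))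

three-close : ∀ {x y z w ε} → ∣ x - y ∣ ≤ ½ * (½ * ε) → ∣ w - z ∣ ≤ ½ * (½ * ε) → ∣ y - z ∣ ≤ ½ * ε → ∣ x - w ∣ ≤ ε
three-close {x} {y} {z} {w} {ε} h₁ h₂ h₃ = begin
  ∣ x - w ∣
    ≡⟨ cong ∣_∣ (three-diff x y z w) ⟩
  ∣ ((x - y) + (- (w - z))) + (y - z) ∣
    ≤⟨ ≤-trans (∣p+q∣≤∣p∣+∣q∣ ((x - y) + (- (w - z))) (y - z))
               (+-monoˡ-≤ ∣ y - z ∣ (∣p+q∣≤∣p∣+∣q∣ (x - y) (- (w - z)))) ⟩
  (∣ x - y ∣ + ∣ - (w - z) ∣) + ∣ y - z ∣
    ≡⟨ cong (λ u → (∣ x - y ∣ + u) + ∣ y - z ∣) (∣-p∣≡∣p∣ (w - z)) ⟩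
  (∣ x - y ∣ + ∣ w - z ∣) + ∣ y - z ∣
    ≤⟨ +-mono-≤ (+-mono-≤ h₁ h₂) h₃ ⟩
  (½ * (½ * ε) + ½ * (½ * ε)) + ½ * ε
    ≡⟨ cong (_+ ½ * ε) (half+half (½ * ε)) ⟩
  ½ * ε + ½ * ε
    ≡⟨ half+half ε ⟩
  ε ∎
  where open ≤-Reasoning

powerSeries-cauchy : ∀ (a s : ℕ → ℚ) {B} → Cauchy s → Eventually (λ n → ∣ s n ∣ ≤ B) →
                     Cauchy (λ N → ∑< N (λ k → ∣ a k ∣ * B ^ k)) →
                     Cauchy (λ n → ∑< n (λ k → a k * s n ^ k))
powerSeries-cauchy a s {B} cs (K , b) ct {ε} 0<ε =
  let L , tl = ct (half-pos (half-pos 0<ε))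
      M , p = ∑<-cauchy f
        (λ k → *-cauchy (λ _ → a k) (λ n → s n ^ k) (const-cauchy (a k)) (^-cauchy s cs k)) L (half-pos 0<ε)
      K≤ = λ m (h : K ℕ.⊔ L ℕ.⊔ M ℕ.≤ m) → ⊔-≤ˡ K L (⊔-≤ˡ (K ℕ.⊔ L) M h)
      L≤ = λ m (h : K ℕ.⊔ L ℕ.⊔ M ℕ.≤ m) → ⊔-≤ʳ K L (⊔-≤ˡ (K ℕ.⊔ L) M h)
      M≤ = λ m (h : K ℕ.⊔ L ℕ.⊔ M ℕ.≤ m) → ⊔-≤ʳ (K ℕ.⊔ L) M h
      tail = λ m h → ≤-trans (powerSeries-tail a (b m (K≤ m h)) (L≤ m h)) (tl m L (L≤ m h) ℕ.≤-refl)
  in K ℕ.⊔ L ℕ.⊔ M , λ m n le₁ le₂ →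
    three-close {∑< m (f m)} {∑< L (f m)} {∑< L (f n)} {∑< n (f n)} (tail m le₁) (tail n le₂) (p m n (M≤ m le₁) (M≤ n le₂))
  where
  f : ℕ → ℕ → ℚ
  f n k = a k * s n ^ k

∑<-mono : ∀ {t : ℕ → ℚ} → (∀ k → 0ℚ ≤ t k) → ∀ {N M} → N ℕ.≤′ M → ∑< N t ≤ ∑< M t
∑<-mono h (ℕ.≤′-reflexive refl) = ≤-refl
∑<-mono {t} h {N} (ℕ.≤′-step {M} le) = ≤-trans (∑<-mono h le)
  (subst (_≤ ∑< M t + t M) (+-identityʳ (∑< M t)) (+-monoʳ-≤ (∑< M t) (h M)))

between-close : ∀ {x y ε} → 0ℚ ≤ x → 0ℚ ≤ y → x ≤ ε → y ≤ ε → ∣ x - y ∣ ≤ ε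
between-close {x} {y} {ε} 0≤x 0≤y x≤ε y≤ε with ≤-total y x
... | inj₁ y≤x = subst (_≤ ε) (sym (0≤p⇒∣p∣≡p (diff-nonNeg y≤x)))
  (≤-trans (subst (x - y ≤_) (+-identityʳ x) (+-monoʳ-≤ x (neg-antimono-≤ 0≤y))) x≤ε)
... | inj₂ x≤y = subst (_≤ ε) (trans (sym (0≤p⇒∣p∣≡p (diff-nonNeg x≤y)))
    (trans (sym (∣-p∣≡∣p∣ (y - x))) (cong ∣_∣ (solve 2 (λ x y → :- (y :- x) := x :- y) refl x y))))
  (≤-trans (subst (y - x ≤_) (+-identityʳ y) (+-monoʳ-≤ y (neg-antimono-≤ 0≤x))) y≤ε)

ratio-diff : ∀ d a b u → d * ((a + b) - u) ≡ d * (a - u) + d * b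
ratio-diff = solve 4 (λ d a b u → d :* ((a :+ b) :- u) := d :* (a :- u) :+ d :* b) refl

ratio-step : ∀ r x y → (x - y) + (1ℚ - r) * y ≡ x - r * y
ratio-step = solve 3 (λ r x y → (x :- y) :+ (con 1ℚ :- r) :* y := x :- r :* y) refl

bernoulli-step : ∀ r j → (1ℚ + j * (1ℚ - r)) - r * (1ℚ + (1ℚ + j) * (1ℚ - r)) ≡ ((1ℚ + j) * ((1ℚ - r) * (1ℚ - r)))
bernoulli-step = solve 2 (λ r j →
  (con 1ℚ :+ j :* (con 1ℚ :- r)) :- r :* (con 1ℚ :+ (con 1ℚ :+ j) :* (con 1ℚ :- r))
  := (con 1ℚ :+ j) :* ((con 1ℚ :- r) :* (con 1ℚ :- r))) refl

fromℕ-nonNeg : ∀ n → 0ℚ ≤ fromℕ n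
fromℕ-nonNeg n = fromℕ-mono {0} {n} ℕ.z≤n

module RatioTest (t : ℕ → ℚ) (0≤t : ∀ k → 0ℚ ≤ t k) (r : ℚ) (0≤r : 0ℚ ≤ r) (r<1 : r < 1ℚ)
                 (K : ℕ) (ratio : ∀ k → K ℕ.≤ k → t (suc k) ≤ r * t k) where

  d : ℚ
  d = 1ℚ - r

  0<d : 0ℚ < d
  0<d = diff-pos r<1

  weight : ℕ → ℚ
  weight j = 1ℚ + fromℕ j * d

  0<weight : ∀ j → 0ℚ < weight j
  0<weight j = +-mono-<-≤ 0<1 (*-nonNeg (fromℕ-nonNeg j) (<⇒≤ 0<d))

  tail-bound : ∀ {N M} → K ℕ.≤ N → N ℕ.≤′ M → d * (∑< M t - ∑< N t) ≤ t N - t M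
  tail-bound {N} K≤N (ℕ.≤′-reflexive refl) = ≤-reflexive
    (trans (cong (d *_) (+-inverseʳ (∑< N t))) (trans (*-zeroʳ d) (sym (+-inverseʳ (t N)))))
  tail-bound {N} K≤N (ℕ.≤′-step {M} le) = begin
    d * ((∑< M t + t M) - ∑< N t)       ≡⟨ ratio-diff d (∑< M t) (t M) (∑< N t) ⟩
    d * (∑< M t - ∑< N t) + d * t M     ≤⟨ +-monoˡ-≤ (d * t M) (tail-bound K≤N le) ⟩
    (t N - t M) + d * t M               ≡⟨ ratio-step r (t N) (t M) ⟩
    t N - r * t M                       ≤⟨ +-monoʳ-≤ (t N) (neg-antimono-≤ (ratio M (ℕ.≤-trans K≤N (ℕ.≤′⇒≤ le)))) ⟩
    t N - t (suc M)                     ∎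
    where open ≤-Reasoning

  weight-step : ∀ j → r * weight (suc j) ≤ weight j
  weight-step j = ≤-from-diff (subst (0ℚ ≤_)
    (sym (trans (cong (λ u → weight j - r * (1ℚ + u * d)) (fromℕ-suc j)) (bernoulli-step r (fromℕ j))))
    (*-nonNeg (subst (0ℚ ≤_) (fromℕ-suc j) (fromℕ-nonNeg (suc j))) (*-nonNeg (<⇒≤ 0<d) (<⇒≤ 0<d))))

  decay : ∀ j → t (j ℕ.+ K) * weight j ≤ t K
  decay zero = ≤-reflexive (trans (cong (λ u → t K * (1ℚ + u)) (*-zeroˡ d)) (*-identityʳ (t K)))
  decay (suc j) = begin
    t (suc (j ℕ.+ K)) * weight (suc j)      ≤⟨ *-monoʳ-≤-nonNeg (weight (suc j)) {{nonNegative (<⇒≤ (0<weight (suc j)))}}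
                                                 (ratio (j ℕ.+ K) (ℕ.m≤n+m K j)) ⟩
    (r * t (j ℕ.+ K)) * weight (suc j)      ≡⟨ solve 3 (λ r t w → (r :* t) :* w := t :* (r :* w)) refl r (t (j ℕ.+ K)) (weight (suc j)) ⟩
    t (j ℕ.+ K) * (r * weight (suc j))      ≤⟨ *-monoˡ-≤-nonNeg (t (j ℕ.+ K)) {{nonNegative (0≤t (j ℕ.+ K))}} (weight-step j) ⟩
    t (j ℕ.+ K) * weight j                  ≤⟨ decay j ⟩
    t K                                     ∎
    where open ≤-Reasoning

  small : ∀ {η} → 0ℚ < η → ∃[ j ] t (j ℕ.+ K) ≤ η
  small {η} 0<η =
    let j , le = archimedean (t K * inv (η * d))
        0<ηd = *-pos 0<η 0<d
        tK≤ : t K ≤ η * weight j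
        tK≤ = begin
          t K                                ≡⟨ sym (trans (*-assoc (t K) (inv (η * d)) (η * d))
                                                  (trans (cong (t K *_) (trans (*-comm (inv (η * d)) (η * d)) (inv-right 0<ηd))) (*-identityʳ (t K)))) ⟩
          (t K * inv (η * d)) * (η * d)      ≤⟨ *-monoʳ-≤-nonNeg (η * d) {{nonNegative (<⇒≤ 0<ηd)}} le ⟩
          fromℕ j * (η * d)                  ≡⟨ solve 3 (λ j η d → j :* (η :* d) := η :* (j :* d)) refl (fromℕ j) η d ⟩
          η * (fromℕ j * d)                  ≤⟨ *-monoˡ-≤-nonNeg η {{nonNegative (<⇒≤ 0<η)}}
                                                  (subst (_≤ weight j) (+-identityˡ _) (+-monoˡ-≤ (fromℕ j * d) (<⇒≤ 0<1))) ⟩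
          η * weight j                       ∎
    in j , *-cancelʳ-≤-pos (weight j) {{positive (0<weight j)}} (≤-trans (decay j) tK≤)
    where open ≤-Reasoning

  ∑-cauchy : Cauchy (λ N → ∑< N t)
  ∑-cauchy {ε} 0<ε =
    let j , tN≤ = small (*-pos 0<d 0<ε)
        N = j ℕ.+ K
        lower = λ m (h : N ℕ.≤ m) → diff-nonNeg (∑<-mono 0≤t (ℕ.≤⇒≤′ h))
        upper = λ m (h : N ℕ.≤ m) → *-cancelˡ-≤-pos d {{positive 0<d}}
          (≤-trans (tail-bound (ℕ.m≤n+m K j) (ℕ.≤⇒≤′ h))
            (≤-trans (subst (t N - t m ≤_) (+-identityʳ (t N)) (+-monoʳ-≤ (t N) (neg-antimono-≤ (0≤t m)))) tN≤))
    in N , λ m n le₁ le₂ → subst (λ u → ∣ u ∣ ≤ ε)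
      (solve 3 (λ x y u → (x :- u) :- (y :- u) := x :- y) refl (∑< m t) (∑< n t) (∑< N t))
      (between-close (lower m le₁) (lower n le₂) (upper m le₁) (upper n le₂))

expCoeff-nonNeg : ∀ k → 0ℚ ≤ expCoeff k
expCoeff-nonNeg k = <⇒≤ (1/n-pos (k !) {{k ℕ.!≢0}})

expCoeff-suc : ∀ k → expCoeff (suc k) * fromℕ (suc k) ≡ expCoeff k
expCoeff-suc k = begin
  a′ * s                  ≡⟨ sym (*-identityʳ (a′ * s)) ⟩
  (a′ * s) * 1ℚ           ≡⟨ cong ((a′ * s) *_) (sym (fromℕ-*-1/n (k !) {{k ℕ.!≢0}})) ⟩
  (a′ * s) * (f * a)      ≡⟨ solve 4 (λ a′ s f a → (a′ :* s) :* (f :* a) := ((s :* f) :* a′) :* a) refl a′ s f a ⟩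
  ((s * f) * a′) * a      ≡⟨ cong (λ u → (u * a′) * a) (sym (fromℕ-* (suc k) (k !))) ⟩
  (fromℕ (suc k !) * a′) * a ≡⟨ cong (_* a) (fromℕ-*-1/n (suc k !) {{suc k ℕ.!≢0}}) ⟩
  1ℚ * a                  ≡⟨ *-identityˡ a ⟩
  a                       ∎
  where
  open ≡-Reasoning
  a a′ s f : ℚ
  a = expCoeff k
  a′ = expCoeff (suc k)
  s = fromℕ (suc k)
  f = fromℕ (k !)

exp-majorant-cauchy : ∀ {B} → 0ℚ ≤ B → Cauchy (λ N → ∑< N (λ k → ∣ expCoeff k ∣ * B ^ k))
exp-majorant-cauchy {B} 0≤B = RatioTest.∑-cauchy t
  (λ k → *-nonNeg (0≤∣p∣ (expCoeff k)) (^-nonNeg 0≤B k)) ½ (<⇒≤ (positive⁻¹ ½)) (toWitness {a? = ½ <? 1ℚ} _) K ratio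
  where
  t : ℕ → ℚ
  t k = ∣ expCoeff k ∣ * B ^ k
  K : ℕ
  K = proj₁ (archimedean (B + B))
  2B≤ : ∀ k → K ℕ.≤ k → B + B ≤ fromℕ (suc k)
  2B≤ k K≤k = ≤-trans (proj₂ (archimedean (B + B))) (fromℕ-mono (ℕ.m≤n⇒m≤1+n K≤k))
  coeff : ∀ k → K ℕ.≤ k → expCoeff (suc k) * B ≤ ½ * expCoeff k
  coeff k K≤k = begin
    a′ * B                       ≡⟨ cong (a′ *_) (sym (trans (*-distribˡ-+ ½ B B) (half+half B))) ⟩
    a′ * (½ * (B + B))           ≡⟨ solve 3 (λ a′ h B → a′ :* (h :* B) := h :* (a′ :* B)) refl a′ ½ (B + B) ⟩
    ½ * (a′ * (B + B))           ≤⟨ *-monoˡ-≤-nonNeg ½ (*-monoˡ-≤-nonNeg a′ {{nonNegative (expCoeff-nonNeg (suc k))}} (2B≤ k K≤k)) ⟩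
    ½ * (a′ * fromℕ (suc k))     ≡⟨ cong (½ *_) (expCoeff-suc k) ⟩
    ½ * expCoeff k               ∎
    where
    open ≤-Reasoning
    a′ : ℚ
    a′ = expCoeff (suc k)
  ratio : ∀ k → K ℕ.≤ k → t (suc k) ≤ ½ * t k
  ratio k K≤k = subst₂ _≤_
    (trans (*-assoc (expCoeff (suc k)) B (B ^ k))
      (cong (_* (B * B ^ k)) (sym (0≤p⇒∣p∣≡p (expCoeff-nonNeg (suc k))))))
    (trans (*-assoc ½ (expCoeff k) (B ^ k))
      (cong (λ u → ½ * (u * B ^ k)) (sym (0≤p⇒∣p∣≡p (expCoeff-nonNeg k)))))
    (*-monoʳ-≤-nonNeg (B ^ k) {{nonNegative (^-nonNeg 0≤B k)}} (coeff k K≤k))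

exp-cauchy : ∀ s → Cauchy s → Cauchy (λ n → expApprox n (s n))
exp-cauchy s cs =
  let B , 0<B , b = cauchy-bounded s cs
  in powerSeries-cauchy expCoeff s cs b (exp-majorant-cauchy (<⇒≤ 0<B))

artanhCoeff-nonNeg : ∀ k → 0ℚ ≤ artanhCoeff k
artanhCoeff-nonNeg k = <⇒≤ (1/n-pos (suc (2 ℕ.* k)))

artanhCoeff-suc : ∀ k → artanhCoeff (suc k) ≤ artanhCoeff k
artanhCoeff-suc k = recip-anti (artanhCoeff-nonNeg k) (artanhCoeff-nonNeg (suc k))
  (fromℕ-*-1/n (suc (2 ℕ.* k))) (fromℕ-*-1/n (suc (2 ℕ.* suc k)))
  (fromℕ-mono (ℕ.s≤s (ℕ.*-monoʳ-≤ 2 (ℕ.n≤1+n k))))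

artanh-majorant-cauchy : ∀ {r} → 0ℚ ≤ r → r < 1ℚ → Cauchy (λ N → ∑< N (λ k → ∣ artanhCoeff k ∣ * r ^ k))
artanh-majorant-cauchy {r} 0≤r r<1 = RatioTest.∑-cauchy t
  (λ k → *-nonNeg (0≤∣p∣ (artanhCoeff k)) (^-nonNeg 0≤r k)) r 0≤r r<1 0 ratio
  where
  t : ℕ → ℚ
  t k = ∣ artanhCoeff k ∣ * r ^ k
  ratio : ∀ k → 0 ℕ.≤ k → t (suc k) ≤ r * t k
  ratio k _ = subst₂ _≤_
    (cong (_* (r * r ^ k)) (sym (0≤p⇒∣p∣≡p (artanhCoeff-nonNeg (suc k)))))
    (trans (solve 3 (λ a r p → a :* (r :* p) := r :* (a :* p)) refl (artanhCoeff k) r (r ^ k))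
      (cong (λ u → r * (u * r ^ k)) (sym (0≤p⇒∣p∣≡p (artanhCoeff-nonNeg k)))))
    (*-monoʳ-≤-nonNeg (r * r ^ k) {{nonNegative (*-nonNeg 0≤r (^-nonNeg 0≤r k))}} (artanhCoeff-suc k))

cayley-identity : ∀ x i → (x + 1ℚ) * i ≡ 1ℚ →
                  ((x - 1ℚ) * i) * ((x - 1ℚ) * i) ≡ 1ℚ - (fromℕ 4 * x) * (i * i)
cayley-identity x i h = trans
  (solve 2 (λ x i → ((x :- con 1ℚ) :* i) :* ((x :- con 1ℚ) :* i)
     := ((x :+ con 1ℚ) :* i) :* ((x :+ con 1ℚ) :* i) :- (con (fromℕ 4) :* x) :* (i :* i)) refl x i)
  (cong (λ u → u * u - (fromℕ 4 * x) * (i * i)) h)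

module LogCauchy (s : ℕ → ℚ) (cs : Cauchy s) {δ : ℚ} (0<δ : 0ℚ < δ)
                 (lb : Eventually (λ n → δ ≤ s n)) where

  z : ℕ → ℚ
  z n = cayley (s n)

  one≤ : ∀ {q} → δ ≤ q → 1ℚ ≤ q + 1ℚ
  one≤ {q} h = subst (_≤ q + 1ℚ) (+-identityˡ 1ℚ) (+-monoˡ-≤ 1ℚ (≤-trans (<⇒≤ 0<δ) h))

  z-cauchy : Cauchy z
  z-cauchy = *-cauchy (λ n → s n - 1ℚ) (λ n → inv (s n + 1ℚ))
    (+-cauchy s (λ _ → - 1ℚ) cs (const-cauchy (- 1ℚ)))
    (inv-cauchy (λ n → s n + 1ℚ) (+-cauchy s (λ _ → 1ℚ) cs (const-cauchy 1ℚ)) 0<1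
      (proj₁ lb , λ n h → one≤ (proj₂ lb n h)))

  B : ℚ
  B = proj₁ (cauchy-bounded s cs)

  0<B+1 : 0ℚ < B + 1ℚ
  0<B+1 = +-mono-< (proj₁ (proj₂ (cauchy-bounded s cs))) 0<1

  j : ℚ
  j = inv (B + 1ℚ)

  gap : ℚ
  gap = (fromℕ 4 * δ) * (j * j)

  0<gap : 0ℚ < gap
  0<gap = *-pos (*-pos (fromℕ-mono-< {0} {4} (ℕ.s≤s ℕ.z≤n)) 0<δ) (*-pos (inv-pos 0<B+1) (inv-pos 0<B+1))

  bounds : Eventually (λ n → δ ≤ s n × ∣ s n ∣ ≤ B)
  bounds = lb ∧ᴱ proj₂ (proj₂ (cauchy-bounded s cs))

  z²≤1-gap : ∀ {q} → δ ≤ q → ∣ q ∣ ≤ B → cayley q * cayley q ≤ 1ℚ - gap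
  z²≤1-gap {q} δ≤q q≤B = subst (_≤ 1ℚ - gap) (sym (cayley-identity q i (inv-right 0<q+1)))
    (+-monoʳ-≤ 1ℚ (neg-antimono-≤ (*-mono
      (*-nonNeg (fromℕ-nonNeg 4) (<⇒≤ 0<δ)) (*-monoˡ-≤-nonNeg (fromℕ 4) δ≤q)
      (*-nonNeg 0≤j 0≤j) (*-mono 0≤j j≤i 0≤j j≤i))))
    where
    i : ℚ
    i = inv (q + 1ℚ)
    0<q+1 : 0ℚ < q + 1ℚ
    0<q+1 = <-≤-trans 0<1 (one≤ δ≤q)
    0≤j : 0ℚ ≤ j
    0≤j = <⇒≤ (inv-pos 0<B+1)
    j≤i : j ≤ i
    j≤i = recip-anti (<⇒≤ (inv-pos 0<q+1)) 0≤j (inv-right 0<q+1) (inv-right 0<B+1)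
      (+-monoˡ-≤ 1ℚ (≤-trans (q≤∣q∣ q) q≤B))

  r : ℚ
  r = 1ℚ - gap

  z²≤r : Eventually (λ n → ∣ z n * z n ∣ ≤ r)
  z²≤r = proj₁ bounds , λ n h → subst (_≤ r) (sym (0≤p⇒∣p∣≡p (square-nonNeg (z n))))
    (z²≤1-gap (proj₁ (proj₂ bounds n h)) (proj₂ (proj₂ bounds n h)))

  0≤r : 0ℚ ≤ r
  0≤r = ≤-trans (0≤∣p∣ _) (proj₂ z²≤r (proj₁ z²≤r) ℕ.≤-refl)

  r<1 : r < 1ℚ
  r<1 = subst (r <_) (+-identityʳ 1ℚ) (+-monoʳ-< 1ℚ (neg-antimono-< 0<gap))

  log-cauchy : Cauchy (λ n → logApprox n (s n))
  log-cauchy = *-cauchy (λ n → fromℕ 2 * z n) (λ n → ∑< n (λ k → artanhCoeff k * (z n * z n) ^ k))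
    (*-cauchy (λ _ → fromℕ 2) z (const-cauchy (fromℕ 2)) z-cauchy)
    (powerSeries-cauchy artanhCoeff (λ n → z n * z n) (*-cauchy z z z-cauchy z-cauchy) z²≤r
      (artanh-majorant-cauchy 0≤r r<1))

-- Constructive (Cauchy) reals; equality is the setoid equality induced by _≤ℝ_.
record ℝ : Set where
  constructor mkℝ
  field
    seq    : ℕ → ℚ
    cauchy : Cauchy seq

open ℝ

_<ℝ_ : ℝ → ℝ → Set
x <ℝ y = ∃[ δ ] (0ℚ < δ × Eventually (λ n → seq x n + δ ≤ seq y n))

_≤ℝ_ : ℝ → ℝ → Set
x ≤ℝ y = ∀ {ε} → 0ℚ < ε → Eventually (λ n → seq x n ≤ seq y n + ε)

ℚ⇒ℝ : ℚ → ℝ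
ℚ⇒ℝ q = mkℝ (λ _ → q) (const-cauchy q)

ℕ⇒ℝ : ℕ → ℝ
ℕ⇒ℝ n = ℚ⇒ℝ (fromℕ n)

0ℝ : ℝ
0ℝ = ℕ⇒ℝ 0

_+ℝ_ : ℝ → ℝ → ℝ
x +ℝ y = mkℝ (λ n → seq x n + seq y n) (+-cauchy (seq x) (seq y) (cauchy x) (cauchy y))

-ℝ_ : ℝ → ℝ
-ℝ x = mkℝ (λ n → - seq x n) (neg-cauchy (seq x) (cauchy x))

_-ℝ_ : ℝ → ℝ → ℝ
x -ℝ y = x +ℝ (-ℝ y)

_*ℝ_ : ℝ → ℝ → ℝ
x *ℝ y = mkℝ (λ n → seq x n * seq y n) (*-cauchy (seq x) (seq y) (cauchy x) (cauchy y))

exp : ℝ → ℝ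
exp x = mkℝ (λ n → expApprox n (seq x n)) (exp-cauchy (seq x) (cauchy x))

log : (x : ℝ) → 0ℝ <ℝ x → ℝ
log x (δ , 0<δ , N , lb) = mkℝ (λ n → logApprox n (seq x n))
  (LogCauchy.log-cauchy (seq x) (cauchy x) 0<δ
    (N , λ n N≤n → subst (_≤ seq x n) (+-identityˡ δ) (lb n N≤n)))

pow : (x : ℝ) → 0ℝ <ℝ x → ℝ → ℝ
pow x 0<x y = exp (y *ℝ log x 0<x)

ℕ⇒ℝ-pos : ∀ {n} → 0 ℕ.< n → 0ℝ <ℝ ℕ⇒ℝ n
ℕ⇒ℝ-pos {n} 0<n = fromℕ n , fromℕ-mono-< 0<n , 0 , λ _ _ → ≤-reflexive (+-identityˡ (fromℕ n))

1<n⇒0<n : ∀ {n} → 1 ℕ.< n → 0 ℕ.< n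
1<n⇒0<n = ℕ.<⇒≤

logℕ : ∀ n → 1 ℕ.< n → ℝ
logℕ n 1<n = log (ℕ⇒ℝ n) (ℕ⇒ℝ-pos (1<n⇒0<n 1<n))

logℕ-pos : ∀ n (1<n : 1 ℕ.< n) → 0ℝ <ℝ logℕ n 1<n
logℕ-pos n 1<n = fromℕ 2 * z , 0<2z , 1 , λ N 1≤N → subst₂ _≤_
  (trans (*-identityʳ (fromℕ 2 * z)) (sym (+-identityˡ (fromℕ 2 * z)))) refl
  (*-monoˡ-≤-nonNeg (fromℕ 2 * z) {{nonNegative (<⇒≤ 0<2z)}}
    (∑<-mono {λ k → artanhCoeff k * (z * z) ^ k}
      (λ k → *-nonNeg (artanhCoeff-nonNeg k) (^-nonNeg (square-nonNeg z) k)) (ℕ.≤⇒≤′ 1≤N)))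
  where
  z : ℚ
  z = cayley (fromℕ n)
  0<2z : 0ℚ < fromℕ 2 * z
  0<2z = *-pos (fromℕ-mono-< {0} {2} (ℕ.s≤s ℕ.z≤n))
    (*-pos (diff-pos (fromℕ-mono-< 1<n)) (inv-pos (+-mono-≤-< (fromℕ-nonNeg n) 0<1)))

-- Every prime p ≤ x satisfies p ≤ ∣ ↥ x ∣, so the range searched is large enough.
π : ℚ → ℕ
π x = length (filter (λ p → prime? p ×-dec (fromℕ p ≤? x)) (upTo (suc ℤ.∣ ↥ x ∣)))

Is3Sidon : Pred ℕ 0ℓ → Set
Is3Sidon A = ∀ {s₁ s₂ s₃ t₁ t₂ t₃} → A s₁ → A s₂ → A s₃ → A t₁ → A t₂ → A t₃ →
  Unique (s₁ ∷ s₂ ∷ s₃ ∷ t₁ ∷ t₂ ∷ t₃ ∷ []) →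
  s₁ ℕ.* s₂ ℕ.* s₃ ≢ t₁ ℕ.* t₂ ℕ.* t₃

-- Subset n encodes the subsets of {1, …, n}: the index i stands for the number i + 1.
value : ∀ {n} → Fin n → ℕ
value i = suc (toℕ i)

⟦_⟧ : ∀ {n} → Subset n → Pred ℕ 0ℓ
⟦ A ⟧ m = ∃[ i ] (i ∈ A × value i ≡ m)

is3Sidon? : ∀ {n} (A : Subset n) → Dec (Is3Sidon ⟦ A ⟧)
is3Sidon? {n} A = map′
  (λ { h (a , a∈ , refl) (b , b∈ , refl) (c , c∈ , refl) (d , d∈ , refl) (e , e∈ , refl) (f , f∈ , refl) →
       h a b c d e f a∈ b∈ c∈ d∈ e∈ f∈ })
  (λ h a b c d e f a∈ b∈ c∈ d∈ e∈ f∈ →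
     h (a , a∈ , refl) (b , b∈ , refl) (c , c∈ , refl) (d , d∈ , refl) (e , e∈ , refl) (f , f∈ , refl))
  (all? λ a → all? λ b → all? λ c → all? λ d → all? λ e → all? λ f →
    (a ∈? A) →-dec (b ∈? A) →-dec (c ∈? A) →-dec (d ∈? A) →-dec (e ∈? A) →-dec (f ∈? A) →-dec
    unique? (value a ∷ value b ∷ value c ∷ value d ∷ value e ∷ value f ∷ []) →-dec
    ¬? (value a ℕ.* value b ℕ.* value c ℕ.≟ value d ℕ.* value e ℕ.* value f))

subsets : ∀ n → List (Subset n)
subsets zero    = [] ∷ []
subsets (suc n) = map (inside ∷_) (subsets n) ++ map (outside ∷_) (subsets n)

G₃ : ℕ → ℕ
G₃ n = max 0 (map Subset.∣_∣ (filter is3Sidon? (subsets n)))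

∈-subsets : ∀ {n} (A : Subset n) → A List.∈ subsets n
∈-subsets []            = here refl
∈-subsets (inside ∷ A)  = ∈-++⁺ˡ (∈-map⁺ (inside ∷_) (∈-subsets A))
∈-subsets (outside ∷ A) = ∈-++⁺ʳ _ (∈-map⁺ (outside ∷_) (∈-subsets A))

G₃-upper : ∀ {n} (A : Subset n) → Is3Sidon ⟦ A ⟧ → Subset.∣ A ∣ ℕ.≤ G₃ n
G₃-upper {n} A h = All.lookup (xs≤max 0 (map Subset.∣_∣ (filter is3Sidon? (subsets n))))
  (∈-map⁺ Subset.∣_∣ (∈-filter⁺ is3Sidon? (∈-subsets A) h))

G₃-attained : ∀ n → ∃[ A ] (Is3Sidon ⟦ A ⟧ × Subset.∣ A ∣ ≡ G₃ n)
G₃-attained n with argmax-sel (λ k → k) 0 (map Subset.∣_∣ (filter is3Sidon? (subsets n)))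
... | inj₁ eq = Subset.⊥ , (λ { (i , i∈ , _) → contradiction i∈ ∉⊥ }) , trans (∣⊥∣≡0 n) (sym eq)
... | inj₂ G∈ with ∈-map⁻ Subset.∣_∣ G∈
... | A , A∈ , eq = A , proj₂ (∈-filter⁻ is3Sidon? {xs = subsets n} A∈) , sym eq

{-# OPTIONS --safe #-}
module Submission where

-- Each a ∈ A is written as u v with a chosen divisor v, making A the edge set of a bipartite graph; a hexagon
-- u₁ v₁ u₂ v₂ u₃ v₃ would give six distinct elements with s₁ s₂ s₃ = t₁ t₂ t₃, so the graph has no C₆. Put N = 2ʲ with
-- N³ ≤ n < 8 N³. If a prime p > N² divides a, let v = p: a C₆-free graph satisfies ∑ (deg p - 2)⁺ ≤ 2 |U|², and primes
-- p > n / 2 have degree at most 1, which yields π(n) + π(n/2) + O(N²). Otherwise either the primes of a below 2ᵏ have a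
-- subproduct v ∈ [N, 2ᵏ N), or those above have one in [N, N²], or a < N². The dyadic blocks of v are treated by the bound
-- e ≪ (|U| |V|)^(2/3) + |U| + |V|, in the linear form e ≤ (2 + α) |V| + (1 + β) |U| for 4 |U| < α² β. The first case has
-- only k blocks. In the second v is 2ᵏ-rough, and the densities of the 2ᵏ-rough numbers in k consecutive dyadic blocks
-- sum to O(1), because their products with the numbers below 2ᵏ are distinct. With k = 8ᵈ and 64ᵈ ≤ j < 64ᵈ⁺¹ the total
-- error is O(16ᵈ N²), that is n^(2/3) (log n)^(2/3) up to a constant, and 2^(1/3) - 1/3 > 5/6 > 2/3.

-- The window case costs k N². The rough case costs 2ᵈ (j / k) N² on the side of v and (j / 4ᵈ) N²
-- on the side of the cofactors. At j ≈ 64ᵈ and k = 8ᵈ none of these exceeds a constant times 16ᵈ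
-- N². The exponent 5/6 allows 32ᵈ N², so a factor 2ᵈ is left over; it absorbs every constant once d
-- ≥ 14, and all estimates can afford to be crude. The linear form of the graph bound keeps α and β
-- as powers of two (times 8), so no fractional power occurs in the counting. The right-hand side of
-- the theorem only has to be bounded from below, and rational lower bounds suffice: log (n + 1) ≥
-- 1/2 + ⋯ + 1/(n + 1) and exp (∑ hᵢ) ≥ ∏ (1 + hᵢ). Both follow from Bernoulli's inequality applied
-- to the series term by term. The products ∏ (1 + c/m) replace c-th powers; they are compared with
-- integers after raising to an integer power, factor by factor.

module Finite where

  open import Defs using (fromℕ; π; Is3Sidon; ⟦_⟧; G₃; G₃-attained)
  open import Data.Nat.Base
  open import Data.Nat.Properties
  open import Data.Nat.Divisibility
  open import Data.Nat.Coprimality using (Coprime; coprime-divisor; prime⇒coprime)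
  open import Data.Nat.Primality using (Prime; prime?; prime⇒nonZero)
  open import Data.Nat.Primality.Factorisation using (PrimeFactorisation; factorise)
  open import Data.Nat.ListAction using (product)
  open import Data.Nat.Solver using (module +-*-Solver)
  open import Data.List.Base using (List; []; _∷_; length; filter; map; upTo; applyUpTo)
  open import Data.List.Properties using (length-map; length-applyUpTo; length-upTo)
  open import Data.List.Membership.Propositional using (_∈_; find; lose)
  open import Data.List.Membership.DecPropositional _≟_ using (_∈?_)
  open import Data.List.Membership.Propositional.Properties using (∈-filter⁺; ∈-filter⁻; ∈-map⁻; ∈-applyUpTo⁺; ∈-applyUpTo⁻; ∈-upTo⁺; ∈-upTo⁻)
  open import Data.List.Relation.Unary.All as All using (All; []; _∷_)
  import Data.List.Relation.Unary.All.Properties as All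
  open import Data.List.Relation.Unary.Any as Any using (Any; here; there)
  open import Data.List.Relation.Unary.Unique.Propositional using (Unique; []; _∷_)
  import Data.List.Relation.Unary.Unique.Propositional.Properties as Unique
  open import Data.Product.Base using (∃-syntax; _×_; _,_; proj₁; proj₂)
  open import Data.Sum.Base using (_⊎_; inj₁; inj₂)
  open import Data.Empty using (⊥; ⊥-elim)
  open import Function.Base using (_∘_; id; flip)
  open import Level using (0ℓ)
  open import Relation.Binary.PropositionalEquality hiding (J)
  open import Relation.Nullary using (Dec; yes; no; ¬_; contradiction)
  open import Relation.Nullary.Decidable using (¬?; _×-dec_; map′)
  open import Relation.Unary using (Pred; Decidable)

  -- Finite sums and indicator counts

  private variable
    A A′ P Q R : Set

  ∑ : List A → (A → ℕ) → ℕ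
  ∑ []       f = 0
  ∑ (x ∷ xs) f = f x + ∑ xs f

  ind : Dec P → ℕ
  ind (yes _) = 1
  ind (no _)  = 0

  ind-yes : (d : Dec P) → P → ind d ≡ 1
  ind-yes (yes _) p = refl
  ind-yes (no ¬p) p = contradiction p ¬p

  ind-no : (d : Dec P) → ¬ P → ind d ≡ 0
  ind-no (yes p) ¬p = contradiction p ¬p
  ind-no (no _)  ¬p = refl

  ind≤1 : (d : Dec P) → ind d ≤ 1
  ind≤1 (yes _) = s≤s z≤n
  ind≤1 (no _)  = z≤n

  ind-pos : (d : Dec P) → 1 ≤ ind d → P
  ind-pos (yes p) _ = p

  ind≤ : (d : Dec P) {m : ℕ} → (P → 1 ≤ m) → ind d ≤ m
  ind≤ (yes p) h = h p
  ind≤ (no _)  h = z≤n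

  ind-mono : (d : Dec P) (e : Dec Q) → (P → Q) → ind d ≤ ind e
  ind-mono d e h = ind≤ d (λ p → ≤-reflexive (sym (ind-yes e (h p))))

  -- A union bound: this is how every three-way case distinction enters a sum.
  cover : (d : Dec P) (e : Dec Q) (f : Dec R) → P ⊎ Q ⊎ R → 1 ≤ ind d + (ind e + ind f)
  cover d e f (inj₁ p)        = m≤n⇒m≤n+o (ind e + ind f) (≤-reflexive (sym (ind-yes d p)))
  cover d e f (inj₂ (inj₁ q)) = m≤n⇒m≤o+n (ind d) (m≤n⇒m≤n+o (ind f) (≤-reflexive (sym (ind-yes e q))))
  cover d e f (inj₂ (inj₂ r)) = m≤n⇒m≤o+n (ind d) (m≤n⇒m≤o+n (ind e) (≤-reflexive (sym (ind-yes f r))))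

  ∑-mono : ∀ (xs : List A) {f g : A → ℕ} → (∀ x → x ∈ xs → f x ≤ g x) → ∑ xs f ≤ ∑ xs g
  ∑-mono []       h = z≤n
  ∑-mono (x ∷ xs) h = +-mono-≤ (h x (here refl)) (∑-mono xs (λ z z∈ → h z (there z∈)))

  ∑-cong : ∀ (xs : List A) {f g : A → ℕ} → (∀ x → f x ≡ g x) → ∑ xs f ≡ ∑ xs g
  ∑-cong []       h = refl
  ∑-cong (x ∷ xs) h = cong₂ _+_ (h x) (∑-cong xs h)

  ∑-zero : ∀ (xs : List A) → ∑ xs (λ _ → 0) ≡ 0
  ∑-zero []       = refl
  ∑-zero (x ∷ xs) = ∑-zero xs

  ∑-+ : ∀ (xs : List A) (f g : A → ℕ) → ∑ xs (λ x → f x + g x) ≡ ∑ xs f + ∑ xs g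
  ∑-+ []       f g = refl
  ∑-+ (x ∷ xs) f g = trans (cong (f x + g x +_) (∑-+ xs f g))
    (solve 4 (λ a b c d → (a :+ b) :+ (c :+ d) := (a :+ c) :+ (b :+ d)) refl (f x) (g x) (∑ xs f) (∑ xs g))
    where open +-*-Solver

  ∑-*ˡ : ∀ (xs : List A) c (f : A → ℕ) → ∑ xs (λ x → c * f x) ≡ c * ∑ xs f
  ∑-*ˡ []       c f = sym (*-zeroʳ c)
  ∑-*ˡ (x ∷ xs) c f = trans (cong (c * f x +_) (∑-*ˡ xs c f)) (sym (*-distribˡ-+ c (f x) (∑ xs f)))

  ∑-*ʳ : ∀ (xs : List A) c (f : A → ℕ) → ∑ xs (λ x → f x * c) ≡ ∑ xs f * c
  ∑-*ʳ xs c f = trans (∑-cong xs (λ x → *-comm (f x) c)) (trans (∑-*ˡ xs c f) (*-comm c (∑ xs f)))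

  ∑-const : ∀ (xs : List A) c → ∑ xs (λ _ → c) ≡ length xs * c
  ∑-const []       c = refl
  ∑-const (x ∷ xs) c = cong (c +_) (∑-const xs c)

  ∑-one : ∀ (xs : List A) → ∑ xs (λ _ → 1) ≡ length xs
  ∑-one xs = trans (∑-const xs 1) (*-identityʳ (length xs))

  ∑-swap : ∀ (xs : List A) (ys : List A′) (f : A → A′ → ℕ) →
           ∑ xs (λ x → ∑ ys (f x)) ≡ ∑ ys (λ y → ∑ xs (λ x → f x y))
  ∑-swap []       ys f = sym (∑-zero ys)
  ∑-swap (x ∷ xs) ys f = trans (cong (∑ ys (f x) +_) (∑-swap xs ys f))
    (sym (∑-+ ys (f x) (λ y → ∑ xs (λ z → f z y))))

  ∑-∈ : ∀ {xs : List A} (f : A → ℕ) {x} → x ∈ xs → f x ≤ ∑ xs f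
  ∑-∈ f {x} (here refl)         = m≤m+n (f x) _
  ∑-∈ {xs = z ∷ _} f (there x∈) = ≤-trans (∑-∈ f x∈) (m≤n+m _ (f z))

  ∑-pos : ∀ (xs : List A) (f : A → ℕ) → 1 ≤ ∑ xs f → ∃[ x ] (x ∈ xs × 1 ≤ f x)
  ∑-pos (x ∷ xs) f h with f x in eq
  ... | suc m = x , here refl , subst (1 ≤_) (sym eq) (s≤s z≤n)
  ... | zero  with ∑-pos xs f h
  ...   | z , z∈ , p = z , there z∈ , p

  ∑-filter : ∀ {P : Pred A 0ℓ} (P? : Decidable P) (xs : List A) (f : A → ℕ) →
             ∑ (filter P? xs) f ≡ ∑ xs (λ x → ind (P? x) * f x)
  ∑-filter P? []       f = refl
  ∑-filter P? (x ∷ xs) f with P? x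
  ... | yes _ = cong₂ _+_ (sym (+-identityʳ (f x))) (∑-filter P? xs f)
  ... | no _  = ∑-filter P? xs f

  length-filter : ∀ {P : Pred A 0ℓ} (P? : Decidable P) (xs : List A) →
                  length (filter P? xs) ≡ ∑ xs (λ x → ind (P? x))
  length-filter P? xs = trans (sym (∑-one (filter P? xs)))
    (trans (∑-filter P? xs (λ _ → 1)) (∑-cong xs (λ x → *-identityʳ _)))

  ∑-unique : ∀ {xs : List A} (f : A → ℕ) → Unique xs → (∀ x → x ∈ xs → f x ≤ 1) →
             (∀ {x y} → x ∈ xs → y ∈ xs → 1 ≤ f x → 1 ≤ f y → x ≡ y) → ∑ xs f ≤ 1
  ∑-unique f [] h u = z≤n
  ∑-unique {xs = x ∷ xs} f (x∉ ∷ un) h u with f x in eq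
  ... | zero = ∑-unique f un (λ z z∈ → h z (there z∈)) (λ a b → u (there a) (there b))
  ... | suc m = subst (_≤ 1) (sym (trans (cong (suc m +_) rest) (+-identityʳ (suc m))))
                  (subst (_≤ 1) eq (h x (here refl)))
    where
    rest : ∑ xs f ≡ 0
    rest with ∑ xs f in eq′
    ... | zero = refl
    ... | suc _ with ∑-pos xs f (subst (1 ≤_) (sym eq′) (s≤s z≤n))
    ...   | z , z∈ , p = contradiction
              (u (here refl) (there z∈) (subst (1 ≤_) (sym eq) (s≤s z≤n)) p) (All.lookup x∉ z∈)

  ∑-unique-ind : ∀ {P : Pred A 0ℓ} (P? : Decidable P) {xs : List A} → Unique xs →
                 (∀ {x y} → x ∈ xs → y ∈ xs → P x → P y → x ≡ y) → ∑ xs (λ x → ind (P? x)) ≤ 1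
  ∑-unique-ind P? un h = ∑-unique (λ x → ind (P? x)) un (λ x _ → ind≤1 (P? x))
    (λ {x} {y} a b p q → h a b (ind-pos (P? x) p) (ind-pos (P? y) q))

  ∑-≡≤1 : ∀ a {xs} → Unique xs → ∑ xs (λ x → ind (x ≟ a)) ≤ 1
  ∑-≡≤1 a un = ∑-unique-ind (_≟ a) un (λ _ _ p q → trans p (sym q))

  -- Each of `a` and `b` removes at most one entry of a list without repetitions. It supplies
  -- hexagon vertices that avoid those already chosen.
  third : ∀ {P : Pred ℕ 0ℓ} (P? : Decidable P) {xs} → Unique xs → 3 ≤ ∑ xs (λ x → ind (P? x)) →
          ∀ a b → ∃[ x ] (x ∈ xs × P x × x ≢ a × x ≢ b)
  third {P} P? {xs} un h a b =
    let x , x∈ , p = ∑-pos xs (λ x → ind (R? x)) one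
        px , na , nb = ind-pos (R? x) p
    in x , x∈ , px , na , nb
    where
    R? : Decidable (λ x → P x × x ≢ a × x ≢ b)
    R? x = P? x ×-dec ¬? (x ≟ a) ×-dec ¬? (x ≟ b)
    cases : ∀ x → P x → (P x × x ≢ a × x ≢ b) ⊎ x ≡ a ⊎ x ≡ b
    cases x p with x ≟ a | x ≟ b
    ... | yes x≡a | _       = inj₂ (inj₁ x≡a)
    ... | no _    | yes x≡b = inj₂ (inj₂ x≡b)
    ... | no x≢a  | no x≢b  = inj₁ (p , x≢a , x≢b)
    one : 1 ≤ ∑ xs (λ x → ind (R? x))
    one = +-cancelʳ-≤ 2 1 _ (begin
      3 ≤⟨ h ⟩
      ∑ xs (λ x → ind (P? x)) ≤⟨ ∑-mono xs (λ x _ → ind≤ (P? x) (λ p → cover (R? x) (x ≟ a) (x ≟ b) (cases x p))) ⟩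
      ∑ xs (λ x → ind (R? x) + (ind (x ≟ a) + ind (x ≟ b))) ≡⟨ ∑-+ xs _ _ ⟩
      ∑ xs (λ x → ind (R? x)) + ∑ xs (λ x → ind (x ≟ a) + ind (x ≟ b))
        ≡⟨ cong (∑ xs (λ x → ind (R? x)) +_) (∑-+ xs _ _) ⟩
      ∑ xs (λ x → ind (R? x)) + (∑ xs (λ x → ind (x ≟ a)) + ∑ xs (λ x → ind (x ≟ b)))
        ≤⟨ +-monoʳ-≤ _ (+-mono-≤ (∑-≡≤1 a un) (∑-≡≤1 b un)) ⟩
      ∑ xs (λ x → ind (R? x)) + 2 ∎)
      where open ≤-Reasoning

  infixl 6 _∖_

  _∖_ : List ℕ → ℕ → List ℕ
  xs ∖ x = filter (λ z → ¬? (z ≟ x)) xs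

  ∑-∖ : ∀ {xs x} (f : ℕ → ℕ) → Unique xs → x ∈ xs → ∑ xs f ≤ f x + ∑ (xs ∖ x) f
  ∑-∖ {xs} {x} f un x∈ = begin
    ∑ xs f ≤⟨ ∑-mono xs split ⟩
    ∑ xs (λ z → ind (z ≟ x) * f x + ind (¬? (z ≟ x)) * f z) ≡⟨ ∑-+ xs _ _ ⟩
    ∑ xs (λ z → ind (z ≟ x) * f x) + ∑ xs (λ z → ind (¬? (z ≟ x)) * f z)
      ≡⟨ cong₂ _+_ (∑-*ʳ xs (f x) _) (sym (∑-filter (λ z → ¬? (z ≟ x)) xs f)) ⟩
    ∑ xs (λ z → ind (z ≟ x)) * f x + ∑ (xs ∖ x) f
      ≤⟨ +-monoˡ-≤ _ (*-monoˡ-≤ (f x) (∑-≡≤1 x un)) ⟩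
    1 * f x + ∑ (xs ∖ x) f ≡⟨ cong (_+ ∑ (xs ∖ x) f) (*-identityˡ (f x)) ⟩
    f x + ∑ (xs ∖ x) f ∎
    where
    open ≤-Reasoning
    split : ∀ z → z ∈ xs → f z ≤ ind (z ≟ x) * f x + ind (¬? (z ≟ x)) * f z
    split z _ with z ≟ x
    ... | yes refl = ≤-trans (≤-reflexive (sym (*-identityˡ (f x)))) (m≤m+n _ _)
    ... | no _     = ≤-reflexive (sym (+-identityʳ (f z)))

  length-∖ : ∀ {xs x} → Unique xs → x ∈ xs → suc (length (xs ∖ x)) ≤ length xs
  length-∖ {xs} {x} un x∈ = begin
    suc (length (xs ∖ x)) ≡⟨ cong suc (length-filter _ xs) ⟩
    suc (∑ xs (λ z → ind (¬? (z ≟ x)))) ≤⟨ +-monoˡ-≤ _ here′ ⟩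
    ∑ xs (λ z → ind (z ≟ x)) + ∑ xs (λ z → ind (¬? (z ≟ x))) ≡⟨ sym (∑-+ xs _ _) ⟩
    ∑ xs (λ z → ind (z ≟ x) + ind (¬? (z ≟ x))) ≤⟨ ∑-mono xs (λ z _ → split z) ⟩
    ∑ xs (λ _ → 1) ≡⟨ ∑-one xs ⟩
    length xs ∎
    where
    open ≤-Reasoning
    here′ : 1 ≤ ∑ xs (λ z → ind (z ≟ x))
    here′ = subst (_≤ ∑ xs (λ z → ind (z ≟ x))) (ind-yes (x ≟ x) refl) (∑-∈ (λ z → ind (z ≟ x)) x∈)
    split : ∀ z → ind (z ≟ x) + ind (¬? (z ≟ x)) ≤ 1
    split z with z ≟ x
    ... | yes _ = s≤s z≤n
    ... | no _  = s≤s z≤n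

  -- C₆-free bipartite graphs

  C₆-Free : (ℕ → ℕ → Set) → Set
  C₆-Free E = ∀ {x₁ x₂ x₃ y₁ y₂ y₃} → x₁ ≢ x₂ → x₁ ≢ x₃ → x₂ ≢ x₃ → y₁ ≢ y₂ → y₁ ≢ y₃ → y₂ ≢ y₃ →
    E x₁ y₁ → E x₂ y₁ → E x₂ y₂ → E x₃ y₂ → E x₃ y₃ → E x₁ y₃ → ⊥

  module Bipartite {E : ℕ → ℕ → Set} (E? : ∀ x y → Dec (E x y)) (c₆ : C₆-Free E) where

    open ≤-Reasoning

    e : List ℕ → List ℕ → ℕ
    e X Y = ∑ X (λ x → ∑ Y (λ y → ind (E? x y)))

    deg : List ℕ → ℕ → ℕ
    deg Y x = ∑ Y (λ y → ind (E? x y))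

    deg′ : List ℕ → ℕ → ℕ
    deg′ X y = ∑ X (λ x → ind (E? x y))

    codeg : List ℕ → ℕ → ℕ → ℕ
    codeg Y x x′ = ∑ Y (λ y → ind (E? x y ×-dec E? x′ y))

    -- If z ≠ z′, three common neighbours leave room for y₂ ≠ y joining z to x and then y₃ ∉ {y, y₂}
    -- joining x to z′, and z y₂ x y₃ z′ y is a hexagon.
    3≤codeg⇒≡ : ∀ {Y y x z z′} → Unique Y → E x y → E z y → E z′ y → z ≢ x → z′ ≢ x →
                3 ≤ codeg Y x z → 3 ≤ codeg Y x z′ → z ≡ z′
    3≤codeg⇒≡ {Y} {y} {x} {z} {z′} un xy zy z′y z≢x z′≢x c c′ with z ≟ z′
    ... | yes z≡z′ = z≡z′
    ... | no z≢z′ =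
      let y₂ , _ , (xy₂ , zy₂) , y₂≢y , _ = third (λ y → E? x y ×-dec E? z y) un c y y
          y₃ , _ , (xy₃ , z′y₃) , y₃≢y , y₃≢y₂ = third (λ y → E? x y ×-dec E? z′ y) un c′ y y₂
      in ⊥-elim (c₆ z≢x z≢z′ (≢-sym z′≢x) (≢-sym y₃≢y₂) y₂≢y y₃≢y zy₂ xy₂ xy₃ z′y₃ z′y zy)

    -- At most one z ∈ N(y) has codegree ≥ 3 with a given x ∈ N(y), so N(y) is full of pairs lying in at most two neighbourhoods.
    ∑-excess : ∀ {X Y} → Unique X → Unique Y →
               ∑ Y (λ y → deg′ X y ∸ 2) ≤ 2 * (length X * length X)
    ∑-excess {X} {Y} uX uY = begin
      ∑ Y (λ y → deg′ X y ∸ 2)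
        ≤⟨ ∑-mono Y (λ y _ → excess y) ⟩
      ∑ Y (λ y → ∑ X (λ x → ∑ X (λ z → ind (F? y x z))))
        ≡⟨ ∑-swap Y X _ ⟩
      ∑ X (λ x → ∑ Y (λ y → ∑ X (λ z → ind (F? y x z))))
        ≡⟨ ∑-cong X (λ x → ∑-swap Y X _) ⟩
      ∑ X (λ x → ∑ X (λ z → ∑ Y (λ y → ind (F? y x z))))
        ≤⟨ ∑-mono X (λ x _ → ∑-mono X (λ z _ → few x z)) ⟩
      ∑ X (λ x → ∑ X (λ z → 2))
        ≡⟨ ∑-cong X (λ x → ∑-const X 2) ⟩
      ∑ X (λ x → length X * 2)
        ≡⟨ ∑-const X (length X * 2) ⟩
      length X * (length X * 2)
        ≡⟨ trans (sym (*-assoc (length X) (length X) 2)) (*-comm (length X * length X) 2) ⟩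
      2 * (length X * length X) ∎
      where
      F? : ∀ y x z → Dec (E x y × E z y × codeg Y x z ≤ 2)
      F? y x z = E? x y ×-dec E? z y ×-dec (codeg Y x z ≤? 2)
      few : ∀ x z → ∑ Y (λ y → ind (F? y x z)) ≤ 2
      few x z with codeg Y x z ≤? 2
      ... | yes c≤2 = ≤-trans (∑-mono Y (λ y _ → ind-mono (E? x y ×-dec E? z y ×-dec yes c≤2) (E? x y ×-dec E? z y)
                        (λ (p , q , _) → p , q))) c≤2
      ... | no c≰2 = ≤-trans (∑-mono Y (λ y _ → ≤-reflexive (ind-no (E? x y ×-dec E? z y ×-dec no c≰2)
                        (λ (_ , _ , r) → c≰2 r)))) (≤-trans (≤-reflexive (∑-zero Y)) z≤n)
      G? : ∀ y x z → Dec (E z y × z ≢ x × 3 ≤ codeg Y x z)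
      G? y x z = E? z y ×-dec ¬? (z ≟ x) ×-dec (3 ≤? codeg Y x z)
      cases : ∀ y x z → E x y → E z y → (E x y × E z y × codeg Y x z ≤ 2) ⊎ z ≡ x ⊎ (E z y × z ≢ x × 3 ≤ codeg Y x z)
      cases y x z xy zy with z ≟ x | codeg Y x z ≤? 2
      ... | yes z≡x | _       = inj₂ (inj₁ z≡x)
      ... | no z≢x  | yes c≤2 = inj₁ (xy , zy , c≤2)
      ... | no z≢x  | no c≰2  = inj₂ (inj₂ (zy , z≢x , ≰⇒> c≰2))
      -- One fixed neighbour x of y is enough. The 2 that is subtracted accounts for z = x and for
      -- the single z of codegree at least 3.
      good : ∀ y x → E x y → deg′ X y ∸ 2 ≤ ∑ X (λ z → ind (F? y x z))
      good y x xy = ≤-trans (∸-monoˡ-≤ 2 (begin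
        deg′ X y
          ≤⟨ ∑-mono X (λ z _ → ind≤ (E? z y) (λ zy → cover (F? y x z) (z ≟ x) (G? y x z) (cases y x z xy zy))) ⟩
        ∑ X (λ z → ind (F? y x z) + (ind (z ≟ x) + ind (G? y x z)))
          ≡⟨ trans (∑-+ X _ _) (cong (∑ X (λ z → ind (F? y x z)) +_) (∑-+ X _ _)) ⟩
        ∑ X (λ z → ind (F? y x z)) + (∑ X (λ z → ind (z ≟ x)) + ∑ X (λ z → ind (G? y x z)))
          ≤⟨ +-monoʳ-≤ _ (+-mono-≤ (∑-≡≤1 x uX) (∑-unique-ind (G? y x) uX
               (λ _ _ (a , b , c) (a′ , b′ , c′) → 3≤codeg⇒≡ uY xy a a′ b b′ c c′))) ⟩
        ∑ X (λ z → ind (F? y x z)) + 2 ∎)) (≤-reflexive (m+n∸n≡m _ 2))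
      excess : ∀ y → deg′ X y ∸ 2 ≤ ∑ X (λ x → ∑ X (λ z → ind (F? y x z)))
      excess y with 1 ≤? deg′ X y
      ... | no d≱1 = ≤-trans (≤-reflexive (m≤n⇒m∸n≡0 (≤-trans (<⇒≤ (≰⇒> d≱1)) (s≤s z≤n)))) z≤n
      ... | yes 1≤d with ∑-pos X _ 1≤d
      ...   | x , x∈ , p = ≤-trans (good y x (ind-pos (E? x y) p)) (∑-∈ (λ x → ∑ X (λ z → ind (F? y x z))) x∈)

    -- Breadth-first search from r: most vertices at distance two have at most two neighbours in N(r), and most
    -- vertices at distance three at most two neighbours among those, since otherwise a hexagon closes up.
    module Rooted {X Y : List ℕ} (uX : Unique X) (uY : Unique Y) {r : ℕ} {α β : ℕ}
                  (dX : ∀ x → x ∈ X → 3 + α ≤ deg Y x) (dY : ∀ y → y ∈ Y → 2 + β ≤ deg′ X y) where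

      c : ℕ → ℕ
      c = codeg Y r

      -- The cap on the codegree loses at most one vertex below each neighbour of r, and it ensures
      -- that at most two neighbours of r count the same vertex.
      Second : ℕ → Set
      Second x = x ≢ r × 1 ≤ c x × c x ≤ 2

      second? : Decidable Second
      second? x = ¬? (x ≟ r) ×-dec (1 ≤? c x) ×-dec (c x ≤? 2)

      second : ℕ
      second = ∑ X (λ x → ind (second? x))

      parent : ∀ {x} → Second x → ∃[ y ] (E r y × E x y)
      parent (_ , 1≤c , _) = let y , _ , p = ∑-pos Y _ 1≤c in y , ind-pos (E? r y ×-dec E? _ y) p

      -- Of the 2 + β neighbours of y two may be lost: r itself, and by `3≤codeg⇒≡` one vertex of
      -- codegree at least 3 with r.
      children : ∀ y → y ∈ Y → E r y → β ≤ ∑ X (λ x → ind (E? x y ×-dec second? x))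
      children y y∈ ry = +-cancelʳ-≤ 2 β _ (begin
        β + 2 ≡⟨ +-comm β 2 ⟩
        2 + β ≤⟨ dY y y∈ ⟩
        deg′ X y ≤⟨ ∑-mono X (λ x _ → ind≤ (E? x y) (λ xy → cover (E? x y ×-dec second? x) (x ≟ r) (B? x) (cases x xy))) ⟩
        ∑ X (λ x → ind (E? x y ×-dec second? x) + (ind (x ≟ r) + ind (B? x)))
          ≡⟨ trans (∑-+ X _ _) (cong (∑ X (λ x → ind (E? x y ×-dec second? x)) +_) (∑-+ X _ _)) ⟩
        ∑ X (λ x → ind (E? x y ×-dec second? x)) + (∑ X (λ x → ind (x ≟ r)) + ∑ X (λ x → ind (B? x)))
          ≤⟨ +-monoʳ-≤ _ (+-mono-≤ (∑-≡≤1 r uX) (∑-unique-ind B? uX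
               (λ _ _ (a , b , c) (a′ , b′ , c′) → 3≤codeg⇒≡ uY ry a a′ b b′ c c′))) ⟩
        ∑ X (λ x → ind (E? x y ×-dec second? x)) + 2 ∎)
        where
        B? : ∀ x → Dec (E x y × x ≢ r × 3 ≤ c x)
        B? x = E? x y ×-dec ¬? (x ≟ r) ×-dec (3 ≤? c x)
        cases : ∀ x → E x y → (E x y × Second x) ⊎ x ≡ r ⊎ (E x y × x ≢ r × 3 ≤ c x)
        cases x xy with x ≟ r | c x ≤? 2
        ... | yes x≡r | _       = inj₂ (inj₁ x≡r)
        ... | no x≢r  | no c≰2  = inj₂ (inj₂ (xy , x≢r , ≰⇒> c≰2))
        ... | no x≢r  | yes c≤2 = inj₁ (xy , x≢r , 1≤c , c≤2)
          where
          1≤c : 1 ≤ c x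
          1≤c = ≤-trans (≤-reflexive (sym (ind-yes (E? r y ×-dec E? x y) (ry , xy))))
                        (∑-∈ (λ y → ind (E? r y ×-dec E? x y)) y∈)

      second-large : deg Y r * β ≤ 2 * second
      second-large = begin
        deg Y r * β ≡⟨ sym (∑-*ʳ Y β _) ⟩
        ∑ Y (λ y → ind (E? r y) * β) ≤⟨ ∑-mono Y step ⟩
        ∑ Y (λ y → ∑ X (λ x → ind (F? x y))) ≡⟨ ∑-swap Y X _ ⟩
        ∑ X (λ x → ∑ Y (λ y → ind (F? x y))) ≤⟨ ∑-mono X (λ x _ → few x) ⟩
        ∑ X (λ x → 2 * ind (second? x)) ≡⟨ ∑-*ˡ X 2 _ ⟩
        2 * second ∎
        where
        F? : ∀ x y → Dec ((E r y × E x y) × Second x)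
        F? x y = (E? r y ×-dec E? x y) ×-dec second? x
        step : ∀ y → y ∈ Y → ind (E? r y) * β ≤ ∑ X (λ x → ind (F? x y))
        step y y∈ with E? r y
        ... | no _ = z≤n
        ... | yes ry = ≤-trans (≤-reflexive (*-identityˡ β)) (≤-trans (children y y∈ ry)
                (∑-mono X (λ x _ → ind-mono (E? x y ×-dec second? x) ((yes ry ×-dec E? x y) ×-dec second? x)
                  (λ (a , b) → (ry , a) , b))))
        few : ∀ x → ∑ Y (λ y → ind (F? x y)) ≤ 2 * ind (second? x)
        few x with second? x
        ... | yes s@(_ , _ , c≤2) = ≤-trans (∑-mono Y (λ y _ → ind-mono ((E? r y ×-dec E? x y) ×-dec yes s) (E? r y ×-dec E? x y) proj₁)) c≤2
        ... | no ns = ≤-trans (∑-mono Y (λ y _ → ≤-reflexive (ind-no ((E? r y ×-dec E? x y) ×-dec no ns) (λ q → ns (proj₂ q)))))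
                              (≤-reflexive (∑-zero Y))

      μ : ℕ → ℕ
      μ y = ∑ X (λ x → ind (second? x ×-dec E? x y))

      -- If x′ had a parent q ≠ p, then r p x y x′ q would be a hexagon; y differs from p and q
      -- because it is not adjacent to r.
      shares-parent : ∀ {x x′ y p} → Second x → Second x′ → E x y → E x′ y → ¬ E r y → E r p → E x p → E x′ p
      shares-parent {x} {x′} {y} {p} s s′ xy x′y ¬ry rp xp with x ≟ x′
      ... | yes refl = xp
      ... | no x≢x′ with parent s′
      ...   | q , rq , x′q with q ≟ p
      ...     | yes refl = x′q
      ...     | no q≢p = ⊥-elim (c₆ (≢-sym (proj₁ s)) (≢-sym (proj₁ s′)) x≢x′
                  (λ { refl → ¬ry rp }) (≢-sym q≢p) (λ { refl → ¬ry rq }) rp xp xy x′y x′q rq)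

      -- If y ≠ y′, choose x₁ below y and x₂ below y′, distinct from each other and from x. By
      -- `shares-parent` both are adjacent to a parent p of x, and x₁ y x y′ x₂ p is a hexagon.
      crowded⇒≡ : ∀ {x y y′} → Second x → E x y → E x y′ → ¬ E r y → ¬ E r y′ → 3 ≤ μ y → 3 ≤ μ y′ → y ≡ y′
      crowded⇒≡ {x} {y} {y′} s xy xy′ ¬ry ¬ry′ m m′ with y ≟ y′
      ... | yes y≡y′ = y≡y′
      ... | no y≢y′ =
        let p , rp , xp = parent s
            x₁ , _ , (s₁ , x₁y) , x₁≢x , _ = third (λ z → second? z ×-dec E? z y) uX m x x
            x₂ , _ , (s₂ , x₂y′) , x₂≢x , x₂≢x₁ = third (λ z → second? z ×-dec E? z y′) uX m′ x x₁
        in ⊥-elim (c₆ x₁≢x (≢-sym x₂≢x₁) (≢-sym x₂≢x) y≢y′ (λ { refl → ¬ry rp }) (λ { refl → ¬ry′ rp })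
             x₁y xy xy′ x₂y′ (shares-parent s s₂ xy′ x₂y′ ¬ry′ rp xp) (shares-parent s s₁ xy x₁y ¬ry rp xp))

      H? : ∀ x y → Dec (E x y × ¬ E r y × μ y ≤ 2)
      H? x y = E? x y ×-dec ¬? (E? r y) ×-dec (μ y ≤? 2)

      -- The 3 in the degree condition on X is spent here: at most two edges lead back to neighbours
      -- of r, and at most one leads to a crowded y.
      grandchildren : ∀ x → x ∈ X → Second x → α ≤ ∑ Y (λ y → ind (H? x y))
      grandchildren x x∈ s@(x≢r , _ , c≤2) = +-cancelʳ-≤ 3 α _ (begin
        α + 3 ≡⟨ +-comm α 3 ⟩
        3 + α ≤⟨ dX x x∈ ⟩
        deg Y x ≤⟨ ∑-mono Y (λ y _ → ind≤ (E? x y) (λ xy → cover (H? x y) (E? r y ×-dec E? x y) (B? y) (cases y xy))) ⟩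
        ∑ Y (λ y → ind (H? x y) + (ind (E? r y ×-dec E? x y) + ind (B? y)))
          ≡⟨ trans (∑-+ Y _ _) (cong (∑ Y (λ y → ind (H? x y)) +_) (∑-+ Y _ _)) ⟩
        ∑ Y (λ y → ind (H? x y)) + (c x + ∑ Y (λ y → ind (B? y)))
          ≤⟨ +-monoʳ-≤ _ (+-mono-≤ c≤2 (∑-unique-ind B? uY
               (λ _ _ (a , b , m) (a′ , b′ , m′) → crowded⇒≡ s a a′ b b′ m m′))) ⟩
        ∑ Y (λ y → ind (H? x y)) + 3 ∎)
        where
        B? : ∀ y → Dec (E x y × ¬ E r y × 3 ≤ μ y)
        B? y = E? x y ×-dec ¬? (E? r y) ×-dec (3 ≤? μ y)
        cases : ∀ y → E x y → (E x y × ¬ E r y × μ y ≤ 2) ⊎ (E r y × E x y) ⊎ (E x y × ¬ E r y × 3 ≤ μ y)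
        cases y xy with E? r y | μ y ≤? 2
        ... | yes ry | _       = inj₂ (inj₁ (ry , xy))
        ... | no ¬ry | yes m≤2 = inj₁ (xy , ¬ry , m≤2)
        ... | no ¬ry | no m≰2  = inj₂ (inj₂ (xy , ¬ry , ≰⇒> m≰2))

      second-small : second * α ≤ 2 * length Y
      second-small = begin
        second * α ≡⟨ sym (∑-*ʳ X α _) ⟩
        ∑ X (λ x → ind (second? x) * α) ≤⟨ ∑-mono X step ⟩
        ∑ X (λ x → ∑ Y (λ y → ind (F? x y))) ≡⟨ ∑-swap X Y _ ⟩
        ∑ Y (λ y → ∑ X (λ x → ind (F? x y))) ≤⟨ ∑-mono Y (λ y _ → few y) ⟩
        ∑ Y (λ y → 2) ≡⟨ trans (∑-const Y 2) (*-comm (length Y) 2) ⟩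
        2 * length Y ∎
        where
        F? : ∀ x y → Dec (Second x × E x y × μ y ≤ 2)
        F? x y = second? x ×-dec E? x y ×-dec (μ y ≤? 2)
        step : ∀ x → x ∈ X → ind (second? x) * α ≤ ∑ Y (λ y → ind (F? x y))
        step x x∈ with second? x
        ... | no _ = z≤n
        ... | yes s = ≤-trans (≤-reflexive (*-identityˡ α)) (≤-trans (grandchildren x x∈ s)
                (∑-mono Y (λ y _ → ind-mono (H? x y) (yes s ×-dec E? x y ×-dec (μ y ≤? 2))
                  (λ (a , _ , b) → s , a , b))))
        few : ∀ y → ∑ X (λ x → ind (F? x y)) ≤ 2
        few y with μ y ≤? 2
        ... | yes m≤2 = ≤-trans (∑-mono X (λ x _ → ind-mono (second? x ×-dec E? x y ×-dec yes m≤2) (second? x ×-dec E? x y)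
                          (λ (p , q , _) → p , q))) m≤2
        ... | no m≰2 = ≤-trans (∑-mono X (λ x _ → ≤-reflexive (ind-no (second? x ×-dec E? x y ×-dec no m≰2)
                          (λ (_ , _ , q) → m≰2 q)))) (≤-trans (≤-reflexive (∑-zero X)) z≤n)

      root-bound : r ∈ X → (α * α) * β ≤ 4 * length Y
      root-bound r∈ = begin
        (α * α) * β ≡⟨ solve 2 (λ a b → (a :* a) :* b := (a :* b) :* a) refl α β ⟩
        (α * β) * α ≤⟨ *-monoˡ-≤ α (*-monoˡ-≤ β (≤-trans (m≤n+m α 3) (dX r r∈))) ⟩
        (deg Y r * β) * α ≤⟨ *-monoˡ-≤ α second-large ⟩
        (2 * second) * α ≡⟨ *-assoc 2 second α ⟩
        2 * (second * α) ≤⟨ *-monoʳ-≤ 2 second-small ⟩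
        2 * (2 * length Y) ≡⟨ sym (*-assoc 2 2 (length Y)) ⟩
        4 * length Y ∎
        where open +-*-Solver

    -- A vertex of degree at most 2 + α in X, or 1 + β in Y, may be deleted; if there is none, search from any vertex.
    edges-bound : ∀ {X Y α β} → Unique X → Unique Y → 4 * length Y < (α * α) * β →
                  e X Y ≤ (2 + α) * length X + (1 + β) * length Y
    edges-bound {α = α} {β} = go _ ≤-refl
      where
      go : ∀ s {X Y} → length X + length Y ≤ s → Unique X → Unique Y → 4 * length Y < (α * α) * β →
           e X Y ≤ (2 + α) * length X + (1 + β) * length Y
      go s {[]} _ _ _ _ = z≤n
      go zero {_ ∷ _} () _ _ _
      go (suc s) {X@(r ∷ _)} {Y} le uX uY lt
        with Any.any? (λ x → deg Y x ≤? 2 + α) X | Any.any? (λ y → deg′ X y ≤? 1 + β) Y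
      ... | yes low | _ =
        let x , x∈ , dx = find low
            X′ = X ∖ x
        in begin
          e X Y ≤⟨ ∑-∖ (deg Y) uX x∈ ⟩
          deg Y x + e X′ Y ≤⟨ +-mono-≤ dx (go s {X′} {Y} (s≤s⁻¹ (≤-trans (+-monoˡ-≤ (length Y) (length-∖ uX x∈)) le))
                                 (Unique.filter⁺ (λ z → ¬? (z ≟ x)) uX) uY lt) ⟩
          (2 + α) + ((2 + α) * length X′ + (1 + β) * length Y)
            ≡⟨ trans (sym (+-assoc (2 + α) _ _)) (cong (_+ (1 + β) * length Y) (sym (*-suc (2 + α) (length X′)))) ⟩
          (2 + α) * suc (length X′) + (1 + β) * length Y
            ≤⟨ +-monoˡ-≤ _ (*-monoʳ-≤ (2 + α) (length-∖ uX x∈)) ⟩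
          (2 + α) * length X + (1 + β) * length Y ∎
      ... | no _ | yes low =
        let y , y∈ , dy = find low
            Y′ = Y ∖ y
        in begin
          e X Y ≡⟨ ∑-swap X Y _ ⟩
          ∑ Y (deg′ X) ≤⟨ ∑-∖ (deg′ X) uY y∈ ⟩
          deg′ X y + ∑ Y′ (deg′ X) ≡⟨ cong (deg′ X y +_) (∑-swap Y′ X _) ⟩
          deg′ X y + e X Y′
            ≤⟨ +-mono-≤ dy (go s {X} {Y′} (s≤s⁻¹ (≤-trans (≤-reflexive (sym (+-suc (length X) (length Y′)))) (≤-trans (+-monoʳ-≤ (length X) (length-∖ uY y∈)) le)))
                 uX (Unique.filter⁺ (λ z → ¬? (z ≟ y)) uY) (≤-<-trans (*-monoʳ-≤ 4 (<⇒≤ (length-∖ uY y∈))) lt)) ⟩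
          (1 + β) + ((2 + α) * length X + (1 + β) * length Y′)
            ≡⟨ solve 3 (λ p q r → p :+ (q :+ p :* r) := q :+ p :* (con 1 :+ r)) refl (1 + β) ((2 + α) * length X) (length Y′) ⟩
          (2 + α) * length X + (1 + β) * suc (length Y′)
            ≤⟨ +-monoʳ-≤ ((2 + α) * length X) (*-monoʳ-≤ (1 + β) (length-∖ uY y∈)) ⟩
          (2 + α) * length X + (1 + β) * length Y ∎
        where open +-*-Solver
      ... | no ¬low | no ¬low′ = contradiction
        (Rooted.root-bound uX uY {r} {α} {β}
          (λ x x∈ → ≰⇒> (λ h → ¬low (lose x∈ h)))
          (λ y y∈ → ≰⇒> (λ h → ¬low′ (lose y∈ h))) (here refl))
        (<⇒≱ lt)

  -- Divisor graphs

  module DivisorGraph {L : List ℕ} (uL : Unique L) (L>0 : ∀ {a} → a ∈ L → 0 < a)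
                      (sidon : Is3Sidon (_∈ L)) {Q : Pred ℕ 0ℓ} (Q? : Decidable Q) where

    HasDivisor : ℕ → Set
    HasDivisor a = Any (λ v → v ∣ a × Q v) (upTo (suc a))

    hasDivisor? : Decidable HasDivisor
    hasDivisor? a = Any.any? (λ v → (v ∣? a) ×-dec Q? v) (upTo (suc a))

    hasDivisor : ∀ {a v} → 0 < a → v ∣ a → Q v → HasDivisor a
    hasDivisor 0<a v∣a qv = lose (∈-upTo⁺ (s≤s (∣⇒≤ {{>-nonZero 0<a}} v∣a))) (v∣a , qv)

    divisor : ℕ → ℕ
    divisor a with hasDivisor? a
    ... | yes h = proj₁ (find h)
    -- The default cannot create an edge: v = 0 would put u * 0 = 0 into `L`, whose elements are
    -- positive.
    ... | no _  = 0

    divisor-spec : ∀ {a} → HasDivisor a → divisor a ∣ a × Q (divisor a)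
    divisor-spec {a} h with hasDivisor? a
    ... | yes p = proj₂ (proj₂ (find p))
    ... | no ¬p = contradiction h ¬p

    -- Requiring v to be the chosen divisor of u v gives each element of `L` at most one edge, so
    -- that different edges carry different elements.
    record E (v u : ℕ) : Set where
      constructor edge
      field
        product∈ : u * v ∈ L
        divisor≡ : divisor (u * v) ≡ v

    open E

    E? : ∀ v u → Dec (E v u)
    E? v u = map′ (λ (p , q) → edge p q) (λ p → product∈ p , divisor≡ p) ((u * v ∈? L) ×-dec (divisor (u * v) ≟ v))

    edge-injective : ∀ {v u v′ u′} → E v u → E v′ u′ → u * v ≡ u′ * v′ → v ≡ v′ × u ≡ u′
    edge-injective {v} {u} {v′} {u′} (edge uv∈ d) (edge _ d′) eq with trans (sym d) (trans (cong divisor eq) d′)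
    ... | refl = refl , *-cancelʳ-≡ u u′ v {{m*n≢0⇒n≢0 u {{>-nonZero (L>0 uv∈)}}}} eq

    -- Alternate edges of the hexagon form the two triples. Each triple meets every vertex once, so
    -- both products equal x₁ x₂ x₃ y₁ y₂ y₃, and any two of the six edges differ in an endpoint.
    E-C₆-free : C₆-Free E
    E-C₆-free {x₁} {x₂} {x₃} {y₁} {y₂} {y₃} x₁≢x₂ x₁≢x₃ x₂≢x₃ y₁≢y₂ y₁≢y₃ y₂≢y₃ e₁₁ e₂₁ e₂₂ e₃₂ e₃₃ e₁₃ =
      sidon (product∈ e₁₁) (product∈ e₂₂) (product∈ e₃₃) (product∈ e₂₁) (product∈ e₃₂) (product∈ e₁₃)
        ((≢x x₁≢x₂ e₁₁ e₂₂ ∷ ≢x x₁≢x₃ e₁₁ e₃₃ ∷ ≢x x₁≢x₂ e₁₁ e₂₁ ∷ ≢x x₁≢x₃ e₁₁ e₃₂ ∷ ≢y y₁≢y₃ e₁₁ e₁₃ ∷ [])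
        ∷ (≢x x₂≢x₃ e₂₂ e₃₃ ∷ ≢y (≢-sym y₁≢y₂) e₂₂ e₂₁ ∷ ≢x x₂≢x₃ e₂₂ e₃₂ ∷ ≢x (≢-sym x₁≢x₂) e₂₂ e₁₃ ∷ [])
        ∷ (≢x (≢-sym x₂≢x₃) e₃₃ e₂₁ ∷ ≢y (≢-sym y₂≢y₃) e₃₃ e₃₂ ∷ ≢x (≢-sym x₁≢x₃) e₃₃ e₁₃ ∷ [])
        ∷ (≢x x₂≢x₃ e₂₁ e₃₂ ∷ ≢x (≢-sym x₁≢x₂) e₂₁ e₁₃ ∷ [])
        ∷ (≢x (≢-sym x₁≢x₃) e₃₂ e₁₃ ∷ [])
        ∷ [] ∷ [])
        (solve 6 (λ a b c x y z → ((x :* a) :* (y :* b)) :* (z :* c) := ((x :* b) :* (y :* c)) :* (z :* a))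
          refl x₁ x₂ x₃ y₁ y₂ y₃)
      where
      open +-*-Solver
      ≢x : ∀ {v u v′ u′} → v ≢ v′ → E v u → E v′ u′ → u * v ≢ u′ * v′
      ≢x v≢v′ p q eq = v≢v′ (proj₁ (edge-injective p q eq))
      ≢y : ∀ {v u v′ u′} → u ≢ u′ → E v u → E v′ u′ → u * v ≢ u′ * v′
      ≢y u≢u′ p q eq = u≢u′ (proj₂ (edge-injective p q eq))

    open Bipartite E? E-C₆-free public

    -- Counting a class of elements thus reduces to locating the chosen divisor in `Vs` and its
    -- cofactor in `Us`.
    count≤e : ∀ {P : Pred ℕ 0ℓ} (P? : Decidable P) {Vs Us} →
              (∀ {a} → a ∈ L → P a → HasDivisor a × divisor a ∈ Vs × (∀ u → u * divisor a ≡ a → u ∈ Us)) →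
              ∑ L (λ a → ind (P? a)) ≤ e Vs Us
    count≤e {P} P? {Vs} {Us} h = begin
      ∑ L (λ a → ind (P? a)) ≤⟨ ∑-mono L (λ a a∈ → ind≤ (P? a) (λ p → covered a∈ p)) ⟩
      ∑ L (λ a → ∑ Vs (λ v → ∑ Us (λ u → ind (K? a v u)))) ≡⟨ ∑-swap L Vs _ ⟩
      ∑ Vs (λ v → ∑ L (λ a → ∑ Us (λ u → ind (K? a v u)))) ≡⟨ ∑-cong Vs (λ v → ∑-swap L Us _) ⟩
      ∑ Vs (λ v → ∑ Us (λ u → ∑ L (λ a → ind (K? a v u)))) ≤⟨ ∑-mono Vs (λ v _ → ∑-mono Us (λ u _ → once v u)) ⟩
      e Vs Us ∎
      where
      open ≤-Reasoning
      K? : ∀ a v u → Dec (E v u × u * v ≡ a)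
      K? a v u = E? v u ×-dec (u * v ≟ a)
      covered : ∀ {a} → a ∈ L → P a → 1 ≤ ∑ Vs (λ v → ∑ Us (λ u → ind (K? a v u)))
      covered {a} a∈ p with h a∈ p
      ... | hd , v∈ , u∈ with divisor-spec hd
      ...   | divides u a≡ , _ = begin
        1 ≡⟨ sym (ind-yes (K? a v u) (edge (subst (_∈ L) a≡ a∈) (cong divisor (sym a≡)) , sym a≡)) ⟩
        ind (K? a v u) ≤⟨ ∑-∈ (λ u → ind (K? a v u)) (u∈ u (sym a≡)) ⟩
        ∑ Us (λ u → ind (K? a v u)) ≤⟨ ∑-∈ (λ v → ∑ Us (λ u → ind (K? a v u))) v∈ ⟩
        ∑ Vs (λ v → ∑ Us (λ u → ind (K? a v u))) ∎
        where v = divisor a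
      once : ∀ v u → ∑ L (λ a → ind (K? a v u)) ≤ ind (E? v u)
      once v u with E? v u
      ... | yes p = ∑-unique-ind (λ a → yes p ×-dec (u * v ≟ a)) uL (λ _ _ (_ , q) (_ , q′) → trans (sym q) q′)
      ... | no ¬p = ≤-reflexive (trans (∑-cong L (λ a → ind-no (no ¬p ×-dec (u * v ≟ a)) (λ q → ¬p (proj₁ q)))) (∑-zero L))

  ∑-applyUpTo-+ : ∀ {A : Set} (f : ℕ → A) m n (g : A → ℕ) →
                  ∑ (applyUpTo f (m + n)) g ≡ ∑ (applyUpTo f m) g + ∑ (applyUpTo (f ∘ (m +_)) n) g
  ∑-applyUpTo-+ f zero    n g = refl
  ∑-applyUpTo-+ f (suc m) n g = trans (cong (g (f 0) +_) (∑-applyUpTo-+ (f ∘ suc) m n g)) (sym (+-assoc (g (f 0)) _ _))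

  ∑-applyUpTo : ∀ {A : Set} (f : ℕ → A) n (g : A → ℕ) → ∑ (applyUpTo f n) g ≡ ∑ (upTo n) (g ∘ f)
  ∑-applyUpTo f n g = go n f id g
    where
    go : ∀ {A : Set} n (f : ℕ → A) (h : ℕ → ℕ) (g : A → ℕ) → ∑ (applyUpTo (f ∘ h) n) g ≡ ∑ (applyUpTo h n) (g ∘ f)
    go zero    f h g = refl
    go (suc n) f h g = cong (g (f (h 0)) +_) (go n f (h ∘ suc) g)

  -- The bound is required only for windows inside the range, because the weights to which it is
  -- applied are controlled only there.
  ∑-windows : ∀ w k o {c} (g : ℕ → ℕ) → (∀ i → i + k ≤ o + w * k → ∑ (upTo k) (g ∘ (i +_)) ≤ c) →
              ∑ (upTo (w * k)) (g ∘ (o +_)) ≤ w * c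
  ∑-windows zero    k o g h = z≤n
  ∑-windows (suc w) k o {c} g h = begin
    ∑ (upTo (k + w * k)) (g ∘ (o +_))
      ≡⟨ ∑-applyUpTo-+ id k (w * k) (g ∘ (o +_)) ⟩
    ∑ (upTo k) (g ∘ (o +_)) + ∑ (applyUpTo (k +_) (w * k)) (g ∘ (o +_))
      ≡⟨ cong (∑ (upTo k) (g ∘ (o +_)) +_) (trans (∑-applyUpTo (k +_) (w * k) (g ∘ (o +_)))
           (∑-cong (upTo (w * k)) (λ x → cong g (sym (+-assoc o k x))))) ⟩
    ∑ (upTo k) (g ∘ (o +_)) + ∑ (upTo (w * k)) (g ∘ ((o + k) +_))
      ≤⟨ +-mono-≤ (h o (+-monoʳ-≤ o (m≤m+n k (w * k))))
           (∑-windows w k (o + k) g (λ i le → h i (subst (i + k ≤_) (+-assoc o k (w * k)) le))) ⟩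
    c + w * c ∎
    where open ≤-Reasoning

  ∑-upTo-≤ : ∀ {m n} (g : ℕ → ℕ) → m ≤ n → ∑ (upTo m) g ≤ ∑ (upTo n) g
  ∑-upTo-≤ {m} {n} g m≤n = subst (λ x → ∑ (upTo m) g ≤ ∑ (upTo x) g) (m+[n∸m]≡n m≤n)
    (subst (∑ (upTo m) g ≤_) (sym (∑-applyUpTo-+ id m (n ∸ m) g)) (m≤m+n _ _))

  -- Dyadic blocks and rough numbers

  block : ℕ → List ℕ
  block i = applyUpTo (2 ^ i +_) (2 ^ i)

  2^suc : ∀ i → 2 ^ suc i ≡ 2 ^ i + 2 ^ i
  2^suc i = cong (2 ^ i +_) (+-identityʳ (2 ^ i))

  2^-pos : ∀ i → 0 < 2 ^ i
  2^-pos i = m^n>0 2 i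

  block⁺ : ∀ i {v} → 2 ^ i ≤ v → v < 2 ^ suc i → v ∈ block i
  block⁺ i {v} lo hi = subst (_∈ block i) (m+[n∸m]≡n lo) (∈-applyUpTo⁺ (2 ^ i +_)
    (subst (v ∸ 2 ^ i <_) (trans (cong (_∸ 2 ^ i) (2^suc i)) (m+n∸n≡m (2 ^ i) (2 ^ i))) (∸-monoˡ-< hi lo)))

  block⁻ : ∀ i {v} → v ∈ block i → 2 ^ i ≤ v × v < 2 ^ suc i
  block⁻ i v∈ with ∈-applyUpTo⁻ (2 ^ i +_) v∈
  ... | k , k< , refl = m≤m+n (2 ^ i) k , subst (2 ^ i + k <_) (sym (2^suc i)) (+-monoʳ-< (2 ^ i) k<)

  block-unique : ∀ i → Unique (block i)
  block-unique i = Unique.applyUpTo⁺₁ (2 ^ i +_) (2 ^ i) (λ a<b _ eq → <⇒≢ a<b (+-cancelˡ-≡ (2 ^ i) _ _ eq))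

  block-length : ∀ i → length (block i) ≡ 2 ^ i
  block-length i = length-applyUpTo (2 ^ i +_) (2 ^ i)

  block-injective : ∀ i i′ {v} → v ∈ block i → v ∈ block i′ → i ≡ i′
  block-injective i i′ v∈ v∈′ = ≤-antisym (below i i′ (proj₁ (block⁻ i v∈)) (proj₂ (block⁻ i′ v∈′)))
                                             (below i′ i (proj₁ (block⁻ i′ v∈′)) (proj₂ (block⁻ i v∈)))
    where
    below : ∀ a b {v} → 2 ^ a ≤ v → v < 2 ^ suc b → a ≤ b
    below a b lo hi = ≮⇒≥ (λ b<a → <⇒≱ hi (≤-trans (^-monoʳ-≤ 2 b<a) lo))

  locate : ∀ m a {v} → 2 ^ a ≤ v → v < 2 ^ (a + m) → ∃[ s ] (s < m × v ∈ block (a + s))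
  locate zero a {v} lo hi = contradiction lo (<⇒≱ (subst (λ x → v < 2 ^ x) (+-identityʳ a) hi))
  locate (suc m) a {v} lo hi with v <? 2 ^ suc a
  ... | yes lt = 0 , s≤s z≤n , subst (λ x → v ∈ block x) (sym (+-identityʳ a)) (block⁺ a lo lt)
  ... | no ge with locate m (suc a) (≮⇒≥ ge) (subst (λ x → v < 2 ^ x) (+-suc a m) hi)
  ...   | s , s<m , v∈ = suc s , s≤s s<m , subst (λ x → v ∈ block x) (sym (+-suc a s)) v∈

  -- Excluding all divisors between 1 and y, and not only the primes, makes the property pass to
  -- divisors and gives coprimality to every positive s < y at once.
  Rough : ℕ → ℕ → Set
  Rough y m = ∀ {d} → d < y → ¬ (1 < d × d ∣ m)

  rough? : ∀ y m → Dec (Rough y m)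
  rough? y m = allUpTo? (λ d → ¬? ((1 <? d) ×-dec (d ∣? m))) y

  rough-coprime : ∀ {y m s} → Rough y m → 0 < s → s < y → Coprime s m
  rough-coprime {s = s} r 0<s s<y {zero} (0∣s , _) = contradiction (sym (0∣⇒≡0 0∣s)) (<⇒≢ 0<s)
  rough-coprime r 0<s s<y {suc zero} _ = refl
  rough-coprime r 0<s s<y {suc (suc d)} (d∣s , d∣m) =
    contradiction (s≤s (s≤s z≤n) , d∣m) (r (≤-<-trans (∣⇒≤ {{>-nonZero 0<s}} d∣s) s<y))

  -- Since s is coprime to m′ and divides m′ s′, it divides s′; the situation is symmetric.
  rough-factor-unique : ∀ {y m m′ s s′} → Rough y m → Rough y m′ → 0 < s → s < y → 0 < s′ → s′ < y →
                        m * s ≡ m′ * s′ → s ≡ s′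
  rough-factor-unique {m = m} {m′} {s} {s′} r r′ 0<s s< 0<s′ s′< eq = ∣-antisym
    (coprime-divisor (rough-coprime r′ 0<s s<) (divides m (sym eq)))
    (coprime-divisor (rough-coprime r 0<s′ s′<) (divides m′ eq))

  roughs : ℕ → ℕ → ℕ
  roughs y i = ∑ (block i) (λ m → ind (rough? y m))

  roughs≤ : ∀ y i → roughs y i ≤ 2 ^ i
  roughs≤ y i = ≤-trans (∑-mono (block i) (λ m _ → ind≤1 (rough? y m)))
    (≤-reflexive (trans (∑-one (block i)) (block-length i)))

  -- The products m s of a 2ᵏ-rough m and an s < 2ᵏ are distinct.
  ∑-roughs : ∀ k i → ∑ (upTo (suc k)) (λ f → roughs (2 ^ suc k) (i + f) * 2 ^ (k ∸ f)) ≤ 2 ^ (2 + (i + k))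
  ∑-roughs k i = begin
    ∑ F (λ f → roughs y (i + f) * 2 ^ (k ∸ f)) ≤⟨ ∑-mono F spread ⟩
    ∑ F (λ f → ∑ T (λ t → G t f)) ≡⟨ ∑-swap F T _ ⟩
    ∑ T (λ t → ∑ F (G t)) ≤⟨ ∑-mono T (λ t _ → once t) ⟩
    ∑ T (λ t → 1) ≡⟨ trans (∑-one T) (length-upTo _) ⟩
    2 ^ (2 + (i + k)) ∎
    where
    open ≤-Reasoning
    y : ℕ
    y = 2 ^ suc k
    F T : List ℕ
    F = upTo (suc k)
    T = upTo (2 ^ (2 + (i + k)))
    K? : ∀ t m s → Dec (Rough y m × m * s ≡ t)
    K? t m s = rough? y m ×-dec (m * s ≟ t)
    G : ℕ → ℕ → ℕ
    G t f = ∑ (block (i + f)) (λ m → ∑ (block (k ∸ f)) (λ s → ind (K? t m s)))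
    -- Pairing block i + f with block k - f puts all products below the same bound: m < 2^(i + f +
    -- 1) and s < 2^(k - f + 1), whence the 2 in the exponent.
    below : ∀ {f m s} → f ∈ F → m ∈ block (i + f) → s ∈ block (k ∸ f) → m * s ∈ T
    below {f} {m} {s} f∈ m∈ s∈ = ∈-upTo⁺ (subst (m * s <_)
      (trans (sym (^-distribˡ-+-* 2 (suc (i + f)) (suc (k ∸ f)))) (cong (2 ^_)
        (trans (cong suc (+-suc (i + f) (k ∸ f))) (cong (2 +_) (trans (+-assoc i f (k ∸ f)) (cong (i +_) (m+[n∸m]≡n (s≤s⁻¹ (∈-upTo⁻ f∈)))))))))
      (*-mono-< (proj₂ (block⁻ (i + f) m∈)) (proj₂ (block⁻ (k ∸ f) s∈))))
    spread : ∀ f → f ∈ F → roughs y (i + f) * 2 ^ (k ∸ f) ≤ ∑ T (λ t → G t f)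
    spread f f∈ = begin
      roughs y (i + f) * 2 ^ (k ∸ f) ≡⟨ sym (∑-*ʳ (block (i + f)) (2 ^ (k ∸ f)) _) ⟩
      ∑ (block (i + f)) (λ m → ind (rough? y m) * 2 ^ (k ∸ f))
        ≡⟨ ∑-cong (block (i + f)) (λ m → trans (*-comm (ind (rough? y m)) _)
             (trans (cong (_* ind (rough? y m)) (sym (block-length (k ∸ f)))) (sym (∑-const (block (k ∸ f)) _)))) ⟩
      ∑ (block (i + f)) (λ m → ∑ (block (k ∸ f)) (λ s → ind (rough? y m)))
        ≤⟨ ∑-mono (block (i + f)) (λ m m∈ → ∑-mono (block (k ∸ f)) (λ s s∈ → ind≤ (rough? y m) (λ r →
             ≤-trans (≤-reflexive (sym (ind-yes (K? (m * s) m s) (r , refl)))) (∑-∈ (λ t → ind (K? t m s)) (below f∈ m∈ s∈))))) ⟩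
      ∑ (block (i + f)) (λ m → ∑ (block (k ∸ f)) (λ s → ∑ T (λ t → ind (K? t m s))))
        ≡⟨ ∑-cong (block (i + f)) (λ m → ∑-swap (block (k ∸ f)) T _) ⟩
      ∑ (block (i + f)) (λ m → ∑ T (λ t → ∑ (block (k ∸ f)) (λ s → ind (K? t m s))))
        ≡⟨ ∑-swap (block (i + f)) T _ ⟩
      ∑ T (λ t → G t f) ∎
    small : ∀ f {s} → s ∈ block (k ∸ f) → 0 < s × s < y
    small f s∈ = ≤-trans (2^-pos (k ∸ f)) (proj₁ (block⁻ (k ∸ f) s∈)) , <-≤-trans (proj₂ (block⁻ (k ∸ f) s∈)) (^-monoʳ-≤ 2 (s≤s (m∸n≤m k f)))
    same-s : ∀ {t} m m′ {s s′} f f′ → s ∈ block (k ∸ f) → s′ ∈ block (k ∸ f′) →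
             Rough y m × m * s ≡ t → Rough y m′ × m′ * s′ ≡ t → s ≡ s′
    same-s m m′ f f′ s∈ s′∈ (r , eq) (r′ , eq′) = rough-factor-unique {m = m} {m′} r r′ (proj₁ (small f s∈)) (proj₂ (small f s∈))
      (proj₁ (small f′ s′∈)) (proj₂ (small f′ s′∈)) (trans eq (sym eq′))
    row≤1 : ∀ t f m → ∑ (block (k ∸ f)) (λ s → ind (K? t m s)) ≤ 1
    row≤1 t f m = ∑-unique-ind (K? t m) (block-unique (k ∸ f)) (same-s m m f f)
    row-witness : ∀ t f m → 1 ≤ ∑ (block (k ∸ f)) (λ s → ind (K? t m s)) →
                  ∃[ s ] (s ∈ block (k ∸ f) × Rough y m × m * s ≡ t)
    row-witness t f m h = let s , s∈ , p = ∑-pos (block (k ∸ f)) _ h in s , s∈ , ind-pos (K? t m s) p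
    G≤1 : ∀ t f → G t f ≤ 1
    G≤1 t f = ∑-unique _ (block-unique (i + f)) (λ m _ → row≤1 t f m) same-m
      where
      same-m : ∀ {m m′} → m ∈ block (i + f) → m′ ∈ block (i + f) →
               1 ≤ ∑ (block (k ∸ f)) (λ s → ind (K? t m s)) → 1 ≤ ∑ (block (k ∸ f)) (λ s → ind (K? t m′ s)) → m ≡ m′
      same-m {m} {m′} _ _ h h′ with row-witness t f m h | row-witness t f m′ h′
      ... | s , s∈ , p | s′ , s′∈ , p′ with same-s m m′ f f s∈ s′∈ p p′
      ...   | refl = *-cancelʳ-≡ m m′ s {{>-nonZero (proj₁ (small f s∈))}} (trans (proj₂ p) (sym (proj₂ p′)))
    -- The product t determines s, and the dyadic block of s determines f.
    once : ∀ t → ∑ F (G t) ≤ 1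
    once t = ∑-unique (G t) (Unique.upTo⁺ (suc k)) (λ f _ → G≤1 t f) same-f
      where
      same-f : ∀ {f f′} → f ∈ F → f′ ∈ F → 1 ≤ G t f → 1 ≤ G t f′ → f ≡ f′
      same-f {f} {f′} f∈ f′∈ h h′ with ∑-pos (block (i + f)) _ h | ∑-pos (block (i + f′)) _ h′
      ... | m , _ , g | m′ , _ , g′ with row-witness t f m g | row-witness t f′ m′ g′
      ...   | s , s∈ , p | s′ , s′∈ , p′ with same-s m m′ f f′ s∈ s′∈ p p′
      ...     | refl = ∸-cancelˡ-≡ (s≤s⁻¹ (∈-upTo⁻ f∈)) (s≤s⁻¹ (∈-upTo⁻ f′∈)) (block-injective (k ∸ f) (k ∸ f′) s∈ s′∈)

  -- Classification by prime factors

  product-filter : ∀ {P : Pred ℕ 0ℓ} (P? : Decidable P) ps →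
                   product ps ≡ product (filter P? ps) * product (filter (¬? ∘ P?) ps)
  product-filter P? [] = refl
  product-filter P? (p ∷ ps) with P? p
  ... | yes _ = trans (cong (p *_) (product-filter P? ps)) (sym (*-assoc p _ _))
  ... | no _  = trans (cong (p *_) (product-filter P? ps))
    (solve 3 (λ p a b → p :* (a :* b) := a :* (p :* b)) refl p (product (filter P? ps)) (product (filter (¬? ∘ P?) ps)))
    where open +-*-Solver

  -- Factors are dropped from the front until the remaining product falls below N; restoring the
  -- last one, p, gives N ≤ v < p N. The final alternative serves to bound v by N²: either v = p,
  -- with p ≤ N² known elsewhere, or p < N and v < N².
  greedy-divisor : ∀ {N} → 1 < N → ∀ ps → All (0 <_) ps → N ≤ product ps →
                   ∃[ v ] ∃[ p ] (p ∈ ps × v ∣ product ps × N ≤ v × v < p * N × (v ≡ p ⊎ p < N))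
  greedy-divisor 1<N [] _ N≤1 = contradiction N≤1 (<⇒≱ 1<N)
  greedy-divisor {N} 1<N (p ∷ ps) (0<p ∷ 0<ps) N≤ with N ≤? product ps
  ... | yes N≤′ = let v , q , q∈ , v∣ , rest = greedy-divisor 1<N ps 0<ps N≤′
                  in v , q , there q∈ , ∣-trans v∣ (n∣m*n p) , rest
  ... | no N≰ with N ≤? p
  ...   | yes N≤p = p , p , here refl , m∣m*n (product ps) , N≤p ,
                    subst (_< p * N) (*-identityʳ p) (*-monoʳ-< p {{>-nonZero 0<p}} 1<N) , inj₁ refl
  ...   | no N≰p  = p * product ps , p , here refl , ∣-refl , N≤ , *-monoʳ-< p {{>-nonZero 0<p}} (≰⇒> N≰) , inj₂ (≰⇒> N≰p)

  rough-∣ : ∀ {y m v} → Rough y m → v ∣ m → Rough y v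
  rough-∣ r v∣m d<y (1<d , d∣v) = r d<y (1<d , ∣-trans d∣v v∣m)

  -- A d with 1 < d < y is smaller than each prime of the list, hence coprime to it, so the primes
  -- can be cancelled from d ∣ product one at a time.
  rough-product : ∀ {y} ps → All (λ p → Prime p × y ≤ p) ps → Rough y (product ps)
  rough-product [] [] d<y (1<d , d∣1) = contradiction (∣1⇒≡1 d∣1) (≢-sym (<⇒≢ 1<d))
  rough-product (p ∷ ps) ((pp , y≤p) ∷ h) {d} d<y (1<d , d∣) = rough-product ps h d<y
    (1<d , coprime-divisor (sym-coprime (prime⇒coprime pp {{>-nonZero (<⇒≤ 1<d)}} (<-≤-trans d<y y≤p))) d∣)
    where
    sym-coprime : Coprime p d → Coprime d p
    sym-coprime c (a , b) = c (b , a)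

  LargePrime Short : ℕ → Pred ℕ 0ℓ
  LargePrime N v = Prime v × N * N < v
  Short N v = N ≤ v × v ≤ N * N

  Window : ℕ → ℕ → Pred ℕ 0ℓ
  Window N y v = N ≤ v × v < y * N

  RoughShort : ℕ → ℕ → Pred ℕ 0ℓ
  RoughShort N y v = Short N v × Rough y v

  classify : ∀ {N y a} → 1 < N → N * N ≤ a →
             (∃[ v ] (v ∣ a × LargePrime N v)) ⊎ (∃[ v ] (v ∣ a × Window N y v)) ⊎ (∃[ v ] (v ∣ a × RoughShort N y v))
  classify {N} {y} {a} 1<N N²≤a = go (factorise a {{>-nonZero (≤-trans (*-mono-≤ (<⇒≤ 1<N) (<⇒≤ 1<N)) N²≤a)}})
    where
    go : PrimeFactorisation a → (∃[ v ] (v ∣ a × LargePrime N v)) ⊎ (∃[ v ] (v ∣ a × Window N y v)) ⊎ (∃[ v ] (v ∣ a × RoughShort N y v))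
    go record { factors = ps ; isFactorisation = refl ; factorsPrime = pps } with Any.any? (λ p → N * N <? p) ps
    ... | yes large = let p , p∈ , lt = find large in inj₁ (p , ∈⇒∣product p∈ , All.lookup pps p∈ , lt)
      where
      ∈⇒∣product : ∀ {p qs} → p ∈ qs → p ∣ product qs
      ∈⇒∣product {qs = q ∷ qs} (here refl) = m∣m*n (product qs)
      ∈⇒∣product {qs = q ∷ qs} (there p∈)  = ∣-trans (∈⇒∣product p∈) (n∣m*n q)
    ... | no ¬large = inj₂ (split (N ≤? product small) (N ≤? product big))
      where
      small big : List ℕ
      small = filter (_<? y) ps
      big = filter (¬? ∘ (_<? y)) ps
      prime-pos : ∀ {p} → Prime p → 0 < p
      prime-pos pp = >-nonZero⁻¹ _ {{prime⇒nonZero pp}}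
      split : Dec (N ≤ product small) → Dec (N ≤ product big) →
              (∃[ v ] (v ∣ a × Window N y v)) ⊎ (∃[ v ] (v ∣ a × RoughShort N y v))
      split (yes N≤s) _ =
        let v , p , p∈ , v∣ , N≤v , v< , _ = greedy-divisor 1<N small (All.filter⁺ (_<? y) (All.map prime-pos pps)) N≤s
            p<y = proj₂ (∈-filter⁻ (_<? y) {xs = ps} p∈)
        in inj₁ (v , subst (v ∣_) (sym (product-filter (_<? y) ps)) (∣m⇒∣m*n (product big) v∣) ,
                 N≤v , <-≤-trans v< (*-monoˡ-≤ N (<⇒≤ p<y)))
      split (no _) (yes N≤b) =
        let v , p , p∈ , v∣ , N≤v , v< , alt = greedy-divisor 1<N big (All.filter⁺ (¬? ∘ (_<? y)) (All.map prime-pos pps)) N≤b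
            p∈ps , _ = ∈-filter⁻ (¬? ∘ (_<? y)) {xs = ps} p∈
            rough = rough-product big (All.tabulate (λ q∈ → let q∈ps , q≮y = ∈-filter⁻ (¬? ∘ (_<? y)) {xs = ps} q∈
                                                       in All.lookup pps q∈ps , ≮⇒≥ q≮y))
        in inj₂ (v , subst (v ∣_) (sym (product-filter (_<? y) ps)) (∣n⇒∣m*n (product small) v∣) ,
                 (N≤v , upper v< alt (≮⇒≥ (λ lt → ¬large (lose p∈ps lt)))) , rough-∣ rough v∣)
        where
        upper : ∀ {v p} → v < p * N → v ≡ p ⊎ p < N → p ≤ N * N → v ≤ N * N
        upper _  (inj₁ refl) p≤  = p≤
        upper v< (inj₂ p<N)  _   = <⇒≤ (<-≤-trans v< (*-monoˡ-≤ N (<⇒≤ p<N)))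
      -- With both parts below N the number itself would be below N².
      split (no N≰s) (no N≰b) = contradiction N²≤a (<⇒≱ (subst (_< N * N) (sym (product-filter (_<? y) ps))
        (*-mono-< (≰⇒> N≰s) (≰⇒> N≰b))))

  -- Edge counts over dyadic blocks

  module Blocks {L : List ℕ} (uL : Unique L) (L>0 : ∀ {a} → a ∈ L → 0 < a) (sidon : Is3Sidon (_∈ L))
                {j : ℕ} (L< : ∀ {a} → a ∈ L → a < 8 * (2 ^ j * (2 ^ j * 2 ^ j)))
                {Q : Pred ℕ 0ℓ} (Q? : Decidable Q) where

    open DivisorGraph uL L>0 sidon Q?
    open +-*-Solver
    open ≤-Reasoning

    N : ℕ
    N = 2 ^ j

    inBlock? : ∀ i a → Dec (HasDivisor a × divisor a ∈ block i)
    inBlock? i a = hasDivisor? a ×-dec (divisor a ∈? block i)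

    -- With α = 8 · 2ᵈ · 2ʳ and β = 2ˢ / 4ᵈ the terms α |X| and β |Y| are balanced for a set X of density 8⁻ᵈ.
    block-count : ∀ d s r → s + r ≡ j →
      ∑ L (λ a → ind (inBlock? (j + s) a)) ≤
      (2 + 8 * (2 ^ d * 2 ^ r)) * ∑ (block (j + s)) (λ v → ind (Q? v)) + (1 + 2 ^ (s ∸ 2 * d)) * (8 * (N * 2 ^ r))
    block-count d s r s+r≡j = begin
      ∑ L (λ a → ind (inBlock? (j + s) a))
        ≤⟨ count≤e (inBlock? (j + s)) {Vs} {Us} (λ a∈ (h , v∈) → h , ∈-filter⁺ Q? v∈ (proj₂ (divisor-spec h)) , cofactor a∈ v∈) ⟩
      e Vs Us
        ≤⟨ edges-bound {Vs} {Us} {8 * (D * q)} {β} (Unique.filter⁺ Q? (block-unique (j + s))) (Unique.upTo⁺ (8 * (N * q))) dense ⟩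
      (2 + 8 * (D * q)) * length Vs + (1 + β) * length Us
        ≡⟨ cong₂ (λ x y → (2 + 8 * (D * q)) * x + (1 + β) * y) (length-filter Q? (block (j + s))) (length-upTo (8 * (N * q))) ⟩
      (2 + 8 * (D * q)) * ∑ (block (j + s)) (λ v → ind (Q? v)) + (1 + β) * (8 * (N * q)) ∎
      where
      D p q β : ℕ
      D = 2 ^ d
      p = 2 ^ s
      q = 2 ^ r
      β = 2 ^ (s ∸ 2 * d)
      Vs Us : List ℕ
      Vs = filter Q? (block (j + s))
      Us = upTo (8 * (N * q))
      N≡pq : N ≡ p * q
      N≡pq = trans (cong (2 ^_) (sym s+r≡j)) (^-distribˡ-+-* 2 s r)
      -- For s < 2 d the truncated exponent gives β = 1, which only enlarges the right-hand side.
      p≤ : p ≤ (D * D) * β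
      p≤ = begin
        2 ^ s ≤⟨ ^-monoʳ-≤ 2 (m≤n+m∸n s (2 * d)) ⟩
        2 ^ (2 * d + (s ∸ 2 * d)) ≡⟨ ^-distribˡ-+-* 2 (2 * d) (s ∸ 2 * d) ⟩
        2 ^ (2 * d) * β ≡⟨ cong (_* β) (trans (cong (2 ^_) (cong (d +_) (+-identityʳ d))) (^-distribˡ-+-* 2 d d)) ⟩
        (D * D) * β ∎
      dense : 4 * length Us < (8 * (D * q)) * (8 * (D * q)) * β
      dense = begin-strict
        4 * length Us ≡⟨ cong (4 *_) (trans (length-upTo (8 * (N * q))) (cong (λ x → 8 * (x * q)) N≡pq)) ⟩
        4 * (8 * ((p * q) * q)) <⟨ m<m+n (4 * (8 * ((p * q) * q))) (≤-trans (s≤s z≤n) (*-monoʳ-≤ 4 (*-monoʳ-≤ 8 (*-mono-≤ (*-mono-≤ (2^-pos s) (2^-pos r)) (2^-pos r))))) ⟩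
        4 * (8 * ((p * q) * q)) + 4 * (8 * ((p * q) * q))
          ≡⟨ solve 2 (λ p q → con 4 :* (con 8 :* ((p :* q) :* q)) :+ con 4 :* (con 8 :* ((p :* q) :* q)) := con 64 :* (q :* q) :* p) refl p q ⟩
        64 * (q * q) * p ≤⟨ *-monoʳ-≤ (64 * (q * q)) p≤ ⟩
        64 * (q * q) * ((D * D) * β)
          ≡⟨ solve 3 (λ q D b → con 64 :* (q :* q) :* ((D :* D) :* b) := (con 8 :* (D :* q)) :* (con 8 :* (D :* q)) :* b) refl q D β ⟩
        (8 * (D * q)) * (8 * (D * q)) * β ∎
      cofactor : ∀ {a} → a ∈ L → divisor a ∈ block (j + s) → ∀ u → u * divisor a ≡ a → u ∈ Us
      cofactor {a} a∈ v∈ u eq = ∈-upTo⁺ (≰⇒> (λ le → <⇒≱ (L< a∈) (begin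
        8 * (N * (N * N)) ≡⟨ cong (λ x → 8 * (N * (N * x))) N≡pq ⟩
        8 * (N * (N * (p * q))) ≡⟨ solve 3 (λ N p q → con 8 :* (N :* (N :* (p :* q))) := (con 8 :* (N :* q)) :* (N :* p)) refl N p q ⟩
        (8 * (N * q)) * (N * p) ≤⟨ *-mono-≤ le (subst (_≤ divisor a) (^-distribˡ-+-* 2 j s) (proj₁ (block⁻ (j + s) v∈))) ⟩
        u * divisor a ≡⟨ eq ⟩
        a ∎)))

    blocks-cover : ∀ m → (∀ {v} → Q v → ∃[ s ] (s < m × v ∈ block (j + s))) →
      ∑ L (λ a → ind (hasDivisor? a)) ≤ ∑ (upTo m) (λ s → ∑ L (λ a → ind (inBlock? (j + s) a)))
    blocks-cover m h = subst (∑ L (λ a → ind (hasDivisor? a)) ≤_) (∑-swap L (upTo m) _)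
      (∑-mono L (λ a _ → ind≤ (hasDivisor? a) (λ hd →
        let s , s<m , v∈ = h (proj₂ (divisor-spec hd))
        in ≤-trans (≤-reflexive (sym (ind-yes (inBlock? (j + s) a) (hd , v∈))))
             (∑-∈ (λ s → ind (inBlock? (j + s) a)) (∈-upTo⁺ s<m)))))

  geometric : ∀ m → suc (∑ (upTo m) (2 ^_)) ≤ 2 ^ m
  geometric zero    = ≤-refl
  geometric (suc m) = begin
    2 + ∑ (applyUpTo suc m) (2 ^_)        ≡⟨ cong (2 +_) (trans (∑-applyUpTo suc m (2 ^_)) (∑-*ˡ (upTo m) 2 (2 ^_))) ⟩
    2 + 2 * ∑ (upTo m) (2 ^_)             ≡⟨ sym (*-suc 2 _) ⟩
    2 * suc (∑ (upTo m) (2 ^_))           ≤⟨ *-monoʳ-≤ 2 (geometric m) ⟩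
    2 ^ suc m                             ∎
    where open ≤-Reasoning

  geometric′ : ∀ j → suc (∑ (upTo (suc j)) (λ s → 2 ^ (j ∸ s))) ≤ 2 ^ suc j
  geometric′ zero    = ≤-refl
  geometric′ (suc j) = begin
    suc (2 ^ suc j + ∑ (applyUpTo suc (suc j)) (λ s → 2 ^ (suc j ∸ s)))
      ≡⟨ cong (λ x → suc (2 ^ suc j + x)) (∑-applyUpTo suc (suc j) (λ s → 2 ^ (suc j ∸ s))) ⟩
    suc (2 ^ suc j + ∑ (upTo (suc j)) (λ s → 2 ^ (j ∸ s))) ≡⟨ sym (+-suc (2 ^ suc j) _) ⟩
    2 ^ suc j + suc (∑ (upTo (suc j)) (λ s → 2 ^ (j ∸ s))) ≤⟨ +-monoʳ-≤ (2 ^ suc j) (geometric′ j) ⟩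
    2 ^ suc j + 2 ^ suc j ≡⟨ sym (2^suc (suc j)) ⟩
    2 ^ suc (suc j) ∎
    where open ≤-Reasoning

  -- The summand is 4ʲ times the density of rough numbers in block j + s. By `∑-roughs` the
  -- densities in k + 1 consecutive blocks sum to at most 4, and w such windows cover the j + 1
  -- blocks.
  ∑-roughs-windows : ∀ k w j → suc j ≤ w * suc k →
    ∑ (upTo (suc j)) (λ s → 2 ^ (j ∸ s) * roughs (2 ^ suc k) (j + s)) ≤ w * (4 * (2 ^ j * 2 ^ j))
  -- The last window may reach beyond s = j, where 2^(j - s) is no longer integral. Multiplying by
  -- `M` shifts all exponents so that they stay natural.
  ∑-roughs-windows k w j j<wk = *-cancelˡ-≤ M {{>-nonZero (2^-pos W)}} (begin
    M * ∑ (upTo (suc j)) (λ s → 2 ^ (j ∸ s) * X (j + s)) ≡⟨ sym (∑-*ˡ (upTo (suc j)) M _) ⟩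
    ∑ (upTo (suc j)) (λ s → M * (2 ^ (j ∸ s) * X (j + s))) ≤⟨ ∑-mono (upTo (suc j)) (λ s s∈ → ≤-reflexive (weight s (s≤s⁻¹ (∈-upTo⁻ s∈)))) ⟩
    ∑ (upTo (suc j)) (g ∘ (j +_)) ≤⟨ ∑-upTo-≤ (g ∘ (j +_)) j<wk ⟩
    ∑ (upTo W) (g ∘ (j +_)) ≤⟨ ∑-windows w (suc k) j g window ⟩
    w * 2 ^ (2 + B) ≡⟨ cong (w *_) (trans (^-distribˡ-+-* 2 2 B) (cong (4 *_) (trans (^-distribˡ-+-* 2 j (W + j))
                         (cong (2 ^ j *_) (^-distribˡ-+-* 2 W j))))) ⟩
    w * (4 * (2 ^ j * (M * 2 ^ j))) ≡⟨ solve 3 (λ w J M → w :* (con 4 :* (J :* (M :* J))) := M :* (w :* (con 4 :* (J :* J)))) refl w (2 ^ j) M ⟩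
    M * (w * (4 * (2 ^ j * 2 ^ j))) ∎)
    where
    open ≤-Reasoning
    open +-*-Solver
    W M B : ℕ
    W = w * suc k
    M = 2 ^ W
    B = j + (W + j)
    X g : ℕ → ℕ
    X = roughs (2 ^ suc k)
    g i = 2 ^ (B ∸ i) * X i
    weight : ∀ s → s ≤ j → M * (2 ^ (j ∸ s) * X (j + s)) ≡ g (j + s)
    weight s s≤j = trans (sym (*-assoc M (2 ^ (j ∸ s)) (X (j + s)))) (cong (_* X (j + s)) (trans (sym (^-distribˡ-+-* 2 W (j ∸ s)))
      (cong (2 ^_) (trans (sym (+-∸-assoc W s≤j)) (sym ([m+n]∸[m+o]≡n∸o j (W + j) s))))))
    window : ∀ i → i + suc k ≤ j + W → ∑ (upTo (suc k)) (g ∘ (i +_)) ≤ 2 ^ (2 + B)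
    window i le = begin
      ∑ (upTo (suc k)) (g ∘ (i +_)) ≤⟨ ∑-mono (upTo (suc k)) (λ f f∈ → ≤-reflexive (shift f (s≤s⁻¹ (∈-upTo⁻ f∈)))) ⟩
      ∑ (upTo (suc k)) (λ f → 2 ^ (B ∸ (i + k)) * (X (i + f) * 2 ^ (k ∸ f))) ≡⟨ ∑-*ˡ (upTo (suc k)) (2 ^ (B ∸ (i + k))) _ ⟩
      2 ^ (B ∸ (i + k)) * ∑ (upTo (suc k)) (λ f → X (i + f) * 2 ^ (k ∸ f)) ≤⟨ *-monoʳ-≤ (2 ^ (B ∸ (i + k))) (∑-roughs k i) ⟩
      2 ^ (B ∸ (i + k)) * 2 ^ (2 + (i + k)) ≡⟨ sym (^-distribˡ-+-* 2 (B ∸ (i + k)) (2 + (i + k))) ⟩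
      2 ^ (B ∸ (i + k) + (2 + (i + k))) ≡⟨ cong (2 ^_) (trans (+-comm (B ∸ (i + k)) _) (cong (2 +_) (m+[n∸m]≡n i+k≤B))) ⟩
      2 ^ (2 + B) ∎
      where
      i+k≤B : i + k ≤ B
      i+k≤B = ≤-trans (+-monoʳ-≤ i (n≤1+n k)) (≤-trans le (+-monoʳ-≤ j (m≤m+n W j)))
      shift : ∀ f → f ≤ k → g (i + f) ≡ 2 ^ (B ∸ (i + k)) * (X (i + f) * 2 ^ (k ∸ f))
      shift f f≤k = trans (cong (λ x → 2 ^ x * X (i + f)) exponent) (trans (cong (_* X (i + f)) (^-distribˡ-+-* 2 (B ∸ (i + k)) (k ∸ f)))
        (solve 3 (λ a b x → (a :* b) :* x := a :* (x :* b)) refl (2 ^ (B ∸ (i + k))) (2 ^ (k ∸ f)) (X (i + f))))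
        where
        exponent : B ∸ (i + f) ≡ (B ∸ (i + k)) + (k ∸ f)
        exponent = trans (cong (_∸ (i + f)) (sym (m∸n+n≡m i+k≤B))) (trans (+-∸-assoc (B ∸ (i + k)) (+-monoʳ-≤ i f≤k))
          (cong (B ∸ (i + k) +_) ([m+n]∸[m+o]≡n∸o i k f)))

  -- The size of each class

  module ClassCounts {L : List ℕ} (uL : Unique L) (L>0 : ∀ {a} → a ∈ L → 0 < a) (sidon : Is3Sidon (_∈ L))
                     {j : ℕ} (L< : ∀ {a} → a ∈ L → a < 8 * (2 ^ j * (2 ^ j * 2 ^ j))) where

    open +-*-Solver
    open ≤-Reasoning

    N : ℕ
    N = 2 ^ j

    largePrime? : Decidable (LargePrime N)
    largePrime? v = prime? v ×-dec (N * N <? v)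

    window? : ∀ y → Decidable (Window N y)
    window? y v = (N ≤? v) ×-dec (v <? y * N)

    roughShort? : ∀ y → Decidable (RoughShort N y)
    roughShort? y v = ((N ≤? v) ×-dec (v ≤? N * N)) ×-dec rough? y v

    module Large = DivisorGraph uL L>0 sidon largePrime?

    -- Each degree is split as min (deg, 2) plus the excess over 2. The first part is at most 1, or
    -- 2 if 2 p ≤ n, since otherwise only the cofactor 1 remains. The excess sums to at most 2 (8
    -- N)², the cofactors being below 8 N.
    large-count : ∀ {n} → (∀ {a} → a ∈ L → a ≤ n) →
      ∑ L (λ a → ind (Large.hasDivisor? a)) ≤
      ∑ (upTo (suc n)) (λ p → ind (prime? p)) + ∑ (upTo (suc n)) (λ p → ind (prime? p ×-dec (2 * p ≤? n))) + 128 * (N * N)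
    large-count {n} L≤n = begin
      ∑ L (λ a → ind (Large.hasDivisor? a))
        ≤⟨ Large.count≤e Large.hasDivisor? {Ps} {Us} (λ a∈ h → h , divisor∈ a∈ h , cofactor a∈ h) ⟩
      Large.e Ps Us
        ≤⟨ ∑-mono Ps (λ p p∈ → ≤-trans (m⊓n+n∸m≤ (Large.deg Us p)) (+-monoˡ-≤ (Large.deg Us p ∸ 2) (two-edges p p∈))) ⟩
      ∑ Ps (λ p → (ind (prime? p) + ind (prime? p ×-dec (2 * p ≤? n))) + (Large.deg Us p ∸ 2))
        ≡⟨ ∑-+ Ps _ _ ⟩
      ∑ Ps (λ p → ind (prime? p) + ind (prime? p ×-dec (2 * p ≤? n))) + ∑ Ps (λ p → Large.deg Us p ∸ 2)
        ≤⟨ +-mono-≤ (≤-trans (≤-reflexive (∑-filter largePrime? (upTo (suc n)) _))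
             (∑-mono (upTo (suc n)) (λ p _ → ≤-trans (*-monoˡ-≤ _ (ind≤1 (largePrime? p))) (≤-reflexive (*-identityˡ _)))))
             (Flip.∑-excess (Unique.upTo⁺ (8 * N)) (Unique.filter⁺ largePrime? (Unique.upTo⁺ (suc n)))) ⟩
      ∑ (upTo (suc n)) (λ p → ind (prime? p) + ind (prime? p ×-dec (2 * p ≤? n))) + 2 * (length Us * length Us)
        ≡⟨ cong₂ _+_ (∑-+ (upTo (suc n)) (λ p → ind (prime? p)) (λ p → ind (prime? p ×-dec (2 * p ≤? n)))) (trans (cong (λ x → 2 * (x * x)) (length-upTo (8 * N)))
             (solve 1 (λ N → con 2 :* ((con 8 :* N) :* (con 8 :* N)) := con 128 :* (N :* N)) refl N)) ⟩
      ∑ (upTo (suc n)) (λ p → ind (prime? p)) + ∑ (upTo (suc n)) (λ p → ind (prime? p ×-dec (2 * p ≤? n))) + 128 * (N * N) ∎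
      where
      Ps Us : List ℕ
      Ps = filter largePrime? (upTo (suc n))
      Us = upTo (8 * N)
      -- `∑-excess` is quadratic in its first side, which should be the few cofactors and not the
      -- primes; transposing the graph rotates the hexagon by one edge.
      module Flip = Bipartite (flip Large.E?)
        (λ a b c a′ b′ c′ p q r s t u → Large.E-C₆-free a′ b′ c′ c (≢-sym a) (≢-sym b) q r s t u p)
      m⊓n+n∸m≤ : ∀ m → m ≤ m ⊓ 2 + (m ∸ 2)
      m⊓n+n∸m≤ zero = z≤n
      m⊓n+n∸m≤ (suc zero) = s≤s z≤n
      m⊓n+n∸m≤ (suc (suc m)) = ≤-reflexive (cong (λ x → 2 + (x + m)) (sym (⊓-zeroʳ m)))
      divisor∈ : ∀ {a} → a ∈ L → Large.HasDivisor a → Large.divisor a ∈ Ps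
      divisor∈ a∈ h = let v∣a , qv = Large.divisor-spec h in
        ∈-filter⁺ largePrime? (∈-upTo⁺ (s≤s (≤-trans (∣⇒≤ {{>-nonZero (L>0 a∈)}} v∣a) (L≤n a∈)))) qv
      cofactor : ∀ {a} → a ∈ L → Large.HasDivisor a → ∀ u → u * Large.divisor a ≡ a → u ∈ Us
      cofactor {a} a∈ h u eq = ∈-upTo⁺ (≰⇒> (λ le → <⇒≱ (L< a∈) (begin
        8 * (N * (N * N)) ≡⟨ sym (*-assoc 8 N (N * N)) ⟩
        (8 * N) * (N * N) ≤⟨ *-mono-≤ le (<⇒≤ (proj₂ (proj₂ (Large.divisor-spec h)))) ⟩
        u * Large.divisor a ≡⟨ eq ⟩
        a ∎)))
      two-edges : ∀ p → p ∈ Ps → Large.deg Us p ⊓ 2 ≤ ind (prime? p) + ind (prime? p ×-dec (2 * p ≤? n))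
      two-edges p p∈ with proj₁ (proj₂ (∈-filter⁻ largePrime? {xs = upTo (suc n)} p∈)) | 2 * p ≤? n
      ... | pp | yes 2p≤n = ≤-trans (m⊓n≤n _ 2) (≤-reflexive (cong₂ _+_ (sym (ind-yes (prime? p) pp)) (sym (ind-yes (prime? p ×-dec yes 2p≤n) (pp , 2p≤n)))))
      ... | pp | no 2p≰n = ≤-trans (m⊓n≤m _ 2) (≤-trans (∑-unique-ind (Large.E? p) (Unique.upTo⁺ (8 * N))
          (λ _ _ x y → trans (one x) (sym (one y)))) (≤-trans (≤-reflexive (sym (ind-yes (prime? p) pp))) (m≤m+n _ _)))
        where
        one : ∀ {u} → Large.E p u → u ≡ 1
        one {zero} (Large.edge up∈ _) = contradiction (L>0 up∈) (<-irrefl refl)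
        one {suc zero} _ = refl
        one {suc (suc u)} (Large.edge up∈ _) = contradiction (≤-trans (*-monoˡ-≤ p (s≤s (s≤s (z≤n {u})))) (L≤n up∈)) 2p≰n

    module _ (k : ℕ) where

      module Win = DivisorGraph uL L>0 sidon (window? (2 ^ k))
      module WinBlocks = Blocks uL L>0 sidon {j} L< (window? (2 ^ k))

      -- No density is gained here, so d = 0. Both main terms, α on the side of v and β on the side
      -- of the cofactors, are then 8 N² in every block, and there are only k blocks.
      window-count : k ≤ j → ∑ L (λ a → ind (Win.hasDivisor? a)) ≤ k * (26 * (N * N))
      window-count k≤j = begin
        ∑ L (λ a → ind (Win.hasDivisor? a))
          ≤⟨ WinBlocks.blocks-cover k (λ (lo , hi) → locate k j lo (subst (_ <_) (trans (*-comm (2 ^ k) N) (sym (^-distribˡ-+-* 2 j k))) hi)) ⟩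
        ∑ (upTo k) (λ s → ∑ L (λ a → ind (WinBlocks.inBlock? (j + s) a)))
          ≤⟨ ∑-mono (upTo k) (λ s s∈ → term s (≤-trans (<⇒≤ (∈-upTo⁻ s∈)) k≤j)) ⟩
        ∑ (upTo k) (λ s → 26 * (N * N))
          ≡⟨ trans (∑-const (upTo k) _) (cong (_* (26 * (N * N))) (length-upTo k)) ⟩
        k * (26 * (N * N)) ∎
        where
        term : ∀ s → s ≤ j → ∑ L (λ a → ind (WinBlocks.inBlock? (j + s) a)) ≤ 26 * (N * N)
        term s s≤j = begin
          ∑ L (λ a → ind (WinBlocks.inBlock? (j + s) a))
            ≤⟨ WinBlocks.block-count 0 s (j ∸ s) (m+[n∸m]≡n s≤j) ⟩
          (2 + 8 * (1 * q)) * ∑ (block (j + s)) (λ v → ind (window? (2 ^ k) v)) + (1 + p) * (8 * (N * q))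
            ≤⟨ +-monoˡ-≤ _ (*-monoʳ-≤ (2 + 8 * (1 * q)) (≤-trans (∑-mono (block (j + s)) (λ v _ → ind≤1 (window? (2 ^ k) v)))
                 (≤-reflexive (trans (∑-one (block (j + s))) (trans (block-length (j + s)) (^-distribˡ-+-* 2 j s)))))) ⟩
          (2 + 8 * (1 * q)) * (N * p) + (1 + p) * (8 * (N * q))
            ≡⟨ solve 3 (λ N p q → (con 2 :+ con 8 :* (con 1 :* q)) :* (N :* p) :+ (con 1 :+ p) :* (con 8 :* (N :* q))
                 := con 2 :* (N :* p) :+ con 16 :* (N :* (p :* q)) :+ con 8 :* (N :* q)) refl N p q ⟩
          2 * (N * p) + 16 * (N * (p * q)) + 8 * (N * q)
            ≤⟨ +-mono-≤ (+-mono-≤ (*-monoʳ-≤ 2 (*-monoʳ-≤ N (^-monoʳ-≤ 2 s≤j)))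
                 (≤-reflexive (cong (λ x → 16 * (N * x)) (trans (sym (^-distribˡ-+-* 2 s (j ∸ s))) (cong (2 ^_) (m+[n∸m]≡n s≤j))))))
                 (*-monoʳ-≤ 8 (*-monoʳ-≤ N (^-monoʳ-≤ 2 (m∸n≤m j s)))) ⟩
          2 * (N * N) + 16 * (N * N) + 8 * (N * N)
            ≡⟨ solve 1 (λ x → con 2 :* x :+ con 16 :* x :+ con 8 :* x := con 26 :* x) refl (N * N) ⟩
          26 * (N * N) ∎
          where
          p q : ℕ
          p = 2 ^ s
          q = 2 ^ (j ∸ s)

    module _ (k : ℕ) where

      module Rgh = DivisorGraph uL L>0 sidon (roughShort? (2 ^ suc k))
      module RghBlocks = Blocks uL L>0 sidon {j} L< (roughShort? (2 ^ suc k))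

      -- The three terms come from geometric series over the blocks, from α times the density of
      -- rough numbers, and from β times the number of cofactors, which is at most 8 · 4^(j - d) in
      -- each block apart from a geometric part.
      rough-count : ∀ d w → suc j ≤ w * suc k →
        ∑ L (λ a → ind (Rgh.hasDivisor? a)) ≤
        36 * (N * N) + 8 * (2 ^ d * (w * (4 * (N * N)))) + suc j * (8 * 2 ^ (2 * j ∸ 2 * d))
      rough-count d w j<wk = begin
        ∑ L (λ a → ind (Rgh.hasDivisor? a))
          ≤⟨ RghBlocks.blocks-cover (suc j) (λ ((lo , hi) , _) → locate (suc j) j lo (short hi)) ⟩
        ∑ S (λ s → ∑ L (λ a → ind (RghBlocks.inBlock? (j + s) a)))
          ≤⟨ ∑-mono S (λ s s∈ → term s (s≤s⁻¹ (∈-upTo⁻ s∈))) ⟩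
        ∑ S (λ s → t₁ s + t₂ s + t₃ s + G)
          ≡⟨ trans (∑-+ S (λ s → t₁ s + t₂ s + t₃ s) (λ _ → G)) (cong₂ _+_ (trans (∑-+ S (λ s → t₁ s + t₂ s) t₃)
               (cong₂ _+_ (trans (∑-+ S t₁ t₂) (cong₂ _+_ (∑-*ˡ S (2 * N) (2 ^_)) (∑-*ˡ S (16 * N) (λ s → 2 ^ (j ∸ s)))))
                 (∑-*ˡ S (8 * D) (λ s → 2 ^ (j ∸ s) * X s))))
               (trans (∑-const S G) (cong (_* G) (length-upTo (suc j))))) ⟩
        2 * N * ∑ S (2 ^_) + 16 * N * ∑ S (λ s → 2 ^ (j ∸ s)) + 8 * D * ∑ S (λ s → 2 ^ (j ∸ s) * X s) + suc j * G
          ≤⟨ +-monoˡ-≤ (suc j * G) (+-mono-≤ (+-mono-≤ (*-monoʳ-≤ (2 * N) (<⇒≤ (geometric (suc j))))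
               (*-monoʳ-≤ (16 * N) (<⇒≤ (geometric′ j)))) (*-monoʳ-≤ (8 * D) (∑-roughs-windows k w j j<wk))) ⟩
        2 * N * (2 * N) + 16 * N * (2 * N) + 8 * D * (w * (4 * (N * N))) + suc j * G
          ≡⟨ cong (_+ suc j * G) (cong₂ _+_ (solve 1 (λ N → con 2 :* N :* (con 2 :* N) :+ con 16 :* N :* (con 2 :* N) := con 36 :* (N :* N)) refl N)
               (*-assoc 8 D (w * (4 * (N * N))))) ⟩
        36 * (N * N) + 8 * (D * (w * (4 * (N * N)))) + suc j * G ∎
        where
        D G : ℕ
        D = 2 ^ d
        G = 8 * 2 ^ (2 * j ∸ 2 * d)
        S : List ℕ
        S = upTo (suc j)
        X : ℕ → ℕ
        X s = roughs (2 ^ suc k) (j + s)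
        t₁ t₂ t₃ : ℕ → ℕ
        t₁ s = 2 * N * 2 ^ s
        t₂ s = 16 * N * 2 ^ (j ∸ s)
        t₃ s = 8 * D * (2 ^ (j ∸ s) * X s)
        short : ∀ {v} → v ≤ N * N → v < 2 ^ (j + suc j)
        short {v} hi = ≤-<-trans hi (subst (_< 2 ^ (j + suc j)) (^-distribˡ-+-* 2 j j) (^-monoʳ-< 2 (s≤s (s≤s z≤n)) (+-monoʳ-< j ≤-refl)))
        term : ∀ s → s ≤ j → ∑ L (λ a → ind (RghBlocks.inBlock? (j + s) a)) ≤
               t₁ s + t₂ s + t₃ s + G
        term s s≤j = begin
          ∑ L (λ a → ind (RghBlocks.inBlock? (j + s) a))
            ≤⟨ RghBlocks.block-count d s (j ∸ s) s+r≡j ⟩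
          (2 + 8 * (D * q)) * ∑ (block (j + s)) (λ v → ind (roughShort? (2 ^ suc k) v)) + (1 + β) * (8 * (N * q))
            ≤⟨ +-monoˡ-≤ _ (*-monoʳ-≤ (2 + 8 * (D * q)) (∑-mono (block (j + s)) (λ v _ →
                 ind-mono (roughShort? (2 ^ suc k) v) (rough? (2 ^ suc k) v) proj₂))) ⟩
          (2 + 8 * (D * q)) * X s + (1 + β) * (8 * (N * q))
            ≡⟨ solve 5 (λ D q X b N → (con 2 :+ con 8 :* (D :* q)) :* X :+ (con 1 :+ b) :* (con 8 :* (N :* q))
                 := con 2 :* X :+ con 8 :* D :* (q :* X) :+ con 8 :* (N :* q) :+ con 8 :* (b :* (N :* q))) refl D q (X s) β N ⟩
          2 * X s + 8 * D * (q * X s) + 8 * (N * q) + 8 * (β * (N * q))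
            ≤⟨ +-mono-≤ (+-monoˡ-≤ (8 * (N * q)) (+-monoˡ-≤ (8 * D * (q * X s)) (*-monoʳ-≤ 2 (≤-trans (roughs≤ (2 ^ suc k) (j + s)) (≤-reflexive (^-distribˡ-+-* 2 j s))))))
                 (*-monoʳ-≤ 8 β-term) ⟩
          2 * (N * p) + 8 * D * (q * X s) + 8 * (N * q) + 8 * (N * q + 2 ^ (2 * j ∸ 2 * d))
            ≡⟨ solve 5 (λ N p q Y g → con 2 :* (N :* p) :+ Y :+ con 8 :* (N :* q) :+ con 8 :* (N :* q :+ g)
                 := con 2 :* N :* p :+ con 16 :* N :* q :+ Y :+ con 8 :* g) refl N p q (8 * D * (q * X s)) (2 ^ (2 * j ∸ 2 * d)) ⟩
          2 * N * p + 16 * N * q + 8 * D * (q * X s) + G ∎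
          where
          p q β : ℕ
          p = 2 ^ s
          q = 2 ^ (j ∸ s)
          β = 2 ^ (s ∸ 2 * d)
          s+r≡j : s + (j ∸ s) ≡ j
          s+r≡j = m+[n∸m]≡n s≤j
          -- For s < 2 d one has β = 1, and the resulting N q sums geometrically; otherwise the
          -- product is exactly 4^(j - d).
          β-term : β * (N * q) ≤ N * q + 2 ^ (2 * j ∸ 2 * d)
          β-term with 2 * d ≤? s
          ... | no 2d≰s = ≤-trans (≤-reflexive (trans (cong (λ x → 2 ^ x * (N * q)) (m≤n⇒m∸n≡0 (<⇒≤ (≰⇒> 2d≰s)))) (*-identityˡ (N * q)))) (m≤m+n _ _)
          ... | yes 2d≤s = ≤-trans (≤-reflexive (begin-equality
            β * (N * q) ≡⟨ solve 3 (λ b N q → b :* (N :* q) := b :* q :* N) refl β N q ⟩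
            β * q * N ≡⟨ cong (_* N) (sym (^-distribˡ-+-* 2 (s ∸ 2 * d) (j ∸ s))) ⟩
            2 ^ (s ∸ 2 * d + (j ∸ s)) * N ≡⟨ sym (^-distribˡ-+-* 2 (s ∸ 2 * d + (j ∸ s)) j) ⟩
            2 ^ (s ∸ 2 * d + (j ∸ s) + j) ≡⟨ cong (2 ^_) exponent ⟩
            2 ^ (2 * j ∸ 2 * d) ∎)) (m≤n+m _ _)
            where
            exponent : s ∸ 2 * d + (j ∸ s) + j ≡ 2 * j ∸ 2 * d
            exponent = begin-equality
              s ∸ 2 * d + (j ∸ s) + j ≡⟨ cong (_+ j) (sym (+-∸-comm (j ∸ s) 2d≤s)) ⟩
              (s + (j ∸ s)) ∸ 2 * d + j ≡⟨ cong (λ x → x ∸ 2 * d + j) s+r≡j ⟩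
              j ∸ 2 * d + j ≡⟨ sym (+-∸-comm j (≤-trans 2d≤s s≤j)) ⟩
              (j + j) ∸ 2 * d ≡⟨ cong (_∸ 2 * d) (cong (j +_) (sym (+-identityʳ j))) ⟩
              2 * j ∸ 2 * d ∎

  -- Summing over the classes

  n<2^n : ∀ n → n < 2 ^ n
  n<2^n zero    = s≤s z≤n
  n<2^n (suc n) = subst (suc (suc n) ≤_) (sym (2^suc n)) (+-mono-≤ (2^-pos n) (n<2^n n))

  ∑-<≤ : ∀ {L} → Unique L → ∀ M → ∑ L (λ a → ind (a <? M)) ≤ M
  ∑-<≤ {L} uL M = begin
    ∑ L (λ a → ind (a <? M)) ≤⟨ ∑-mono L (λ a _ → ind≤ (a <? M) (λ a<M →
      ≤-trans (≤-reflexive (sym (ind-yes (a ≟ a) refl))) (∑-∈ (λ t → ind (a ≟ t)) (∈-upTo⁺ a<M)))) ⟩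
    ∑ L (λ a → ∑ (upTo M) (λ t → ind (a ≟ t))) ≡⟨ ∑-swap L (upTo M) _ ⟩
    ∑ (upTo M) (λ t → ∑ L (λ a → ind (a ≟ t))) ≤⟨ ∑-mono (upTo M) (λ t _ → ∑-≡≤1 t uL) ⟩
    ∑ (upTo M) (λ t → 1) ≡⟨ trans (∑-one (upTo M)) (length-upTo M) ⟩
    M ∎
    where open ≤-Reasoning

  -- With k + 1 = 8ᵈ and w = 64 · 8ᵈ windows the contributions in units of 16ᵈ N² are 165 = 1 + 128
  -- + 36, then 26, 32 · 64 and 512. Their sum 2751 is rounded up to a power of two.
  sidon-bound : ∀ {L n} → Unique L → (∀ {a} → a ∈ L → 0 < a) → (∀ {a} → a ∈ L → a ≤ n) → Is3Sidon (_∈ L) →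
    ∀ j d → n < 8 * (2 ^ j * (2 ^ j * 2 ^ j)) → 2 ^ (6 * d) ≤ j → j < 2 ^ (6 + 6 * d) →
    length L ≤ ∑ (upTo (suc n)) (λ p → ind (prime? p)) + ∑ (upTo (suc n)) (λ p → ind (prime? p ×-dec (2 * p ≤? n)))
               + 4096 * (2 ^ (4 * d) * (2 ^ j * 2 ^ j))
  sidon-bound {L} {n} uL L>0 L≤n sidon j d n< lo hi with 2 ^ (3 * d) in k-eq
  -- The power is matched as a successor because `rough-count` takes the roughness bound in the form
  -- 2^(k + 1).
  ... | zero = contradiction k-eq (≢-sym (<⇒≢ (2^-pos (3 * d))))
  ... | suc k = begin
    length L ≡⟨ sym (∑-one L) ⟩
    ∑ L (λ _ → 1) ≤⟨ ∑-mono L class ⟩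
    ∑ L (λ a → c₀ a + (c₁ a + (c₂ a + c₃ a)))
      ≡⟨ trans (∑-+ L c₀ _) (cong (∑ L c₀ +_) (trans (∑-+ L c₁ _) (cong (∑ L c₁ +_) (∑-+ L c₂ c₃)))) ⟩
    ∑ L c₀ + (∑ L c₁ + (∑ L c₂ + ∑ L c₃))
      ≤⟨ +-mono-≤ (∑-<≤ uL (N * N)) (+-mono-≤ (large-count L≤n) (+-mono-≤ (window-count (suc k) k≤j) (rough-count k d w (subst (suc j ≤_) w*k hi)))) ⟩
    N * N + (main + 128 * (N * N) + (suc k * (26 * (N * N)) +
      (36 * (N * N) + 8 * (2 ^ d * (w * (4 * (N * N)))) + suc j * (8 * 2 ^ (2 * j ∸ 2 * d)))))
      ≡⟨ solve 6 (λ x main k d w g → x :+ (main :+ con 128 :* x :+ (k :* (con 26 :* x) :+ (con 36 :* x :+ con 8 :* (d :* (w :* (con 4 :* x))) :+ g)))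
           := main :+ (con 165 :* x :+ con 26 :* (k :* x) :+ con 32 :* (d :* w :* x) :+ g)) refl (N * N) main (suc k) (2 ^ d) w (suc j * (8 * 2 ^ (2 * j ∸ 2 * d))) ⟩
    main + (165 * (N * N) + 26 * (suc k * (N * N)) + 32 * (2 ^ d * w * (N * N)) + suc j * (8 * 2 ^ (2 * j ∸ 2 * d)))
      ≤⟨ +-monoʳ-≤ main (+-mono-≤ (+-mono-≤ (+-mono-≤
           (*-monoʳ-≤ 165 (≤-trans (≤-reflexive (sym (*-identityˡ (N * N)))) (*-monoˡ-≤ (N * N) (2^-pos (4 * d)))))
           (*-monoʳ-≤ 26 (*-monoˡ-≤ (N * N) k≤D))) (≤-reflexive (cong (λ x → 32 * (x * (N * N))) dw≡))) j-term) ⟩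
    main + (165 * (D * (N * N)) + 26 * (D * (N * N)) + 32 * (64 * D * (N * N)) + 512 * (D * (N * N)))
      ≤⟨ +-monoʳ-≤ main (begin
           165 * (D * (N * N)) + 26 * (D * (N * N)) + 32 * (64 * D * (N * N)) + 512 * (D * (N * N))
             ≡⟨ cong (λ x → 165 * (D * (N * N)) + 26 * (D * (N * N)) + 32 * x + 512 * (D * (N * N))) (*-assoc 64 D (N * N)) ⟩
           165 * x + 26 * x + 32 * (64 * x) + 512 * x
             ≡⟨ cong (λ y → 165 * x + 26 * x + y + 512 * x) (sym (*-assoc 32 64 x)) ⟩
           165 * x + 26 * x + 2048 * x + 512 * x
             ≡⟨ trans (cong (_+ 512 * x) (trans (cong (_+ 2048 * x) (sym (*-distribʳ-+ x 165 26))) (sym (*-distribʳ-+ x 191 2048)))) (sym (*-distribʳ-+ x 2239 512)) ⟩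
           2751 * x ≤⟨ *-monoˡ-≤ x (m≤m+n 2751 1345) ⟩
           4096 * x ∎) ⟩
    main + 4096 * x ∎
    where
    open ≤-Reasoning
    open +-*-Solver
    open ClassCounts uL L>0 sidon {j} (λ a∈ → ≤-<-trans (L≤n a∈) n<)
    w main D x : ℕ
    w = 2 ^ (6 + 3 * d)
    main = ∑ (upTo (suc n)) (λ p → ind (prime? p)) + ∑ (upTo (suc n)) (λ p → ind (prime? p ×-dec (2 * p ≤? n)))
    D = 2 ^ (4 * d)
    x = D * (N * N)
    c₀ c₁ c₂ c₃ : ℕ → ℕ
    c₀ a = ind (a <? N * N)
    c₁ a = ind (Large.hasDivisor? a)
    c₂ a = ind (Win.hasDivisor? (suc k) a)
    c₃ a = ind (Rgh.hasDivisor? k a)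
    w*k : 2 ^ (6 + 6 * d) ≡ w * suc k
    w*k = trans (cong (2 ^_) (solve 1 (λ d → con 6 :+ con 6 :* d := (con 6 :+ con 3 :* d) :+ con 3 :* d) refl d))
      (trans (^-distribˡ-+-* 2 (6 + 3 * d) (3 * d)) (cong (w *_) k-eq))
    k≤j : suc k ≤ j
    k≤j = ≤-trans (≤-reflexive (sym k-eq)) (≤-trans (^-monoʳ-≤ 2 (*-monoˡ-≤ d (s≤s (s≤s (s≤s (z≤n {3})))))) lo)
    k≤D : suc k ≤ D
    k≤D = ≤-trans (≤-reflexive (sym k-eq)) (^-monoʳ-≤ 2 (*-monoˡ-≤ d (n≤1+n 3)))
    dw≡ : 2 ^ d * w ≡ 64 * D
    dw≡ = trans (sym (^-distribˡ-+-* 2 d (6 + 3 * d))) (trans (cong (2 ^_) (solve 1 (λ d → d :+ (con 6 :+ con 3 :* d) := con 6 :+ con 4 :* d) refl d))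
      (^-distribˡ-+-* 2 6 (4 * d)))
    d≤j : d ≤ j
    d≤j = ≤-trans (<⇒≤ (n<2^n d)) (≤-trans (^-monoʳ-≤ 2 (m≤n*m d 6)) lo)
    j-term : suc j * (8 * 2 ^ (2 * j ∸ 2 * d)) ≤ 512 * (D * (N * N))
    j-term = begin
      suc j * (8 * 2 ^ (2 * j ∸ 2 * d)) ≤⟨ *-monoˡ-≤ _ hi ⟩
      2 ^ (6 + 6 * d) * (2 ^ 3 * 2 ^ (2 * j ∸ 2 * d)) ≡⟨ cong (2 ^ (6 + 6 * d) *_) (sym (^-distribˡ-+-* 2 3 (2 * j ∸ 2 * d))) ⟩
      2 ^ (6 + 6 * d) * 2 ^ (3 + (2 * j ∸ 2 * d)) ≡⟨ sym (^-distribˡ-+-* 2 (6 + 6 * d) (3 + (2 * j ∸ 2 * d))) ⟩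
      2 ^ (6 + 6 * d + (3 + (2 * j ∸ 2 * d))) ≡⟨ cong (2 ^_) exponent ⟩
      2 ^ (9 + (4 * d + (j + j))) ≡⟨ trans (^-distribˡ-+-* 2 9 (4 * d + (j + j))) (cong (512 *_) (trans (^-distribˡ-+-* 2 (4 * d) (j + j)) (cong (D *_) (^-distribˡ-+-* 2 j j)))) ⟩
      512 * (D * (N * N)) ∎
      where
      exponent : 6 + 6 * d + (3 + (2 * j ∸ 2 * d)) ≡ 9 + (4 * d + (j + j))
      exponent = begin-equality
        6 + 6 * d + (3 + (2 * j ∸ 2 * d)) ≡⟨ solve 2 (λ d y → con 6 :+ con 6 :* d :+ (con 3 :+ y) := con 9 :+ (con 4 :* d :+ (con 2 :* d :+ y))) refl d (2 * j ∸ 2 * d) ⟩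
        9 + (4 * d + (2 * d + (2 * j ∸ 2 * d))) ≡⟨ cong (λ y → 9 + (4 * d + y)) (m+[n∸m]≡n (*-monoʳ-≤ 2 d≤j)) ⟩
        9 + (4 * d + (j + (j + 0))) ≡⟨ cong (λ y → 9 + (4 * d + (j + y))) (+-identityʳ j) ⟩
        9 + (4 * d + (j + j)) ∎
    1<N : 1 < N
    1<N = ^-monoʳ-< 2 (s≤s (s≤s z≤n)) (≤-trans (2^-pos (6 * d)) lo)
    class : ∀ a → a ∈ L → 1 ≤ c₀ a + (c₁ a + (c₂ a + c₃ a))
    class a a∈ with N * N ≤? a
    ... | no small = m≤n⇒m≤n+o _ (≤-reflexive (sym (ind-yes (a <? N * N) (≰⇒> small))))
    ... | yes N²≤a = m≤n⇒m≤o+n (c₀ a) (cover (Large.hasDivisor? a) (Win.hasDivisor? (suc k) a) (Rgh.hasDivisor? k a) (found (classify {y = 2 ^ suc k} 1<N N²≤a)))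
      where
      found : (∃[ v ] (v ∣ a × LargePrime N v)) ⊎ (∃[ v ] (v ∣ a × Window N (2 ^ suc k) v)) ⊎ (∃[ v ] (v ∣ a × RoughShort N (2 ^ suc k) v)) →
              Large.HasDivisor a ⊎ Win.HasDivisor (suc k) a ⊎ Rgh.HasDivisor k a
      found (inj₁ (v , v∣a , q))        = inj₁ (Large.hasDivisor (L>0 a∈) v∣a q)
      found (inj₂ (inj₁ (v , v∣a , q))) = inj₂ (inj₁ (Win.hasDivisor (suc k) (L>0 a∈) v∣a q))
      found (inj₂ (inj₂ (v , v∣a , q))) = inj₂ (inj₂ (Rgh.hasDivisor k (L>0 a∈) v∣a q))

  -- Passage to `G₃` and `π`

  open import Data.Integer.Base as ℤ using (+_)
  import Data.Integer.Properties as ℤ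
  open import Data.Rational.Base as ℚ using (mkℚ; ↥_)
  import Data.Rational.Properties as ℚ
  import Data.Rational.Unnormalised.Base as ℚᵘ
  import Data.Rational.Unnormalised.Properties as ℚᵘ
  open import Data.Fin.Base as Fin using ()
  open import Data.Fin.Properties using (toℕ<n)
  open import Data.Fin.Subset as Subset using (Subset; inside; outside)
  open import Data.Vec.Base as Vec using ([]; _∷_)

  elements : ∀ {n} → Subset n → List ℕ
  elements []            = []
  elements (inside ∷ A)  = 1 ∷ map suc (elements A)
  elements (outside ∷ A) = map suc (elements A)

  length-elements : ∀ {n} (A : Subset n) → length (elements A) ≡ Subset.∣ A ∣
  length-elements []            = refl
  length-elements (inside ∷ A)  = cong suc (trans (length-map suc (elements A)) (length-elements A))
  length-elements (outside ∷ A) = trans (length-map suc (elements A)) (length-elements A)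

  shift : ∀ {n} {A : Subset n} {b m} → ⟦ A ⟧ m → ⟦ b ∷ A ⟧ (suc m)
  shift (i , i∈ , eq) = Fin.suc i , Vec.there i∈ , cong suc eq

  ∈-elements : ∀ {n} (A : Subset n) {m} → m ∈ elements A → ⟦ A ⟧ m
  ∈-elements (inside ∷ A) (here refl) = Fin.zero , Vec.here , refl
  ∈-elements (inside ∷ A) (there m∈) with ∈-map⁻ suc m∈
  ... | _ , m′∈ , refl = shift (∈-elements A m′∈)
  ∈-elements (outside ∷ A) m∈ with ∈-map⁻ suc m∈
  ... | _ , m′∈ , refl = shift (∈-elements A m′∈)

  ⟦⟧-range : ∀ {n} {A : Subset n} {m} → ⟦ A ⟧ m → 0 < m × m ≤ n
  ⟦⟧-range (i , _ , refl) = s≤s z≤n , toℕ<n i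

  elements-unique : ∀ {n} (A : Subset n) → Unique (elements A)
  elements-unique []            = []
  elements-unique (inside ∷ A)  = All.tabulate new ∷ Unique.map⁺ suc-injective (elements-unique A)
    where
    new : ∀ {m} → m ∈ map suc (elements A) → 1 ≢ m
    new m∈ refl with ∈-map⁻ suc m∈
    ... | _ , 0∈ , refl = contradiction (proj₁ (⟦⟧-range (∈-elements A 0∈))) (<-irrefl refl)
  elements-unique (outside ∷ A) = Unique.map⁺ suc-injective (elements-unique A)

  extremal : ∀ n → ∃[ L ] (Unique L × (∀ {a} → a ∈ L → 0 < a) × (∀ {a} → a ∈ L → a ≤ n) × Is3Sidon (_∈ L) × length L ≡ G₃ n)
  extremal n = let A , sidon , size = G₃-attained n in
    elements A , elements-unique A , proj₁ ∘ ⟦⟧-range ∘ ∈-elements A , proj₂ ∘ ⟦⟧-range ∘ ∈-elements A ,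
    (λ a b c d e f → sidon (∈-elements A a) (∈-elements A b) (∈-elements A c) (∈-elements A d) (∈-elements A e) (∈-elements A f)) ,
    trans (length-elements A) size

  -- Lets the range of summation change: `π` searches up to the numerator of its argument, not up to
  -- n.
  ∑-ind-⊆ : ∀ {P Q : Pred ℕ 0ℓ} (P? : Decidable P) (Q? : Decidable Q) {xs ys} → Unique xs →
            (∀ {x} → x ∈ xs → P x → x ∈ ys × Q x) → ∑ xs (λ x → ind (P? x)) ≤ ∑ ys (λ y → ind (Q? y))
  ∑-ind-⊆ {P} {Q} P? Q? {xs} {ys} un h = begin
    ∑ xs (λ x → ind (P? x)) ≤⟨ ∑-mono xs (λ x x∈ → ind≤ (P? x) (λ p → let x∈′ , q = h x∈ p in
      ≤-trans (≤-reflexive (sym (ind-yes (K? x x) (q , refl)))) (∑-∈ (λ y → ind (K? x y)) x∈′))) ⟩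
    ∑ xs (λ x → ∑ ys (λ y → ind (K? x y))) ≡⟨ ∑-swap xs ys _ ⟩
    ∑ ys (λ y → ∑ xs (λ x → ind (K? x y))) ≤⟨ ∑-mono ys (λ y _ → once y) ⟩
    ∑ ys (λ y → ind (Q? y)) ∎
    where
    open ≤-Reasoning
    K? : ∀ x y → Dec (Q y × x ≡ y)
    K? x y = Q? y ×-dec (x ≟ y)
    once : ∀ y → ∑ xs (λ x → ind (K? x y)) ≤ ind (Q? y)
    once y with Q? y
    ... | yes q = ∑-unique-ind (λ x → yes q ×-dec (x ≟ y)) un (λ _ _ (_ , p) (_ , p′) → trans p (sym p′))
    ... | no ¬q = ≤-reflexive (trans (∑-cong xs (λ x → ind-no (no ¬q ×-dec (x ≟ y)) (λ r → ¬q (proj₁ r)))) (∑-zero xs))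

  fromℕ≤⇒≤∣↥∣ : ∀ {p x} → fromℕ p ℚ.≤ x → p ≤ ℤ.∣ ↥ x ∣
  fromℕ≤⇒≤∣↥∣ {p} {x@(mkℚ num d _)} (ℚ.*≤* le) = go num (subst₂ ℤ._≤_ (sym (ℤ.pos-* p (suc d))) (ℤ.*-identityʳ num) le)
    where
    go : ∀ i → + (p * suc d) ℤ.≤ i → p ≤ ℤ.∣ i ∣
    go (+ m) (ℤ.+≤+ le) = ≤-trans (m≤m*n p (suc d)) le

  ∑≤π : ∀ {P : Pred ℕ 0ℓ} (P? : Decidable P) m x → (∀ {p} → p < m → P p → Prime p × fromℕ p ℚ.≤ x) →
        ∑ (upTo m) (λ p → ind (P? p)) ≤ π x
  ∑≤π P? m x h = subst (∑ (upTo m) (λ p → ind (P? p)) ≤_) (sym (length-filter Q? (upTo (suc ℤ.∣ ↥ x ∣))))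
    (∑-ind-⊆ P? Q? (Unique.upTo⁺ m) (λ p∈ pp → let q = h (∈-upTo⁻ p∈) pp in ∈-upTo⁺ (s≤s (fromℕ≤⇒≤∣↥∣ (proj₂ q))) , q))
    where
    Q? : Decidable (λ p → Prime p × fromℕ p ℚ.≤ x)
    Q? p = prime? p ×-dec (fromℕ p ℚ.≤? x)

  -- Comparing with the unnormalised fraction n/(k + 1) avoids the reduction to lowest terms
  -- performed by `/`.
  fromℕ≤/ : ∀ {p n} k → suc k * p ≤ n → fromℕ p ℚ.≤ (+ n ℚ./ suc k)
  fromℕ≤/ {p} {n} k le = ℚ.toℚᵘ-cancel-≤ (ℚᵘ.≤-respʳ-≃ (ℚᵘ.≃-sym (ℚ.toℚᵘ-fromℚᵘ (ℚᵘ.mkℚᵘ (+ n) k)))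
    (ℚᵘ.*≤* (subst₂ ℤ._≤_ (ℤ.pos-* p (suc k)) (sym (ℤ.*-identityʳ (+ n))) (ℤ.+≤+ (subst (_≤ n) (*-comm (suc k) p) le)))))

  ∑-prime≤π : ∀ n → ∑ (upTo (suc n)) (λ p → ind (prime? p)) ≤ π (+ n ℚ./ 1)
  ∑-prime≤π n = ∑≤π prime? (suc n) (+ n ℚ./ 1) (λ {p} p≤n pp → pp , fromℕ≤/ {p} 0 (subst (_≤ n) (sym (*-identityˡ p)) (s≤s⁻¹ p≤n)))

  ∑-prime≤π/2 : ∀ n → ∑ (upTo (suc n)) (λ p → ind (prime? p ×-dec (2 * p ≤? n))) ≤ π (+ n ℚ./ 2)
  ∑-prime≤π/2 n = ∑≤π (λ p → prime? p ×-dec (2 * p ≤? n)) (suc n) (+ n ℚ./ 2) (λ {p} _ (pp , 2p≤n) → pp , fromℕ≤/ {p} 1 2p≤n)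

module Analysis where

  open Finite using (n<2^n; extremal; sidon-bound; ∑-prime≤π; ∑-prime≤π/2)
  open import Defs
  open import Data.Nat.Base as ℕ using (ℕ; zero; suc; z≤n; s≤s)
  import Data.Nat.Properties as ℕ
  open import Data.Nat.Solver using () renaming (module +-*-Solver to ℕS)
  open import Data.Integer.Base using (+_)
  open import Data.Rational.Base using (ℚ; 0ℚ; 1ℚ; _+_; _*_; _-_; -_; _/_; _≤_; _<_; nonNegative; positive)
  open import Data.Rational.Properties
  open import Data.Rational.Solver using (module +-*-Solver)
  open import Data.Product.Base using (∃-syntax; _×_; _,_; proj₁; proj₂)
  open import Relation.Binary.PropositionalEquality
  open import Relation.Nullary using (yes; no; contradiction)
  open +-*-Solver using (solve; _:=_; _:+_; _:*_; _:-_; con)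
  open ℝ


  -- Lower bounds for powers and for the exponential

  x≤x+y : ∀ {x y} → 0ℚ ≤ y → x ≤ x + y
  x≤x+y {x} {y} 0≤y = subst (_≤ x + y) (+-identityʳ x) (+-monoʳ-≤ x 0≤y)

  *-monoˡ : ∀ {a x y} → 0ℚ ≤ a → x ≤ y → a * x ≤ a * y
  *-monoˡ {a} 0≤a = *-monoˡ-≤-nonNeg a {{nonNegative 0≤a}}

  *-monoʳ : ∀ {a x y} → 0ℚ ≤ a → x ≤ y → x * a ≤ y * a
  *-monoʳ {a} 0≤a = *-monoʳ-≤-nonNeg a {{nonNegative 0≤a}}

  ^-mono : ∀ {x y} → 0ℚ ≤ x → x ≤ y → ∀ k → x ^ k ≤ y ^ k
  ^-mono 0≤x x≤y zero    = ≤-refl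
  ^-mono 0≤x x≤y (suc k) = *-mono 0≤x x≤y (^-nonNeg 0≤x k) (^-mono 0≤x x≤y k)

  ^-pos : ∀ {x} → 0ℚ < x → ∀ k → 0ℚ < x ^ k
  ^-pos 0<x zero    = 0<1
  ^-pos 0<x (suc k) = *-pos 0<x (^-pos 0<x k)

  ^-cancel-≤ : ∀ {x y} → 0ℚ ≤ x → 0ℚ ≤ y → ∀ k → x ^ suc k ≤ y ^ suc k → x ≤ y
  ^-cancel-≤ {x} {y} 0≤x 0≤y k le with x ≤? y
  ... | yes x≤y = x≤y
  ... | no x≰y  = contradiction (<-≤-trans (≤-<-trans (*-monoˡ 0≤y (^-mono 0≤y (<⇒≤ y<x) k))
      (*-monoˡ-<-pos (x ^ k) {{positive (^-pos (≤-<-trans 0≤y y<x) k)}} y<x)) le) (<-irrefl refl)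
    where
    y<x : y < x
    y<x = ≰⇒> x≰y

  -- The first-order bound for a power. Applied to each term, it gives the growth of both the
  -- exponential and the artanh series.
  bernoulli : ∀ {x h} → 0ℚ ≤ x → 0ℚ ≤ h → ∀ k → x ^ suc k + fromℕ (suc k) * (h * x ^ k) ≤ (x + h) ^ suc k
  bernoulli {x} {h} 0≤x 0≤h zero = ≤-reflexive (solve 2 (λ x h → x :* con 1ℚ :+ con 1ℚ :* (h :* con 1ℚ) := (x :+ h) :* con 1ℚ) refl x h)
  bernoulli {x} {h} 0≤x 0≤h (suc k) = begin
    x * X + fromℕ (suc (suc k)) * (h * X)
      ≡⟨ cong (λ c → x * X + c * (h * X)) (fromℕ-suc (suc k)) ⟩
    x * X + (1ℚ + c) * (h * X)
      ≤⟨ x≤x+y (*-nonNeg (*-nonNeg (fromℕ-nonNeg (suc k)) (*-nonNeg 0≤h 0≤h)) (^-nonNeg 0≤x k)) ⟩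
    (x * X + (1ℚ + c) * (h * X)) + (c * (h * h)) * x ^ k
      ≡⟨ solve 4 (λ x h c Y → (x :* (x :* Y) :+ (con 1ℚ :+ c) :* (h :* (x :* Y))) :+ (c :* (h :* h)) :* Y
           := (x :+ h) :* (x :* Y :+ c :* (h :* Y))) refl x h c (x ^ k) ⟩
    (x + h) * (X + c * (h * x ^ k))
      ≤⟨ *-monoˡ (+-nonNeg 0≤x 0≤h) (bernoulli 0≤x 0≤h k) ⟩
    (x + h) * (x + h) ^ suc k ∎
    where
    open ≤-Reasoning
    X c : ℚ
    X = x ^ suc k
    c = fromℕ (suc k)

  expApprox-nonNeg : ∀ {x} → 0ℚ ≤ x → ∀ K → 0ℚ ≤ expApprox K x
  expApprox-nonNeg 0≤x zero    = ≤-refl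
  expApprox-nonNeg 0≤x (suc K) = +-nonNeg (expApprox-nonNeg 0≤x K) (*-nonNeg (expCoeff-nonNeg K) (^-nonNeg 0≤x K))

  expApprox-mono : ∀ {x y} → 0ℚ ≤ x → x ≤ y → ∀ K → expApprox K x ≤ expApprox K y
  expApprox-mono 0≤x x≤y zero    = ≤-refl
  expApprox-mono 0≤x x≤y (suc K) = +-mono-≤ (expApprox-mono 0≤x x≤y K) (*-monoˡ (expCoeff-nonNeg K) (^-mono 0≤x x≤y K))

  expApprox-more : ∀ {x M K} → 0ℚ ≤ x → M ℕ.≤ K → expApprox M x ≤ expApprox K x
  expApprox-more 0≤x M≤K = ∑<-mono (λ k → *-nonNeg (expCoeff-nonNeg k) (^-nonNeg 0≤x k)) (ℕ.≤⇒≤′ M≤K)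

  -- The finite form of exp (x + h) ≥ exp x + h exp x. The factor K + 1 from Bernoulli turns the
  -- coefficient 1/(K + 1)! into 1/K!, which reproduces the series one order lower.
  expApprox-+ : ∀ {x h} → 0ℚ ≤ x → 0ℚ ≤ h → ∀ K → expApprox (suc K) x + h * expApprox K x ≤ expApprox (suc K) (x + h)
  expApprox-+ {x} {h} 0≤x 0≤h zero = ≤-reflexive (trans (cong (λ u → expApprox 1 x + u) (*-zeroʳ h)) (+-identityʳ _))
  expApprox-+ {x} {h} 0≤x 0≤h (suc K) = begin
    (E + c * x ^ suc K) + h * (expApprox K x + expCoeff K * x ^ K)
      ≡⟨ cong (λ u → (E + c * x ^ suc K) + h * (expApprox K x + u * x ^ K)) (sym (expCoeff-suc K)) ⟩
    (E + c * x ^ suc K) + h * (expApprox K x + (c * s) * x ^ K)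
      ≡⟨ solve 7 (λ E c X h F s Y → (E :+ c :* X) :+ h :* (F :+ (c :* s) :* Y) := (E :+ h :* F) :+ c :* (X :+ s :* (h :* Y)))
           refl E c (x ^ suc K) h (expApprox K x) s (x ^ K) ⟩
    (E + h * expApprox K x) + c * (x ^ suc K + s * (h * x ^ K))
      ≤⟨ +-mono-≤ (expApprox-+ 0≤x 0≤h K) (*-monoˡ (expCoeff-nonNeg (suc K)) (bernoulli 0≤x 0≤h K)) ⟩
    expApprox (suc K) (x + h) + c * (x + h) ^ suc K ∎
    where
    open ≤-Reasoning
    E c s : ℚ
    E = expApprox (suc K) x
    c = expCoeff (suc K)
    s = fromℕ (suc K)

  expApprox-step : ∀ {x h} → 0ℚ ≤ x → 0ℚ ≤ h → ∀ K → (1ℚ + h) * expApprox K x ≤ expApprox (suc K) (x + h)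
  expApprox-step {x} {h} 0≤x 0≤h K = ≤-trans
    (≤-trans (≤-reflexive (trans (*-distribʳ-+ (expApprox K x) 1ℚ h) (cong (_+ h * expApprox K x) (*-identityˡ (expApprox K x)))))
      (+-monoˡ-≤ (h * expApprox K x) (expApprox-more 0≤x (ℕ.n≤1+n K))))
    (expApprox-+ 0≤x 0≤h K)

  unit : ℕ → ℚ
  unit i = inv (fromℕ (suc (suc i)))

  unit-pos : ∀ i → 0ℚ < unit i
  unit-pos i = inv-pos (fromℕ-mono-< {0} {suc (suc i)} (ℕ.s≤s ℕ.z≤n))

  -- H M = 1/2 + ⋯ + 1/(M + 1), and Π c M is the product of 1 + c/m over 2 ≤ m ≤ M + 1.
  H : ℕ → ℚ
  H M = ∑< M unit

  H-nonNeg : ∀ M → 0ℚ ≤ H M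
  H-nonNeg zero    = ≤-refl
  H-nonNeg (suc M) = +-nonNeg (H-nonNeg M) (<⇒≤ (unit-pos M))

  Π : ℚ → ℕ → ℚ
  Π c zero    = 1ℚ
  Π c (suc M) = (1ℚ + c * unit M) * Π c M

  Π-nonNeg : ∀ {c} → 0ℚ ≤ c → ∀ M → 0ℚ ≤ Π c M
  Π-nonNeg 0≤c zero    = <⇒≤ 0<1
  Π-nonNeg 0≤c (suc M) = *-nonNeg (+-nonNeg (<⇒≤ 0<1) (*-nonNeg 0≤c (<⇒≤ (unit-pos M)))) (Π-nonNeg 0≤c M)

  -- `expApprox-step` trades each summand c/m of the exponent for a factor 1 + c/m, at the price of
  -- one more series term; hence the `suc M` terms.
  Π≤exp : ∀ {c} → 0ℚ ≤ c → ∀ M → Π c M ≤ expApprox (suc M) (c * H M)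
  Π≤exp {c} 0≤c zero = ≤-refl
  Π≤exp {c} 0≤c (suc M) = begin
    (1ℚ + c * unit M) * Π c M
      ≤⟨ *-monoˡ (+-nonNeg (<⇒≤ 0<1) 0≤cu) (Π≤exp 0≤c M) ⟩
    (1ℚ + c * unit M) * expApprox (suc M) (c * H M)
      ≤⟨ expApprox-step (*-nonNeg 0≤c (H-nonNeg M)) 0≤cu (suc M) ⟩
    expApprox (suc (suc M)) (c * H M + c * unit M)
      ≡⟨ cong (expApprox (suc (suc M))) (sym (*-distribˡ-+ c (H M) (unit M))) ⟩
    expApprox (suc (suc M)) (c * H (suc M)) ∎
    where
    open ≤-Reasoning
    0≤cu : 0ℚ ≤ c * unit M
    0≤cu = *-nonNeg 0≤c (<⇒≤ (unit-pos M))

  Π≤expApprox : ∀ {c} → 0ℚ ≤ c → ∀ {M K y} → suc M ℕ.≤ K → c * H M ≤ y → Π c M ≤ expApprox K y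
  Π≤expApprox {c} 0≤c {M} {K} le h = ≤-trans (Π≤exp 0≤c M) (≤-trans (expApprox-more (*-nonNeg 0≤c (H-nonNeg M)) le)
    (expApprox-mono (*-nonNeg 0≤c (H-nonNeg M)) h K))

  unit-inv : ∀ i → fromℕ (suc (suc i)) * unit i ≡ 1ℚ
  unit-inv i = inv-right (fromℕ-mono-< {0} {suc (suc i)} (ℕ.s≤s ℕ.z≤n))

  -- The factors (m + 1)/m telescope from m = 2 to m = M + 1.
  Π-telescope : ∀ M → fromℕ 2 * Π 1ℚ M ≡ fromℕ (suc (suc M))
  Π-telescope zero    = refl
  Π-telescope (suc M) = begin
    fromℕ 2 * ((1ℚ + 1ℚ * u) * Π 1ℚ M)    ≡⟨ solve 3 (λ t u P → t :* ((con 1ℚ :+ con 1ℚ :* u) :* P) := (con 1ℚ :+ u) :* (t :* P)) refl (fromℕ 2) u (Π 1ℚ M) ⟩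
    (1ℚ + u) * (fromℕ 2 * Π 1ℚ M)         ≡⟨ cong ((1ℚ + u) *_) (Π-telescope M) ⟩
    (1ℚ + u) * m                          ≡⟨ solve 2 (λ u m → (con 1ℚ :+ u) :* m := m :* u :+ m) refl u m ⟩
    m * u + m                             ≡⟨ cong (_+ m) (unit-inv M) ⟩
    1ℚ + m                                ≡⟨ sym (fromℕ-suc (suc (suc M))) ⟩
    fromℕ (suc (suc (suc M)))             ∎
    where
    open ≡-Reasoning
    u m : ℚ
    u = unit M
    m = fromℕ (suc (suc M))

  ^-distrib-* : ∀ x y k → (x * y) ^ k ≡ x ^ k * y ^ k
  ^-distrib-* x y zero    = refl
  ^-distrib-* x y (suc k) = trans (cong (x * y *_) (^-distrib-* x y k))
    (solve 4 (λ x y X Y → (x :* y) :* (X :* Y) := (x :* X) :* (y :* Y)) refl x y (x ^ k) (y ^ k))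

  Π-power : ∀ {c} → 0ℚ ≤ c → ∀ k l → (∀ {t} → 0ℚ ≤ t → (1ℚ + 1ℚ * t) ^ l ≤ (1ℚ + c * t) ^ k) → ∀ M → Π 1ℚ M ^ l ≤ Π c M ^ k
  Π-power 0≤c k l h zero = ≤-reflexive (trans (1^ l) (sym (1^ k)))
    where
    1^ : ∀ k → 1ℚ ^ k ≡ 1ℚ
    1^ zero    = refl
    1^ (suc k) = trans (*-identityˡ (1ℚ ^ k)) (1^ k)
  Π-power {c} 0≤c k l h (suc M) = subst₂ _≤_ (sym (^-distrib-* _ (Π 1ℚ M) l)) (sym (^-distrib-* _ (Π c M) k))
    (*-mono (^-nonNeg (+-nonNeg (<⇒≤ 0<1) (*-nonNeg (<⇒≤ 0<1) (<⇒≤ (unit-pos M)))) l) (h (<⇒≤ (unit-pos M)))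
      (^-nonNeg (Π-nonNeg (<⇒≤ 0<1) M) l) (Π-power 0≤c k l h M))

  -- As 3 · 2/3 = 2, the constant and linear terms agree on both sides, and the difference is t²
  -- times a polynomial with nonnegative coefficients. The next inequality is the same with 6 · 5/6
  -- = 5.
  [1+t]²≤ : ∀ {t} → 0ℚ ≤ t → (1ℚ + 1ℚ * t) ^ 2 ≤ (1ℚ + (+ 2 / 3) * t) ^ 3
  [1+t]²≤ {t} 0≤t = ≤-from-diff (subst (0ℚ ≤_)
    (solve 1 (λ t → (t :* t) :* (con (+ 1 / 3) :+ con (+ 8 / 27) :* t) :=
      (con 1ℚ :+ con (+ 2 / 3) :* t) :* ((con 1ℚ :+ con (+ 2 / 3) :* t) :* ((con 1ℚ :+ con (+ 2 / 3) :* t) :* con 1ℚ))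
      :- (con 1ℚ :+ con 1ℚ :* t) :* ((con 1ℚ :+ con 1ℚ :* t) :* con 1ℚ)) refl t)
    (*-nonNeg (*-nonNeg 0≤t 0≤t) (+-nonNeg (nonNegative⁻¹ (+ 1 / 3)) (*-nonNeg (nonNegative⁻¹ (+ 8 / 27)) 0≤t))))

  [1+t]⁵≤ : ∀ {t} → 0ℚ ≤ t → (1ℚ + 1ℚ * t) ^ 5 ≤ (1ℚ + (+ 5 / 6) * t) ^ 6
  [1+t]⁵≤ {t} 0≤t = ≤-from-diff (subst (0ℚ ≤_)
    (solve 1 (λ t → (t :* t) :* (con (+ 5 / 12) :+ t :* (con (+ 85 / 54) :+ t :* (con (+ 965 / 432) :+ t :* (con (+ 1829 / 1296) :+ t :* con (+ 15625 / 46656))))) :=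
      (let a = con 1ℚ :+ con (+ 5 / 6) :* t in a :* (a :* (a :* (a :* (a :* (a :* con 1ℚ))))))
      :- (let b = con 1ℚ :+ con 1ℚ :* t in b :* (b :* (b :* (b :* (b :* con 1ℚ)))))) refl t)
    (*-nonNeg (*-nonNeg 0≤t 0≤t) (+-nonNeg (nonNegative⁻¹ (+ 5 / 12)) (*-nonNeg 0≤t (+-nonNeg (nonNegative⁻¹ (+ 85 / 54))
      (*-nonNeg 0≤t (+-nonNeg (nonNegative⁻¹ (+ 965 / 432)) (*-nonNeg 0≤t (+-nonNeg (nonNegative⁻¹ (+ 1829 / 1296))
        (*-nonNeg 0≤t (nonNegative⁻¹ (+ 15625 / 46656)))))))))) ))

  -- Lower bounds for the logarithm

  artanhSum : ℕ → ℚ → ℚ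
  artanhSum K z = ∑< K (λ k → artanhCoeff k * (z * z) ^ k)

  square^ : ∀ z k → (z * z) ^ k ≡ z ^ (2 ℕ.* k)
  square^ z zero    = refl
  square^ z (suc k) = trans (cong (z * z *_) (square^ z k))
    (trans (*-assoc z z (z ^ (2 ℕ.* k))) (cong (z ^_) (sym (ℕ.*-suc 2 k))))

  odd-bernoulli : ∀ {z δ} → 0ℚ ≤ z → 0ℚ ≤ δ → ∀ k →
    z * (z * z) ^ k + fromℕ (suc (2 ℕ.* k)) * (δ * (z * z) ^ k) ≤ (z + δ) * ((z + δ) * (z + δ)) ^ k
  odd-bernoulli {z} {δ} 0≤z 0≤δ k = subst₂ _≤_
    (cong (λ u → z * u + fromℕ (suc (2 ℕ.* k)) * (δ * u)) (sym (square^ z k)))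
    (cong ((z + δ) *_) (sym (square^ (z + δ) k)))
    (bernoulli 0≤z 0≤δ (2 ℕ.* k))

  -- The finite form of artanh (z + δ) ≥ artanh z + δ / (1 - z²): the factor 2 k + 1 from Bernoulli
  -- cancels the coefficient 1/(2 k + 1) and leaves the geometric series in z².
  artanh-increase : ∀ {z δ} → 0ℚ ≤ z → 0ℚ ≤ δ → ∀ K →
    z * artanhSum K z + δ * ∑< K ((z * z) ^_) ≤ (z + δ) * artanhSum K (z + δ)
  artanh-increase {z} {δ} _ _ zero = ≤-reflexive (solve 2 (λ z d → z :* con 0ℚ :+ d :* con 0ℚ := (z :+ d) :* con 0ℚ) refl z δ)
  artanh-increase {z} {δ} 0≤z 0≤δ (suc K) = begin
    z * (T + a * X) + δ * (R + X)
      ≡⟨ solve 6 (λ z T a X δ R → z :* (T :+ a :* X) :+ δ :* (R :+ X) := (z :* T :+ δ :* R) :+ (z :* (a :* X) :+ con 1ℚ :* (δ :* X))) refl z T a X δ R ⟩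
    (z * T + δ * R) + (z * (a * X) + 1ℚ * (δ * X))
      ≡⟨ cong (λ u → (z * T + δ * R) + (z * (a * X) + u * (δ * X))) (sym (fromℕ-*-1/n (suc (2 ℕ.* K)))) ⟩
    (z * T + δ * R) + (z * (a * X) + (s * a) * (δ * X))
      ≡⟨ cong (λ u → (z * T + δ * R) + u) (solve 5 (λ z a X s δ → z :* (a :* X) :+ (s :* a) :* (δ :* X) := a :* (z :* X :+ s :* (δ :* X))) refl z a X s δ) ⟩
    (z * T + δ * R) + a * (z * X + s * (δ * X))
      ≤⟨ +-mono-≤ (artanh-increase 0≤z 0≤δ K) (*-monoˡ (artanhCoeff-nonNeg K) (odd-bernoulli 0≤z 0≤δ K)) ⟩
    w * artanhSum K w + a * (w * (w * w) ^ K)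
      ≡⟨ solve 4 (λ w T a X → w :* T :+ a :* (w :* X) := w :* (T :+ a :* X)) refl w (artanhSum K w) a ((w * w) ^ K) ⟩
    w * (artanhSum K w + a * (w * w) ^ K) ∎
    where
    open ≤-Reasoning
    w T R X a s : ℚ
    w = z + δ
    T = artanhSum K z
    R = ∑< K ((z * z) ^_)
    X = (z * z) ^ K
    a = artanhCoeff K
    s = fromℕ (suc (2 ℕ.* K))

  ∑<-geometric : ∀ r K → (1ℚ - r) * ∑< K (r ^_) ≡ 1ℚ - r ^ K
  ∑<-geometric r zero    = *-zeroʳ (1ℚ - r)
  ∑<-geometric r (suc K) = trans (*-distribˡ-+ (1ℚ - r) (∑< K (r ^_)) (r ^ K))
    (trans (cong (_+ (1ℚ - r) * r ^ K) (∑<-geometric r K))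
      (solve 2 (λ r X → (con 1ℚ :- X) :+ (con 1ℚ :- r) :* X := con 1ℚ :- r :* X) refl r (r ^ K)))

  ^-small : ∀ {r η} → 0ℚ ≤ r → r < 1ℚ → 0ℚ < η → Eventually (λ K → r ^ K ≤ η)
  ^-small {r} {η} 0≤r r<1 0<η =
    let j , le = RatioTest.small (r ^_) (^-nonNeg 0≤r) r 0≤r r<1 0 (λ _ _ → ≤-refl) 0<η
    in j ℕ.+ 0 , λ K j≤K → ≤-trans (anti (ℕ.≤⇒≤′ j≤K)) le
    where
    anti : ∀ {m n} → m ℕ.≤′ n → r ^ n ≤ r ^ m
    anti (ℕ.≤′-reflexive refl) = ≤-refl
    anti (ℕ.≤′-step {n} le) = ≤-trans (≤-trans (*-monoʳ (^-nonNeg 0≤r n) (<⇒≤ r<1)) (≤-reflexive (*-identityˡ (r ^ n)))) (anti le)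

  -- In this form the monotonicity of `cayley` and its differences can be read off.
  cayley-inv : ∀ {q} → 0ℚ ≤ q → cayley q ≡ 1ℚ - fromℕ 2 * inv (q + 1ℚ)
  cayley-inv {q} 0≤q = trans
    (solve 2 (λ q i → (q :- con 1ℚ) :* i := (q :+ con 1ℚ) :* i :- con (fromℕ 2) :* i) refl q (inv (q + 1ℚ)))
    (cong (λ u → u - fromℕ 2 * inv (q + 1ℚ)) (inv-right (+-mono-≤-< 0≤q 0<1)))

  cayley-nonNeg : ∀ {q} → 1ℚ ≤ q → 0ℚ ≤ cayley q
  cayley-nonNeg {q} 1≤q = *-nonNeg (diff-nonNeg 1≤q) (<⇒≤ (inv-pos (+-mono-≤-< (≤-trans (<⇒≤ 0<1) 1≤q) 0<1)))

  cayley-mono : ∀ {q q′} → 0ℚ ≤ q → q ≤ q′ → cayley q ≤ cayley q′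
  cayley-mono {q} {q′} 0≤q q≤q′ = subst₂ _≤_ (sym (cayley-inv 0≤q)) (sym (cayley-inv (≤-trans 0≤q q≤q′)))
    (+-monoʳ-≤ 1ℚ (neg-antimono-≤ (*-monoˡ (fromℕ-nonNeg 2)
      (recip-anti (<⇒≤ (inv-pos 0<q+1)) (<⇒≤ (inv-pos 0<q′+1)) (inv-right 0<q+1) (inv-right 0<q′+1) (+-monoˡ-≤ 1ℚ q≤q′)))))
    where
    0<q+1 : 0ℚ < q + 1ℚ
    0<q+1 = +-mono-≤-< 0≤q 0<1
    0<q′+1 : 0ℚ < q′ + 1ℚ
    0<q′+1 = +-mono-≤-< (≤-trans 0≤q q≤q′) 0<1

  logApprox-increase : ∀ {q q′} → 1ℚ ≤ q → q ≤ q′ → ∀ K →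
    logApprox K q + fromℕ 2 * ((cayley q′ - cayley q) * ∑< K ((cayley q * cayley q) ^_)) ≤ logApprox K q′
  logApprox-increase {q} {q′} 1≤q q≤q′ K = begin
    (fromℕ 2 * z) * artanhSum K z + fromℕ 2 * (δ * R)
      ≡⟨ solve 5 (λ t z T δ R → (t :* z) :* T :+ t :* (δ :* R) := t :* (z :* T :+ δ :* R)) refl (fromℕ 2) z (artanhSum K z) δ R ⟩
    fromℕ 2 * (z * artanhSum K z + δ * R)
      ≤⟨ *-monoˡ (fromℕ-nonNeg 2) (artanh-increase (cayley-nonNeg 1≤q) (diff-nonNeg (cayley-mono (≤-trans (<⇒≤ 0<1) 1≤q) q≤q′)) K) ⟩
    fromℕ 2 * ((z + δ) * artanhSum K (z + δ))
      ≡⟨ cong (λ w → fromℕ 2 * (w * artanhSum K w)) (solve 2 (λ z w → z :+ (w :- z) := w) refl z (cayley q′)) ⟩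
    fromℕ 2 * (cayley q′ * artanhSum K (cayley q′))
      ≡⟨ sym (*-assoc (fromℕ 2) (cayley q′) (artanhSum K (cayley q′))) ⟩
    logApprox K q′ ∎
    where
    open ≤-Reasoning
    z δ R : ℚ
    z = cayley q
    δ = cayley q′ - z
    R = ∑< K ((z * z) ^_)

  ∑<-nonNeg : ∀ {f : ℕ → ℚ} → (∀ k → 0ℚ ≤ f k) → ∀ K → 0ℚ ≤ ∑< K f
  ∑<-nonNeg h zero    = ≤-refl
  ∑<-nonNeg h (suc K) = +-nonNeg (∑<-nonNeg h K) (h K)

  logApprox-mono : ∀ {q q′} → 1ℚ ≤ q → q ≤ q′ → ∀ K → logApprox K q ≤ logApprox K q′
  logApprox-mono {q} 1≤q q≤q′ K = ≤-trans
    (x≤x+y (*-nonNeg (fromℕ-nonNeg 2) (*-nonNeg (diff-nonNeg (cayley-mono (≤-trans (<⇒≤ 0<1) 1≤q) q≤q′))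
      (∑<-nonNeg (^-nonNeg (square-nonNeg (cayley q))) K))))
    (logApprox-increase 1≤q q≤q′ K)

  1≤fromℕ-suc : ∀ n → 1ℚ ≤ fromℕ (suc n)
  1≤fromℕ-suc n = fromℕ-mono {1} {suc n} (ℕ.s≤s ℕ.z≤n)

  unit-cayley : ∀ n → cayley (fromℕ (suc n)) ≡ 1ℚ - fromℕ 2 * unit n
  unit-cayley n = trans (cayley-inv (fromℕ-nonNeg (suc n)))
    (cong (λ u → 1ℚ - fromℕ 2 * inv u) (trans (+-comm (fromℕ (suc n)) 1ℚ) (sym (fromℕ-suc (suc n)))))

  unit-diff : ∀ n → unit n - unit (suc n) ≡ unit n * unit (suc n)
  unit-diff n = sym (begin
    i * i′ ≡⟨ solve 3 (λ m i i′ → i :* i′ := i :* ((con 1ℚ :+ m) :* i′) :- i′ :* (m :* i)) refl m i i′ ⟩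
    i * ((1ℚ + m) * i′) - i′ * (m * i)
      ≡⟨ cong₂ (λ u v → i * u - i′ * v) (trans (cong (_* i′) (sym (fromℕ-suc (suc (suc n))))) (unit-inv (suc n))) (unit-inv n) ⟩
    i * 1ℚ - i′ * 1ℚ ≡⟨ cong₂ _-_ (*-identityʳ i) (*-identityʳ i′) ⟩
    i - i′ ∎)
    where
    open ≡-Reasoning
    m i i′ : ℚ
    m = fromℕ (suc (suc n))
    i = unit n
    i′ = unit (suc n)

  unit<1 : ∀ n → unit n < 1ℚ
  unit<1 n = subst₂ _<_ (*-identityˡ (unit n)) (unit-inv n)
    (*-monoˡ-<-pos (unit n) {{positive (unit-pos n)}} (fromℕ-mono-< {1} {suc (suc n)} (ℕ.s≤s (ℕ.s≤s ℕ.z≤n))))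

  -- Let i = 1/(n + 2) and i′ = 1/(n + 3). Then z = 1 - 2 i, δ = 2 i i′ and 1 - z² = 4 i (1 - i), so
  -- the gain 2 δ (1 - rᴷ) / (1 - r) equals i (1 - rᴷ) / (1 - i²) because i′ (1 + i) = i. It is at
  -- least i as soon as rᴷ ≤ i².
  logApprox-step : ∀ n → Eventually (λ K → logApprox K (fromℕ (suc n)) + unit n ≤ logApprox K (fromℕ (suc (suc n))))
  logApprox-step n = let K₀ , small = ^-small (square-nonNeg z) r<1 (*-pos (unit-pos n) (unit-pos n)) in
    K₀ , λ K K₀≤K → ≤-trans (+-monoʳ-≤ (logApprox K (fromℕ (suc n))) (gain K (small K K₀≤K)))
      (logApprox-increase (1≤fromℕ-suc n) (fromℕ-mono (ℕ.n≤1+n (suc n))) K)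
    where
    i i′ z r : ℚ
    i = unit n
    i′ = unit (suc n)
    z = cayley (fromℕ (suc n))
    r = z * z
    1-r : 1ℚ - r ≡ fromℕ 4 * (i * (1ℚ - i))
    1-r = trans (cong (λ u → 1ℚ - u * u) (unit-cayley n))
      (solve 1 (λ i → con 1ℚ :- (con 1ℚ :- con (fromℕ 2) :* i) :* (con 1ℚ :- con (fromℕ 2) :* i) := con (fromℕ 4) :* (i :* (con 1ℚ :- i))) refl i)
    0<1-r : 0ℚ < 1ℚ - r
    0<1-r = subst (0ℚ <_) (sym 1-r) (*-pos (fromℕ-mono-< {0} {4} (ℕ.s≤s ℕ.z≤n)) (*-pos (unit-pos n) (diff-pos (unit<1 n))))
    r<1 : r < 1ℚ
    r<1 = subst₂ _<_ (+-identityˡ r) (solve 1 (λ r → (con 1ℚ :- r) :+ r := con 1ℚ) refl r) (+-monoˡ-< r 0<1-r)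
    δ≡ : cayley (fromℕ (suc (suc n))) - z ≡ fromℕ 2 * (i * i′)
    δ≡ = trans (cong₂ _-_ (unit-cayley (suc n)) (unit-cayley n))
      (trans (solve 2 (λ i i′ → (con 1ℚ :- con (fromℕ 2) :* i′) :- (con 1ℚ :- con (fromℕ 2) :* i) := con (fromℕ 2) :* (i :- i′)) refl i i′)
        (cong (fromℕ 2 *_) (unit-diff n)))
    gain : ∀ K → r ^ K ≤ i * i → i ≤ fromℕ 2 * ((cayley (fromℕ (suc (suc n))) - z) * ∑< K (r ^_))
    gain K small = *-cancelˡ-≤-pos (1ℚ - r) {{positive 0<1-r}} (begin
      (1ℚ - r) * i ≡⟨ cong (_* i) 1-r ⟩
      (fromℕ 4 * (i * (1ℚ - i))) * i ≤⟨ ≤-from-diff (subst (0ℚ ≤_) identity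
         (*-nonNeg (*-nonNeg (fromℕ-nonNeg 4) (*-nonNeg (<⇒≤ (unit-pos n)) (<⇒≤ (unit-pos (suc n))))) (diff-nonNeg small))) ⟩
      (fromℕ 4 * (i * i′)) * (1ℚ - r ^ K) ≡⟨ cong (λ u → (fromℕ 4 * (i * i′)) * u) (sym (∑<-geometric r K)) ⟩
      (fromℕ 4 * (i * i′)) * ((1ℚ - r) * ∑< K (r ^_))
        ≡⟨ solve 3 (λ x d R → (con (fromℕ 4) :* x) :* (d :* R) := d :* (con (fromℕ 2) :* ((con (fromℕ 2) :* x) :* R))) refl (i * i′) (1ℚ - r) (∑< K (r ^_)) ⟩
      (1ℚ - r) * (fromℕ 2 * ((fromℕ 2 * (i * i′)) * ∑< K (r ^_)))
        ≡⟨ cong (λ u → (1ℚ - r) * (fromℕ 2 * (u * ∑< K (r ^_)))) (sym δ≡) ⟩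
      (1ℚ - r) * (fromℕ 2 * ((cayley (fromℕ (suc (suc n))) - z) * ∑< K (r ^_))) ∎)
      where
      open ≤-Reasoning
      X : ℚ
      X = r ^ K
      identity : (fromℕ 4 * (i * i′)) * (i * i - X) ≡ (fromℕ 4 * (i * i′)) * (1ℚ - X) - (fromℕ 4 * (i * (1ℚ - i))) * i
      identity = sym (begin-equality
        (fromℕ 4 * (i * i′)) * (1ℚ - X) - (fromℕ 4 * (i * (1ℚ - i))) * i
          ≡⟨ solve 3 (λ i j X → (con (fromℕ 4) :* (i :* j)) :* (con 1ℚ :- X) :- (con (fromℕ 4) :* (i :* (con 1ℚ :- i))) :* i
               := (con (fromℕ 4) :* (i :* j)) :* (i :* i :- X) :+ (con (fromℕ 4) :* i) :* (i :* (i :- i :* j) :- (i :- j))) refl i i′ X ⟩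
        (fromℕ 4 * (i * i′)) * (i * i - X) + (fromℕ 4 * i) * (i * (i - i * i′) - (i - i′))
          ≡⟨ cong₂ (λ w v → (fromℕ 4 * (i * i′)) * (i * i - X) + (fromℕ 4 * i) * (i * (i - w) - v)) (sym (unit-diff n)) (unit-diff n) ⟩
        (fromℕ 4 * (i * i′)) * (i * i - X) + (fromℕ 4 * i) * (i * (i - (i - i′)) - i * i′)
          ≡⟨ solve 3 (λ i j Y → Y :+ (con (fromℕ 4) :* i) :* (i :* (i :- (i :- j)) :- i :* j) := Y) refl i i′ ((fromℕ 4 * (i * i′)) * (i * i - X)) ⟩
        (fromℕ 4 * (i * i′)) * (i * i - X) ∎)

  logApprox-one : ∀ K → logApprox K (fromℕ 1) ≡ 0ℚ
  logApprox-one K = *-zeroˡ (artanhSum K 0ℚ)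

  H≤logApprox : ∀ n → Eventually (λ K → H n ≤ logApprox K (fromℕ (suc n)))
  H≤logApprox zero    = 0 , λ K _ → ≤-reflexive (sym (logApprox-one K))
  H≤logApprox (suc n) =
    let K₀ , h = H≤logApprox n ∧ᴱ logApprox-step n
    in K₀ , λ K K₀≤K → ≤-trans (+-monoˡ-≤ (unit n) (proj₁ (h K K₀≤K))) (proj₂ (h K K₀≤K))

  H-mono : ∀ {m n} → m ℕ.≤ n → H m ≤ H n
  H-mono m≤n = ∑<-mono (λ k → <⇒≤ (unit-pos k)) (ℕ.≤⇒≤′ m≤n)

  unit-anti : ∀ {m n} → m ℕ.≤ n → unit n ≤ unit m
  unit-anti {m} {n} m≤n = recip-anti (<⇒≤ (unit-pos m)) (<⇒≤ (unit-pos n)) (unit-inv m) (unit-inv n)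
    (fromℕ-mono (ℕ.s≤s (ℕ.s≤s m≤n)))

  H-block : ∀ m k {n} → m ℕ.+ k ℕ.≤ suc n → H m + fromℕ k * unit n ≤ H (m ℕ.+ k)
  H-block m zero {n} _ = ≤-reflexive (trans (cong (λ u → H m + u) (*-zeroˡ (unit n))) (trans (+-identityʳ (H m)) (cong H (sym (ℕ.+-identityʳ m)))))
  H-block m (suc k) {n} le = begin
    H m + fromℕ (suc k) * unit n ≡⟨ cong (λ u → H m + u * unit n) (fromℕ-suc k) ⟩
    H m + (1ℚ + fromℕ k) * unit n ≡⟨ solve 3 (λ h k u → h :+ (con 1ℚ :+ k) :* u := (h :+ k :* u) :+ u) refl (H m) (fromℕ k) (unit n) ⟩
    (H m + fromℕ k * unit n) + unit n ≤⟨ +-mono-≤ (H-block m k (ℕ.≤-trans (ℕ.n≤1+n _) le′)) (unit-anti (ℕ.s≤s⁻¹ le′)) ⟩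
    H (m ℕ.+ k) + unit (m ℕ.+ k) ≡⟨ cong H (sym (ℕ.+-suc m k)) ⟩
    H (m ℕ.+ suc k) ∎
    where
    open ≤-Reasoning
    le′ : suc (m ℕ.+ k) ℕ.≤ suc n
    le′ = subst (ℕ._≤ suc n) (ℕ.+-suc m k) le

  -- The classical doubling argument: with m + 1 = 2ˡ the m + 1 terms after H m are each at least
  -- 1/(2 m + 2), so together they contribute at least 1/2.
  log₂≤2H : ∀ l n → 2 ℕ.^ l ℕ.≤ suc n → fromℕ l ≤ fromℕ 2 * H n
  log₂≤2H zero    n _  = *-nonNeg (fromℕ-nonNeg 2) (H-nonNeg n)
  log₂≤2H (suc l) n le with 2 ℕ.^ l in eq
  ... | zero  = contradiction eq (≢-sym (ℕ.<⇒≢ (ℕ.m^n>0 2 l)))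
  ... | suc m = begin
    fromℕ (suc l) ≡⟨ trans (fromℕ-suc l) (+-comm 1ℚ (fromℕ l)) ⟩
    fromℕ l + 1ℚ ≤⟨ +-mono-≤ (log₂≤2H l m (ℕ.≤-reflexive eq)) half ⟩
    fromℕ 2 * H m + fromℕ 2 * (fromℕ (suc m) * unit (m ℕ.+ m)) ≡⟨ sym (*-distribˡ-+ (fromℕ 2) (H m) _) ⟩
    fromℕ 2 * (H m + fromℕ (suc m) * unit (m ℕ.+ m)) ≤⟨ *-monoˡ (fromℕ-nonNeg 2) (H-block m (suc m) (ℕ.≤-reflexive (ℕ.+-suc m m))) ⟩
    fromℕ 2 * H (m ℕ.+ suc m) ≤⟨ *-monoˡ (fromℕ-nonNeg 2) (H-mono m+m≤n) ⟩
    fromℕ 2 * H n ∎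
    where
    open ≤-Reasoning
    m+m≤n : m ℕ.+ suc m ℕ.≤ n
    m+m≤n = ℕ.s≤s⁻¹ (subst (ℕ._≤ suc n) (cong (suc m ℕ.+_) (ℕ.+-identityʳ (suc m))) le)
    half : 1ℚ ≤ fromℕ 2 * (fromℕ (suc m) * unit (m ℕ.+ m))
    half = ≤-reflexive (sym (trans (sym (*-assoc (fromℕ 2) (fromℕ (suc m)) (unit (m ℕ.+ m))))
      (trans (cong (_* unit (m ℕ.+ m)) (trans (sym (fromℕ-* 2 (suc m)))
        (cong fromℕ (trans (cong (suc m ℕ.+_) (ℕ.+-identityʳ (suc m))) (cong suc (ℕ.+-suc m m)))))) (unit-inv (m ℕ.+ m)))))

  -- Comparison with the powers of n and log n

  fromℕ-+ : ∀ m n → fromℕ (m ℕ.+ n) ≡ fromℕ m + fromℕ n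
  fromℕ-+ zero    n = sym (+-identityˡ (fromℕ n))
  fromℕ-+ (suc m) n = trans (fromℕ-suc (m ℕ.+ n)) (trans (cong (λ u → 1ℚ + u) (fromℕ-+ m n))
    (trans (sym (+-assoc 1ℚ (fromℕ m) (fromℕ n))) (cong (_+ fromℕ n) (sym (fromℕ-suc m)))))

  fromℕ-^ : ∀ m k → fromℕ (m ℕ.^ k) ≡ fromℕ m ^ k
  fromℕ-^ m zero    = refl
  fromℕ-^ m (suc k) = trans (fromℕ-* m (m ℕ.^ k)) (cong (fromℕ m *_) (fromℕ-^ m k))

  -- `Π c M` stands in for ((M + 2)/2)ᶜ with c = l/(k + 1). Raising to the power k + 1 removes the
  -- root, and the factor 2 makes up for the telescoping product starting at 2.
  root≤2Π : ∀ {c} → 0ℚ ≤ c → ∀ {k l} → l ℕ.≤ suc k → (∀ {t} → 0ℚ ≤ t → (1ℚ + 1ℚ * t) ^ l ≤ (1ℚ + c * t) ^ suc k) →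
            ∀ x M → x ℕ.^ suc k ℕ.≤ suc (suc M) ℕ.^ l → fromℕ x ≤ fromℕ 2 * Π c M
  root≤2Π {c} 0≤c {k} {l} l≤k h x M le = ^-cancel-≤ (fromℕ-nonNeg x) (*-nonNeg (fromℕ-nonNeg 2) (Π-nonNeg 0≤c M)) k (begin
    fromℕ x ^ suc k ≡⟨ sym (fromℕ-^ x (suc k)) ⟩
    fromℕ (x ℕ.^ suc k) ≤⟨ fromℕ-mono le ⟩
    fromℕ (suc (suc M) ℕ.^ l) ≡⟨ fromℕ-^ (suc (suc M)) l ⟩
    fromℕ (suc (suc M)) ^ l ≡⟨ cong (_^ l) (sym (Π-telescope M)) ⟩
    (fromℕ 2 * Π 1ℚ M) ^ l ≡⟨ ^-distrib-* (fromℕ 2) (Π 1ℚ M) l ⟩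
    fromℕ 2 ^ l * Π 1ℚ M ^ l ≤⟨ *-mono (^-nonNeg (fromℕ-nonNeg 2) l) two (^-nonNeg (Π-nonNeg (<⇒≤ 0<1) M) l) (Π-power 0≤c (suc k) l h M) ⟩
    fromℕ 2 ^ suc k * Π c M ^ suc k ≡⟨ sym (^-distrib-* (fromℕ 2) (Π c M) (suc k)) ⟩
    (fromℕ 2 * Π c M) ^ suc k ∎)
    where
    open ≤-Reasoning
    two : fromℕ 2 ^ l ≤ fromℕ 2 ^ suc k
    two = subst₂ _≤_ (fromℕ-^ 2 l) (fromℕ-^ 2 (suc k)) (fromℕ-mono (ℕ.^-monoʳ-≤ 2 l≤k))

  -- From log 2 ≥ H 1 = 1/2 follows exp ((log 2)/3) ≥ 1 + 1/6, and 7/6 - 1/3 = 5/6.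
  exponent≥5/6 : (ε : ℝ) → 0ℝ <ℝ ε →
    Eventually (λ K → + 5 / 6 ≤ (expApprox K ((+ 1 / 3) * logApprox K (fromℕ 2)) + - (+ 1 / 3)) + seq ε K)
  exponent≥5/6 ε (δ , 0<δ , N , h) =
    let K₀ , p = (2 , λ K le → le) ∧ᴱ (H≤logApprox 1 ∧ᴱ (N , h))
    in K₀ , λ K le → let 2≤K , H≤ , δ≤ = p K le in begin
      + 5 / 6 ≡⟨ sym (+-identityʳ (+ 5 / 6)) ⟩
      + 5 / 6 + 0ℚ ≤⟨ +-mono-≤ (+-monoˡ-≤ (- (+ 1 / 3)) (Π≤expApprox 0≤⅓ 2≤K (*-monoˡ 0≤⅓ H≤)))
                         (≤-trans (<⇒≤ 0<δ) (≤-trans (≤-reflexive (sym (+-identityˡ δ))) δ≤)) ⟩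
      (expApprox K ((+ 1 / 3) * logApprox K (fromℕ 2)) + - (+ 1 / 3)) + seq ε K ∎
    where
    open ≤-Reasoning
    0≤⅓ : 0ℚ ≤ + 1 / 3
    0≤⅓ = nonNegative⁻¹ (+ 1 / 3)

  module _ {n j d : ℕ} (8^j≤n : 8 ℕ.^ j ℕ.≤ suc n) (64^d≤j : 64 ℕ.^ d ℕ.≤ j) where

    -- The harmonic bound yields only half of the binary logarithm; 4ʲ ≤ 8ʲ ≤ n + 1 leaves room for
    -- that loss.
    j≤H : fromℕ j ≤ H n
    j≤H = *-cancelˡ-≤-pos (fromℕ 2) (subst (_≤ fromℕ 2 * H n) (fromℕ-* 2 j) (log₂≤2H (2 ℕ.* j) n
      (ℕ.≤-trans (ℕ.≤-trans (ℕ.^-monoʳ-≤ 2 (ℕ.*-monoˡ-≤ j (ℕ.n≤1+n 2))) (ℕ.≤-reflexive (sym (ℕ.^-*-assoc 2 3 j)))) 8^j≤n)))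

    -- First, (N²)³ = (N³)² ≤ (n + 1)². Second, (32ᵈ)⁶ = (64ᵈ)⁵, where 64ᵈ ≤ j ≤ H n is eventually a
    -- lower bound for log (n + 1), so the outer logarithm is at least that of 64ᵈ. Nested series
    -- are truncated at the same K, so each estimate is needed only for large K.
    powers≥ : (ε : ℝ) → 0ℝ <ℝ ε → Eventually (λ K →
      fromℕ (2 ℕ.^ j ℕ.* 2 ℕ.^ j) ≤ fromℕ 2 * expApprox K ((+ 2 / 3) * logApprox K (fromℕ (suc n))) ×
      fromℕ (32 ℕ.^ d) ≤ fromℕ 2 * expApprox K
        (((expApprox K ((+ 1 / 3) * logApprox K (fromℕ 2)) + - (+ 1 / 3)) + seq ε K) * logApprox K (logApprox K (fromℕ (suc n)))))
    powers≥ ε 0<ε =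
      let K₀ , p = (suc n ℕ.⊔ suc m , λ K le → le) ∧ᴱ (H≤logApprox n ∧ᴱ (H≤logApprox m ∧ᴱ exponent≥5/6 ε 0<ε))
      in K₀ , λ K le → let big , Hn , Hm , z≥ = p K le in
        ≤-trans cube (*-monoˡ (fromℕ-nonNeg 2) (Π≤expApprox 0≤⅔ (⊔-≤ˡ (suc n) (suc m) big) (*-monoˡ 0≤⅔ Hn))) ,
        ≤-trans sixth (*-monoˡ (fromℕ-nonNeg 2) (Π≤expApprox 0≤⅚ (⊔-≤ʳ (suc n) (suc m) big)
          (*-mono 0≤⅚ z≥ (H-nonNeg m) (≤-trans Hm (logApprox-mono (1≤fromℕ-suc m)
            (≤-trans (≤-trans (fromℕ-mono (subst (ℕ._≤ j) eq 64^d≤j)) j≤H) Hn) K)))))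
      where
      m : ℕ
      m = ℕ.pred (64 ℕ.^ d)
      eq : 64 ℕ.^ d ≡ suc m
      eq = sym (ℕ.suc-pred (64 ℕ.^ d) {{ℕ.m^n≢0 64 d}})
      0≤⅔ : 0ℚ ≤ + 2 / 3
      0≤⅔ = nonNegative⁻¹ (+ 2 / 3)
      0≤⅚ : 0ℚ ≤ + 5 / 6
      0≤⅚ = nonNegative⁻¹ (+ 5 / 6)
      cube : fromℕ (2 ℕ.^ j ℕ.* 2 ℕ.^ j) ≤ fromℕ 2 * Π (+ 2 / 3) n
      cube = root≤2Π 0≤⅔ {2} {2} (s≤s (s≤s z≤n)) [1+t]²≤ (2 ℕ.^ j ℕ.* 2 ℕ.^ j) n
        (ℕ.≤-trans (ℕ.≤-reflexive (trans
          (ℕS.solve 1 (λ x → (x ℕS.:* x) ℕS.:* ((x ℕS.:* x) ℕS.:* ((x ℕS.:* x) ℕS.:* ℕS.con 1))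
            ℕS.:= (x ℕS.:* (x ℕS.:* (x ℕS.:* ℕS.con 1))) ℕS.:* ((x ℕS.:* (x ℕS.:* (x ℕS.:* ℕS.con 1))) ℕS.:* ℕS.con 1)) refl (2 ℕ.^ j))
          (cong (ℕ._^ 2) (trans (ℕ.^-*-assoc 2 j 3) (trans (cong (2 ℕ.^_) (ℕ.*-comm j 3)) (sym (ℕ.^-*-assoc 2 3 j)))))))
          (ℕ.^-monoˡ-≤ 2 (ℕ.≤-trans 8^j≤n (ℕ.n≤1+n (suc n)))))
      sixth : fromℕ (32 ℕ.^ d) ≤ fromℕ 2 * Π (+ 5 / 6) m
      sixth = root≤2Π 0≤⅚ {5} {5} (ℕ.n≤1+n 5) [1+t]⁵≤ (32 ℕ.^ d) m
        (ℕ.≤-trans (ℕ.≤-reflexive (trans (ℕ.^-*-assoc 32 d 6) (trans (ℕ.^-*-assoc 2 5 (d ℕ.* 6))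
          (trans (cong (2 ℕ.^_) (ℕS.solve 1 (λ d → ℕS.con 5 ℕS.:* (d ℕS.:* ℕS.con 6) ℕS.:= ℕS.con 6 ℕS.:* (d ℕS.:* ℕS.con 5)) refl d))
            (trans (sym (ℕ.^-*-assoc 2 6 (d ℕ.* 5))) (trans (sym (ℕ.^-*-assoc 64 d 5)) (cong (ℕ._^ 5) eq)))))))
          (ℕ.^-monoˡ-≤ 5 (ℕ.n≤1+n (suc m))))

  -- Choice of the scales and conclusion

  bracket : ∀ b n → 2 ℕ.≤ b → 1 ℕ.≤ n → ∃[ j ] (b ℕ.^ j ℕ.≤ n × n ℕ.< b ℕ.^ suc j)
  bracket b n 2≤b 1≤n = go n (ℕ.<-≤-trans (n<2^n n) (ℕ.^-monoˡ-≤ n 2≤b))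
    where
    go : ∀ m → n ℕ.< b ℕ.^ m → ∃[ j ] (b ℕ.^ j ℕ.≤ n × n ℕ.< b ℕ.^ suc j)
    go zero    n<1 = contradiction 1≤n (ℕ.<⇒≱ n<1)
    go (suc m) n<  with b ℕ.^ m ℕ.≤? n
    ... | yes le = m , le , n<
    ... | no ¬le = go m (ℕ.≰⇒> ¬le)

  bracket-≥ : ∀ b {c j n} → 2 ℕ.≤ b → b ℕ.^ c ℕ.≤ n → n ℕ.< b ℕ.^ suc j → c ℕ.≤ j
  bracket-≥ b {c} {j} 2≤b lo hi = ℕ.≮⇒≥ (λ j<c → ℕ.<⇒≱ hi (ℕ.≤-trans (ℕ.^-monoʳ-≤ b {{ℕ.>-nonZero (ℕ.≤-trans (s≤s z≤n) 2≤b)}} j<c) lo))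

  -- The doubly exponential threshold first forces j ≥ 64ᶜ and then d ≥ c.
  scales : ∀ c n → 8 ℕ.^ (64 ℕ.^ c) ℕ.≤ n →
    ∃[ j ] ∃[ d ] (8 ℕ.^ j ℕ.≤ n × n ℕ.< 8 ℕ.^ suc j × 64 ℕ.^ d ℕ.≤ j × j ℕ.< 64 ℕ.^ suc d × c ℕ.≤ d)
  scales c n le =
    let j , 8^j≤n , n<8^j = bracket 8 n (s≤s (s≤s z≤n)) (ℕ.≤-trans (ℕ.m^n>0 8 (64 ℕ.^ c)) le)
        64^c≤j = bracket-≥ 8 (s≤s (s≤s z≤n)) le n<8^j
        d , 64^d≤j , j<64^d = bracket 64 j (s≤s (s≤s z≤n)) (ℕ.≤-trans (ℕ.m^n>0 64 c) 64^c≤j)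
    in j , d , 8^j≤n , n<8^j , 64^d≤j , j<64^d , bracket-≥ 64 (s≤s (s≤s z≤n)) 64^c≤j j<64^d

  G₃-bound : ∀ {n j d} → n ℕ.< 8 ℕ.^ suc j → 64 ℕ.^ d ℕ.≤ j → j ℕ.< 64 ℕ.^ suc d →
    G₃ n ℕ.≤ π (+ n / 1) ℕ.+ π (+ n / 2) ℕ.+ 4096 ℕ.* (16 ℕ.^ d ℕ.* (2 ℕ.^ j ℕ.* 2 ℕ.^ j))
  G₃-bound {n} {j} {d} n< lo hi =
    let L , uL , L>0 , L≤n , sidon , size = extremal n
    in subst (ℕ._≤ π (+ n / 1) ℕ.+ π (+ n / 2) ℕ.+ 4096 ℕ.* (16 ℕ.^ d ℕ.* (2 ℕ.^ j ℕ.* 2 ℕ.^ j))) size (ℕ.≤-trans (sidon-bound uL L>0 L≤n sidon j d n<′ lo′ hi′)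
         (ℕ.+-mono-≤ (ℕ.+-mono-≤ (∑-prime≤π n) (∑-prime≤π/2 n))
           (ℕ.≤-reflexive (cong (λ u → 4096 ℕ.* (u ℕ.* (2 ℕ.^ j ℕ.* 2 ℕ.^ j))) (sym (ℕ.^-*-assoc 2 4 d))))))
    where
    n<′ : n ℕ.< 8 ℕ.* (2 ℕ.^ j ℕ.* (2 ℕ.^ j ℕ.* 2 ℕ.^ j))
    n<′ = subst (n ℕ.<_) (cong (8 ℕ.*_) (trans (ℕ.^-*-assoc 2 3 j) (trans (cong (2 ℕ.^_) (ℕ.*-comm 3 j)) (trans (sym (ℕ.^-*-assoc 2 j 3))
      (cong (λ u → 2 ℕ.^ j ℕ.* (2 ℕ.^ j ℕ.* u)) (ℕ.*-identityʳ (2 ℕ.^ j))))))) n<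
    lo′ : 2 ℕ.^ (6 ℕ.* d) ℕ.≤ j
    lo′ = subst (ℕ._≤ j) (ℕ.^-*-assoc 2 6 d) lo
    hi′ : j ℕ.< 2 ℕ.^ (6 ℕ.+ 6 ℕ.* d)
    hi′ = subst (j ℕ.<_) (trans (ℕ.^-*-assoc 2 6 (suc d)) (cong (2 ℕ.^_) (ℕ.*-suc 6 d))) hi

  -- Since 32ᵈ = 2ᵈ · 16ᵈ, the spare 2ᵈ has to cover 4096 and the two factors 2 in the hypotheses: 4
  -- · 4096 = 2¹⁴.
  error≤ : ∀ {d x a b} → 14 ℕ.≤ d → 0ℚ ≤ a → fromℕ x ≤ fromℕ 2 * a → fromℕ (32 ℕ.^ d) ≤ fromℕ 2 * b →
           fromℕ (4096 ℕ.* (16 ℕ.^ d ℕ.* x)) ≤ a * b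
  error≤ {d} {x} {a} {b} 14≤d 0≤a ha hb = *-cancelˡ-≤-pos (fromℕ 4) (begin
    fromℕ 4 * fromℕ (4096 ℕ.* (16 ℕ.^ d ℕ.* x)) ≡⟨ sym (fromℕ-* 4 (4096 ℕ.* (16 ℕ.^ d ℕ.* x))) ⟩
    fromℕ (4 ℕ.* (4096 ℕ.* (16 ℕ.^ d ℕ.* x))) ≤⟨ fromℕ-mono nat ⟩
    fromℕ (x ℕ.* 32 ℕ.^ d) ≡⟨ fromℕ-* x (32 ℕ.^ d) ⟩
    fromℕ x * fromℕ (32 ℕ.^ d) ≤⟨ *-mono (fromℕ-nonNeg x) ha (fromℕ-nonNeg (32 ℕ.^ d)) hb ⟩
    (fromℕ 2 * a) * (fromℕ 2 * b) ≡⟨ solve 2 (λ a b → (con (fromℕ 2) :* a) :* (con (fromℕ 2) :* b) := con (fromℕ 4) :* (a :* b)) refl a b ⟩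
    fromℕ 4 * (a * b) ∎)
    where
    open ≤-Reasoning
    nat : 4 ℕ.* (4096 ℕ.* (16 ℕ.^ d ℕ.* x)) ℕ.≤ x ℕ.* 32 ℕ.^ d
    nat = ℕ.≤-trans (ℕ.≤-reflexive (trans (sym (ℕ.*-assoc 4 4096 (16 ℕ.^ d ℕ.* x))) (sym (ℕ.*-assoc (2 ℕ.^ 14) (16 ℕ.^ d) x))))
      (ℕ.≤-trans (ℕ.*-monoˡ-≤ x (ℕ.*-monoˡ-≤ (16 ℕ.^ d) (ℕ.^-monoʳ-≤ 2 14≤d)))
        (ℕ.≤-reflexive (trans (cong (ℕ._* x) (sym (^-distrib d))) (ℕ.*-comm (32 ℕ.^ d) x))))
      where
      ^-distrib : ∀ d → 32 ℕ.^ d ≡ 2 ℕ.^ d ℕ.* 16 ℕ.^ d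
      ^-distrib zero    = refl
      ^-distrib (suc d) = trans (cong (32 ℕ.*_) (^-distrib d)) (trans (ℕ.*-assoc 2 16 (2 ℕ.^ d ℕ.* 16 ℕ.^ d))
        (trans (cong (2 ℕ.*_) (trans (sym (ℕ.*-assoc 16 (2 ℕ.^ d) (16 ℕ.^ d))) (trans (cong (ℕ._* 16 ℕ.^ d) (ℕ.*-comm 16 (2 ℕ.^ d))) (ℕ.*-assoc (2 ℕ.^ d) 16 (16 ℕ.^ d)))))
          (sym (ℕ.*-assoc 2 (2 ℕ.^ d) (16 ℕ.* 16 ℕ.^ d)))))

  bound : ∀ c → 14 ℕ.≤ c → (ε : ℝ) → 0ℝ <ℝ ε → ∀ n → 8 ℕ.^ (64 ℕ.^ c) ℕ.≤ n → (1<n : 1 ℕ.< n) →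
        ℕ⇒ℝ (G₃ n) ≤ℝ
          ℕ⇒ℝ (π (+ n / 1)) +ℝ ℕ⇒ℝ (π (+ n / 2)) +ℝ
          pow (ℕ⇒ℝ n) (ℕ⇒ℝ-pos (1<n⇒0<n 1<n)) (ℚ⇒ℝ (+ 2 / 3)) *ℝ
          pow (logℕ n 1<n) (logℕ-pos n 1<n)
            (pow (ℕ⇒ℝ 2) (ℕ⇒ℝ-pos (s≤s z≤n)) (ℚ⇒ℝ (+ 1 / 3)) -ℝ ℚ⇒ℝ (+ 1 / 3) +ℝ ε)
  bound c 14≤c ε 0<ε (suc n) le 1<n {ε′} 0<ε′ =
    let j , d , 8^j≤n , n<8^j , 64^d≤j , j<64^d , c≤d = scales c (suc n) le
        T = 4096 ℕ.* (16 ℕ.^ d ℕ.* (2 ℕ.^ j ℕ.* 2 ℕ.^ j))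
        K₀ , p = powers≥ {n} {j} {d} 8^j≤n 64^d≤j ε 0<ε ∧ᴱ H≤logApprox n
    in K₀ , λ K K₀≤K → let (ha , hb) , Hn = p K K₀≤K in begin
      fromℕ (G₃ (suc n))             ≤⟨ fromℕ-mono (G₃-bound {suc n} {j} {d} n<8^j 64^d≤j j<64^d) ⟩
      fromℕ (p₁ ℕ.+ p₂ ℕ.+ T)        ≡⟨ trans (fromℕ-+ (p₁ ℕ.+ p₂) T) (cong (_+ fromℕ T) (fromℕ-+ p₁ p₂)) ⟩
      fromℕ p₁ + fromℕ p₂ + fromℕ T  ≤⟨ +-monoʳ-≤ (fromℕ p₁ + fromℕ p₂) (error≤ {d} {2 ℕ.^ j ℕ.* 2 ℕ.^ j} {a K} {b K} (ℕ.≤-trans 14≤c c≤d)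
                                          (expApprox-nonNeg (*-nonNeg (nonNegative⁻¹ (+ 2 / 3)) (≤-trans (H-nonNeg n) Hn)) K) ha hb) ⟩
      -- The approximants already satisfy the inequality for K ≥ K₀, so the slack demanded by `≤ℝ`
      -- is merely added.
      fromℕ p₁ + fromℕ p₂ + a K * b K        ≤⟨ x≤x+y (<⇒≤ 0<ε′) ⟩
      fromℕ p₁ + fromℕ p₂ + a K * b K + ε′   ∎
    where
    open ≤-Reasoning
    p₁ p₂ : ℕ
    p₁ = π (+ suc n / 1)
    p₂ = π (+ suc n / 2)
    a b : ℕ → ℚ
    a K = expApprox K ((+ 2 / 3) * logApprox K (fromℕ (suc n)))
    b K = expApprox K (((expApprox K ((+ 1 / 3) * logApprox K (fromℕ 2)) + - (+ 1 / 3)) + seq ε K) * logApprox K (logApprox K (fromℕ (suc n))))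

open import Defs
open import Data.Nat.Base using (ℕ; _≤_; _<_; s≤s; z≤n)
open import Data.Integer.Base using (+_)
open import Data.Rational.Base using (_/_)
open import Data.Product.Base using (∃-syntax; _,_)
open import Data.Nat.Properties using (≤-refl)

theorem1 : (ε : ℝ) → 0ℝ <ℝ ε →
  ∃[ n₀ ] ((n : ℕ) → n₀ ≤ n → (1<n : 1 < n) →
    ℕ⇒ℝ (G₃ n) ≤ℝ
      ℕ⇒ℝ (π (+ n / 1)) +ℝ ℕ⇒ℝ (π (+ n / 2)) +ℝ
      pow (ℕ⇒ℝ n) (ℕ⇒ℝ-pos (1<n⇒0<n 1<n)) (ℚ⇒ℝ (+ 2 / 3)) *ℝ
      pow (logℕ n 1<n) (logℕ-pos n 1<n)
        (pow (ℕ⇒ℝ 2) (ℕ⇒ℝ-pos (s≤s z≤n)) (ℚ⇒ℝ (+ 1 / 3)) -ℝ ℚ⇒ℝ (+ 1 / 3) +ℝ ε))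
-- Unification fills in the threshold 8 ^ (64 ^ 14), with 14 as required by `error≤`.
theorem1 ε 0<ε = _ , Analysis.bound 14 ≤-refl ε 0<ε
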